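{- For a positive integer $q$ and real $X>0$ let $R(X,q)$ denote the number of residue classes $a \bmod q$ that contain a prime $p<X$ (i.e. for which there is a prime $p<X$ with $p\equiv a \pmod q$). (i) For every fixed $\lambda>0$ there exist $c=c(\lambda)>0$ and $q_0=q_0(\lambda)$ such that for every integer $q\ge q_0$ and every real $X\ge \lambda\,\varphi(q)\log q$ one has $R(X,q)\ge c\,\varphi(q)$. (ii) Conversely, for every fixed $c>0$ there exists $c'=c'(c)>0$ such that, for all sufficiently large $q$, if $R(X,q)\ge c\,\varphi(q)$ then $X\ge c'\,\varphi(q)\log q$.
   Context: $\varphi$ is Euler's totient function and $\log$ is the natural logarithm. "A positive proportion of congruence classes modulo $q$" means at least a fixed positive constant times $\varphi(q)$ of them.
   Formalization: The real parameters λ, c and X (and the constants found) are taken to be rational; the bound X ≥ λφ(q) log q is expressed as q ≤ exp(X/(λφ(q))) via partial sums of the exponential series. -}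

module Defs where

open import Data.Nat as ℕ using (ℕ; zero; suc; NonZero)
open import Data.Nat.DivMod using (_%_)
open import Data.Nat.Primality using (Prime; prime?)
open import Data.Nat.Coprimality using (Coprime; coprime?)
open import Data.Integer using (+_; ∣_∣)
open import Data.Rational as ℚ using (ℚ; _/_; _<_; 0ℚ; 1ℚ; ↥_)
open import Data.Rational.Properties using (_<?_)
open import Data.List using (List; upTo; filter; length)
open import Data.List.Relation.Unary.Any using (any?)
open import Data.Product using (_×_; ∃-syntax)
open import Relation.Nullary.Decidable using (_×-dec_)
open import Relation.Binary.PropositionalEquality using (_≡_)

ℕ→ℚ : ℕ → ℚ
ℕ→ℚ n = (+ n) / 1

-- Euler's totient: number of k ∈ {0,…,q-1} coprime to q
-- (for q ≥ 1 this is #{1 ≤ k ≤ q : gcd(k,q)=1}; note φ(1) = 1 via k = 0)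
φ : ℕ → ℕ
φ q = length (filter (λ k → coprime? k q) (upTo q))

-- natural numbers p with p < X (as rationals); all such p lie below ∣num X∣ + 1
below : ℚ → List ℕ
below X = filter (λ p → ℕ→ℚ p <? X) (upTo (suc ∣ ↥ X ∣))

R : ℚ → (q : ℕ) → .{{NonZero q}} → ℕ
R X q = length (filter (λ a → any? (λ p → prime? p ×-dec (p % q ℕ.≟ a)) (below X)) (upTo q))

expTerm : ℕ → ℚ → ℚ
expTerm zero    t = 1ℚ
expTerm (suc j) t = expTerm j t ℚ.* t ℚ.* ((+ 1) / suc j)

expSum : ℕ → ℚ → ℚ
expSum zero    t = 1ℚ
expSum (suc k) t = expSum k t ℚ.+ expTerm (suc k) t

-- x ≤ exp t  (for t ≥ 0, where the partial sums increase to exp t):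
-- every rational below x is exceeded by some partial sum
_≤exp_ : ℚ → ℚ → Set
x ≤exp t = ∀ (r : ℚ) → r < x → ∃[ k ] (r < expSum k t)

-- μ · log q ≤ X  for μ > 0 and X > 0, expressed as  q ≤ exp (X / μ);
-- the quotient X / μ is referred to as the (unique) t with t * μ = X
LogBound : ℚ → ℕ → ℚ → Set
LogBound μ q X = ∀ (t : ℚ) → t ℚ.* μ ≡ X → ℕ→ℚ q ≤exp t

_·φlog_≤_ : ℚ → ℕ → ℚ → Set
c ·φlog q ≤ X = LogBound (c ℚ.* ℕ→ℚ (φ q)) q X

{-# OPTIONS --safe #-}
-- Let 2 ^ L ≤ q < 2 ^ (L + 1) and N = φ(q) L / J with J a large constant. A prime below N either opens a new residue
-- class mod q or is congruent to a smaller prime, so the number of classes hit is at least π(N) minus the number of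
-- pairs m < N, k ≥ 1 with m and m + kq prime. By Chebyshev π(N) ≫ φ(q) / J. For each k ≤ N / q the Brun–Hooley sieve
-- bounds the pairs by an Euler product, which is O(1 / L²) by Mertens, times q / φ(q), times a factor depending on k
-- that is bounded on average; summing over k gives O(φ(q) / J²) pairs. Conversely at most π(X) classes are hit, so the
-- second part follows from Chebyshev's upper bound and φ(q)² ≥ q / 2.
module Submission where

open import Defs
open import Data.Nat as ℕ using (ℕ; zero; suc; _^_; _!; _∸_; _≥_; NonZero; z≤n; s≤s) renaming (_*_ to _·_)
import Data.Nat.Properties as ℕ
open import Data.Nat.Divisibility as ∣ using (_∣_; _∣?_; divides)
open import Data.Nat.DivMod as DM using (_%_; _/_)
open import Data.Nat.Primality as Pr using (Prime; prime?)
open import Data.Nat.Coprimality as Cop using (Coprime; coprime?)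
import Data.Nat.Combinatorics as Comb
import Data.Nat.Primality.Factorisation as Fact
import Data.Nat.GCD as GCD
open import Data.Nat.Tactic.RingSolver using () renaming (solve-∀ to solve-ℕ)
open import Data.Nat.Induction using (<-rec)
open import Data.Integer as ℤ using ()
import Data.Integer.Properties as ℤ
open import Data.Rational as ℚ using (ℚ; mkℚ; 0ℚ; 1ℚ; _<_; _≤_; _*_; _+_; _-_; -_)
import Data.Rational.Properties as ℚ
import Data.Rational.Unnormalised as ℚᵘ
import Data.Rational.Unnormalised.Properties as ℚᵘ
open import Data.List using (List; []; _∷_; _++_; upTo; filter; length; map)
open import Data.Nat.ListAction using (product)
import Data.List.Properties as List
open import Data.List.Relation.Unary.All as All using (All; []; _∷_)
import Data.List.Relation.Unary.All.Properties as All
open import Data.List.Relation.Unary.Any using (Any; here; there; any?)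
open import Data.List.Relation.Unary.AllPairs using (AllPairs; []; _∷_)
open import Data.List.Membership.Propositional as ∈ using (_∈_)
import Data.List.Membership.Propositional.Properties as ∈
open import Data.Product using (_×_; _,_; proj₁; proj₂; ∃-syntax)
open import Data.Sum using (_⊎_; inj₁; inj₂)
open import Data.Empty using (⊥; ⊥-elim)
open import Function using (_∘_)
open import Relation.Nullary using (¬_; Dec; yes; no; ¬?; contradiction)
open import Relation.Nullary.Decidable using (_×-dec_; dec⇒maybe)
open import Relation.Unary using (Pred; Decidable)
open import Relation.Binary.PropositionalEquality using (_≡_; refl; sym; trans; cong; cong₂; subst; subst₂; module ≡-Reasoning)
open import Relation.Binary.Definitions using (tri<; tri≈; tri>)
open import Tactic.RingSolver.Core.AlmostCommutativeRing using (AlmostCommutativeRing; fromCommutativeRing)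
open import Tactic.RingSolver using (solve-∀)
import Level

-- Arithmetic of ℚ

-- The two counts scale differently in J: the primes give at least a constant times φ(q)/J, the
-- congruent pairs at most a constant times φ(q)/J². A large J thus absorbs every constant lost on
-- the way, but no unbounded factor: the full saving 1/L² is needed, and the remainders of the
-- sieves for all k together must stay below φ(q)/(24J), where only φ(q) ≥ √(q/2) is at hand. So the
-- sieve stops at 2^(H·2^r), a small fixed power of q with 2^r comparable to L. Brun-Hooley fits
-- this: for each block of primes an odd truncation of inclusion-exclusion majorises the indicator,
-- majorants are nonnegative and can be multiplied, and the remainder is merely the number of terms.
-- All sizes are measured in powers of 2; the exponential series is met only where `LogBound` is
-- compared with such powers, at the cost of one more constant.

ℚ-ring : AlmostCommutativeRing Level.zero Level.zero
ℚ-ring = fromCommutativeRing ℚ.+-*-commutativeRing (λ x → dec⇒maybe (0ℚ ℚ.≟ x))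

toℚᵘ-/ : ∀ i n → ℚ.toℚᵘ (i ℚ./ suc n) ℚᵘ.≃ ℚᵘ.mkℚᵘ i n
toℚᵘ-/ i n = ℚ.toℚᵘ-fromℚᵘ (ℚᵘ.mkℚᵘ i n)

-- ι and recip are opaque because their unfolding to normalised fractions defeats unification; note recip 0 = 0.
opaque
  ι : ℕ → ℚ
  ι n = ℕ→ℚ n

  recip : ℕ → ℚ
  recip zero    = 0ℚ
  recip (suc n) = (ℤ.+ 1) ℚ./ suc n

  ι≡ℕ→ℚ : ∀ n → ι n ≡ ℕ→ℚ n
  ι≡ℕ→ℚ n = refl

  ι-0 : ι 0 ≡ 0ℚ
  ι-0 = refl

  ι-1 : ι 1 ≡ 1ℚ
  ι-1 = refl

  recip-0 : recip 0 ≡ 0ℚ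
  recip-0 = refl

  recip-suc : ∀ n → recip (suc n) ≡ (ℤ.+ 1) ℚ./ suc n
  recip-suc n = refl

  ι-+ : ∀ m n → ι (m ℕ.+ n) ≡ ι m + ι n
  ι-+ m n = ℚ.toℚᵘ-injective (begin
    ℚ.toℚᵘ (ι (m ℕ.+ n)) ≈⟨ toℚᵘ-/ (ℤ.+ (m ℕ.+ n)) 0 ⟩
    ℚᵘ.mkℚᵘ (ℤ.+ (m ℕ.+ n)) 0 ≈⟨ ℚᵘ.*≡* (trans (ℤ.*-identityʳ _) (sym (trans (ℤ.*-identityʳ _) (cong₂ ℤ._+_ (ℤ.*-identityʳ (ℤ.+ m)) (ℤ.*-identityʳ (ℤ.+ n)))))) ⟩
    ℚᵘ.mkℚᵘ (ℤ.+ m) 0 ℚᵘ.+ ℚᵘ.mkℚᵘ (ℤ.+ n) 0 ≈⟨ ℚᵘ.+-cong (toℚᵘ-/ (ℤ.+ m) 0) (toℚᵘ-/ (ℤ.+ n) 0) ⟨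
    ℚ.toℚᵘ (ι m) ℚᵘ.+ ℚ.toℚᵘ (ι n) ≈⟨ ℚ.toℚᵘ-homo-+ (ι m) (ι n) ⟨
    ℚ.toℚᵘ (ι m + ι n) ∎)
    where open ℚᵘ.≃-Reasoning

  ι-* : ∀ m n → ι (m · n) ≡ ι m * ι n
  ι-* m n = ℚ.toℚᵘ-injective (begin
    ℚ.toℚᵘ (ι (m · n)) ≈⟨ toℚᵘ-/ (ℤ.+ (m · n)) 0 ⟩
    ℚᵘ.mkℚᵘ (ℤ.+ (m · n)) 0 ≈⟨ ℚᵘ.*≡* (cong (ℤ._* ℤ.+ 1) (ℤ.pos-* m n)) ⟩
    ℚᵘ.mkℚᵘ (ℤ.+ m) 0 ℚᵘ.* ℚᵘ.mkℚᵘ (ℤ.+ n) 0 ≈⟨ ℚᵘ.*-cong (toℚᵘ-/ (ℤ.+ m) 0) (toℚᵘ-/ (ℤ.+ n) 0) ⟨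
    ℚ.toℚᵘ (ι m) ℚᵘ.* ℚ.toℚᵘ (ι n) ≈⟨ ℚ.toℚᵘ-homo-* (ι m) (ι n) ⟨
    ℚ.toℚᵘ (ι m * ι n) ∎)
    where open ℚᵘ.≃-Reasoning

  ι-mono-≤ : ∀ {m n} → m ℕ.≤ n → ι m ≤ ι n
  ι-mono-≤ {m} {n} m≤n = ℚ.toℚᵘ-cancel-≤ (begin
    ℚ.toℚᵘ (ι m) ≃⟨ toℚᵘ-/ (ℤ.+ m) 0 ⟩
    ℚᵘ.mkℚᵘ (ℤ.+ m) 0 ≤⟨ ℚᵘ.*≤* (ℤ.*-monoʳ-≤-nonNeg (ℤ.+ 1) (ℤ.+≤+ m≤n)) ⟩
    ℚᵘ.mkℚᵘ (ℤ.+ n) 0 ≃⟨ toℚᵘ-/ (ℤ.+ n) 0 ⟨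
    ℚ.toℚᵘ (ι n) ∎)
    where open ℚᵘ.≤-Reasoning

  ι-mono-< : ∀ {m n} → m ℕ.< n → ι m < ι n
  ι-mono-< {m} {n} m<n = ℚ.toℚᵘ-cancel-< (begin-strict
    ℚ.toℚᵘ (ι m) ≃⟨ toℚᵘ-/ (ℤ.+ m) 0 ⟩
    ℚᵘ.mkℚᵘ (ℤ.+ m) 0 <⟨ ℚᵘ.*<* (ℤ.*-monoʳ-<-pos (ℤ.+ 1) (ℤ.+<+ m<n)) ⟩
    ℚᵘ.mkℚᵘ (ℤ.+ n) 0 ≃⟨ toℚᵘ-/ (ℤ.+ n) 0 ⟨
    ℚ.toℚᵘ (ι n) ∎)
    where open ℚᵘ.≤-Reasoning

  ι-recip-suc : ∀ n → ι (suc n) * recip (suc n) ≡ 1ℚ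
  ι-recip-suc n = ℚ.toℚᵘ-injective (begin
    ℚ.toℚᵘ (ι (suc n) * recip (suc n)) ≈⟨ ℚ.toℚᵘ-homo-* (ι (suc n)) (recip (suc n)) ⟩
    ℚ.toℚᵘ (ι (suc n)) ℚᵘ.* ℚ.toℚᵘ (recip (suc n)) ≈⟨ ℚᵘ.*-cong (toℚᵘ-/ (ℤ.+ suc n) 0) (toℚᵘ-/ (ℤ.+ 1) n) ⟩
    ℚᵘ.mkℚᵘ (ℤ.+ suc n) 0 ℚᵘ.* ℚᵘ.mkℚᵘ (ℤ.+ 1) n ≈⟨ ℚᵘ.*≡* (trans (ℤ.*-identityʳ _) (trans (ℤ.*-identityʳ (ℤ.+ suc n)) (sym (trans (ℤ.*-identityˡ _) (cong ℤ.+_ (ℕ.*-identityˡ (suc n))))))) ⟩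
    ℚ.toℚᵘ 1ℚ ∎)
    where open ℚᵘ.≃-Reasoning

  0≤recip : ∀ n → 0ℚ ≤ recip n
  0≤recip zero    = ℚ.≤-refl
  0≤recip (suc n) = ℚ.nonNegative⁻¹ (recip (suc n)) {{ℚ.normalize-nonNeg 1 (suc n)}}

  0<recip : ∀ n .{{_ : NonZero n}} → 0ℚ < recip n
  0<recip (suc n) = ℚ.positive⁻¹ (recip (suc n)) {{ℚ.normalize-pos 1 (suc n)}}

ι-cancel-≤ : ∀ {m n} → ι m ≤ ι n → m ℕ.≤ n
ι-cancel-≤ {m} {n} h with m ℕ.≤? n
... | yes m≤n = m≤n
... | no  m≰n = ⊥-elim (ℚ.<-irrefl refl (ℚ.<-≤-trans (ι-mono-< (ℕ.≰⇒> m≰n)) h))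

0≤ι : ∀ n → 0ℚ ≤ ι n
0≤ι n = subst (_≤ ι n) ι-0 (ι-mono-≤ z≤n)

0<ι : ∀ n .{{_ : NonZero n}} → 0ℚ < ι n
0<ι n = subst (_< ι n) ι-0 (ι-mono-< (ℕ.>-nonZero⁻¹ n))

ι-suc : ∀ n → ι (suc n) ≡ 1ℚ + ι n
ι-suc n = trans (ι-+ 1 n) (cong (_+ ι n) ι-1)

ι-recip : ∀ n .{{_ : NonZero n}} → ι n * recip n ≡ 1ℚ
ι-recip (suc n) = ι-recip-suc n

0≤1 : 0ℚ ≤ 1ℚ
0≤1 = subst (0ℚ ≤_) ι-1 (0≤ι 1)

*-mono-≤ : ∀ {a b c d} → 0ℚ ≤ a → a ≤ b → 0ℚ ≤ c → c ≤ d → a * c ≤ b * d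
*-mono-≤ {a} {b} {c} {d} 0≤a a≤b 0≤c c≤d =
  ℚ.≤-trans (ℚ.*-monoʳ-≤-nonNeg c {{ℚ.nonNegative 0≤c}} a≤b)
             (ℚ.*-monoˡ-≤-nonNeg b {{ℚ.nonNegative (ℚ.≤-trans 0≤a a≤b)}} c≤d)

*-monoʳ : ∀ {a c d} → 0ℚ ≤ a → c ≤ d → a * c ≤ a * d
*-monoʳ {a} 0≤a c≤d = ℚ.*-monoˡ-≤-nonNeg a {{ℚ.nonNegative 0≤a}} c≤d

*-monoˡ : ∀ {a c d} → 0ℚ ≤ a → c ≤ d → c * a ≤ d * a
*-monoˡ {a} 0≤a c≤d = ℚ.*-monoʳ-≤-nonNeg a {{ℚ.nonNegative 0≤a}} c≤d

0≤* : ∀ {a b} → 0ℚ ≤ a → 0ℚ ≤ b → 0ℚ ≤ a * b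
0≤* {a} {b} 0≤a 0≤b = subst (_≤ a * b) (ℚ.*-zeroʳ a) (*-monoʳ 0≤a 0≤b)

0<* : ∀ {a b} → 0ℚ < a → 0ℚ < b → 0ℚ < a * b
0<* {a} {b} 0<a 0<b = subst (_< a * b) (ℚ.*-zeroʳ a) (ℚ.*-monoʳ-<-pos a {{ℚ.positive 0<a}} 0<b)

0≤+ : ∀ {a b} → 0ℚ ≤ a → 0ℚ ≤ b → 0ℚ ≤ a + b
0≤+ {a} {b} 0≤a 0≤b = ℚ.+-mono-≤ 0≤a 0≤b

*-cancel-≤ : ∀ {a b c} → 0ℚ < c → c * a ≤ c * b → a ≤ b
*-cancel-≤ {c = c} 0<c h = ℚ.*-cancelˡ-≤-pos c {{ℚ.positive 0<c}} h

0≤b-a : ∀ {a b} → a ≤ b → 0ℚ ≤ b - a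
0≤b-a {a} {b} a≤b = subst (_≤ b - a) (ℚ.+-inverseʳ a) (ℚ.+-monoˡ-≤ (- a) a≤b)

-- Most inequalities b ≥ a below are obtained by exhibiting b − a as a manifestly nonnegative expression.
≤-by : ∀ {a b s} → b ≡ a + s → 0ℚ ≤ s → a ≤ b
≤-by {a} {b} {s} eq 0≤s = subst₂ _≤_ (ℚ.+-identityʳ a) (sym eq) (ℚ.+-monoʳ-≤ a 0≤s)

a≤a+s : ∀ {a s} → 0ℚ ≤ s → a ≤ a + s
a≤a+s = ≤-by refl

recip-unique : ∀ n .{{_ : NonZero n}} {y} → ι n * y ≡ 1ℚ → y ≡ recip n
recip-unique n {y} eq = begin
  y ≡⟨ ℚ.*-identityˡ y ⟨
  1ℚ * y ≡⟨ cong (_* y) (trans (ℚ.*-comm (recip n) (ι n)) (ι-recip n)) ⟨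
  recip n * ι n * y ≡⟨ ℚ.*-assoc (recip n) (ι n) y ⟩
  recip n * (ι n * y) ≡⟨ cong (recip n *_) eq ⟩
  recip n * 1ℚ ≡⟨ ℚ.*-identityʳ (recip n) ⟩
  recip n ∎
  where open ≡-Reasoning

recip-* : ∀ m n → recip (m · n) ≡ recip m * recip n
recip-* zero    n = trans recip-0 (sym (trans (cong (_* recip n) recip-0) (ℚ.*-zeroˡ (recip n))))
recip-* (suc m) zero = trans (cong recip (ℕ.*-zeroʳ m)) (trans recip-0 (sym (trans (cong (recip (suc m) *_) recip-0) (ℚ.*-zeroʳ (recip (suc m))))))
recip-* (suc m) (suc n) = sym (recip-unique (suc m · suc n) (begin
  ι (suc m · suc n) * (recip (suc m) * recip (suc n)) ≡⟨ cong (_* (recip (suc m) * recip (suc n))) (ι-* (suc m) (suc n)) ⟩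
  ι (suc m) * ι (suc n) * (recip (suc m) * recip (suc n)) ≡⟨ lem (ι (suc m)) (ι (suc n)) (recip (suc m)) (recip (suc n)) ⟩
  (ι (suc m) * recip (suc m)) * (ι (suc n) * recip (suc n)) ≡⟨ cong₂ _*_ (ι-recip (suc m)) (ι-recip (suc n)) ⟩
  1ℚ * 1ℚ ≡⟨⟩
  1ℚ ∎))
  where
  open ≡-Reasoning
  lem : ∀ a b c d → a * b * (c * d) ≡ (a * c) * (b * d)
  lem = solve-∀ ℚ-ring

recip-≤ : ∀ {m n} .{{_ : NonZero m}} → m ℕ.≤ n → recip n ≤ recip m
recip-≤ {m} {n} m≤n = *-cancel-≤ (0<ι m) (*-cancel-≤ (0<ι n) (begin
  ι n * (ι m * recip n) ≡⟨ lem (ι n) (ι m) (recip n) ⟩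
  ι m * (ι n * recip n) ≡⟨ cong (ι m *_) (ι-recip n) ⟩
  ι m * 1ℚ ≡⟨ ℚ.*-identityʳ (ι m) ⟩
  ι m ≤⟨ ι-mono-≤ m≤n ⟩
  ι n ≡⟨ ℚ.*-identityʳ (ι n) ⟨
  ι n * 1ℚ ≡⟨ cong (ι n *_) (ι-recip m) ⟨
  ι n * (ι m * recip m) ∎))
  where
  open ℚ.≤-Reasoning
  instance
    n≢0 : NonZero n
    n≢0 = ℕ.>-nonZero (ℕ.<-≤-trans (ℕ.>-nonZero⁻¹ m) m≤n)
  lem : ∀ a b c → a * (b * c) ≡ b * (a * c)
  lem = solve-∀ ℚ-ring

2ℚ : ℚ
2ℚ = 1ℚ + 1ℚ

0≤2 : 0ℚ ≤ 2ℚ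
0≤2 = 0≤+ 0≤1 0≤1

opaque
  unfolding ι recip

  recip-1 : recip 1 ≡ 1ℚ
  recip-1 = refl

  ι-2 : ι 2 ≡ 2ℚ
  ι-2 = refl

  ι-16 : ι 16 ≡ 2ℚ * 2ℚ * (2ℚ * 2ℚ)
  ι-16 = refl

  ½+½≡1 : recip 2 + recip 2 ≡ 1ℚ
  ½+½≡1 = refl

2·recip≤1 : ∀ {n} → 2 ℕ.≤ n → recip n + recip n ≤ 1ℚ
2·recip≤1 2≤n = ℚ.≤-trans (ℚ.+-mono-≤ (recip-≤ 2≤n) (recip-≤ 2≤n)) (ℚ.≤-reflexive ½+½≡1)

recip≤1 : ∀ {n} → 2 ℕ.≤ n → recip n ≤ 1ℚ
recip≤1 {n} 2≤n = ℚ.≤-trans (≤-by refl (0≤recip n)) (2·recip≤1 2≤n)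

abs-≤ : ∀ {x e} → - e ≤ x → x ≤ e → ℚ.∣ x ∣ ≤ e
abs-≤ {x} {e} l u with ℚ.∣p∣≡p∨∣p∣≡-p x
... | inj₁ eq = subst (_≤ e) (sym eq) u
... | inj₂ eq = subst₂ _≤_ (sym eq) (neg-neg e) (ℚ.neg-antimono-≤ l)
  where
  neg-neg : ∀ e → - (- e) ≡ e
  neg-neg = solve-∀ ℚ-ring

x≤∣x∣ : ∀ x → x ≤ ℚ.∣ x ∣
x≤∣x∣ x with ℚ.≤-total 0ℚ x
... | inj₁ 0≤x = ℚ.≤-reflexive (sym (ℚ.0≤p⇒∣p∣≡p 0≤x))
... | inj₂ x≤0 = ℚ.≤-trans x≤0 (ℚ.0≤∣p∣ x)

-- Finite sums and indicators

∑ : ℕ → (ℕ → ℚ) → ℚ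
∑ zero    f = 0ℚ
∑ (suc n) f = ∑ n f + f n

∑-cong : ∀ n {f g : ℕ → ℚ} → (∀ i → i ℕ.< n → f i ≡ g i) → ∑ n f ≡ ∑ n g
∑-cong zero    h = refl
∑-cong (suc n) h = cong₂ _+_ (∑-cong n (λ i i<n → h i (ℕ.m<n⇒m<1+n i<n))) (h n ℕ.≤-refl)

∑-mono : ∀ n {f g : ℕ → ℚ} → (∀ i → i ℕ.< n → f i ≤ g i) → ∑ n f ≤ ∑ n g
∑-mono zero    h = ℚ.≤-refl
∑-mono (suc n) h = ℚ.+-mono-≤ (∑-mono n (λ i i<n → h i (ℕ.m<n⇒m<1+n i<n))) (h n ℕ.≤-refl)

∑-nonneg : ∀ n {f : ℕ → ℚ} → (∀ i → 0ℚ ≤ f i) → 0ℚ ≤ ∑ n f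
∑-nonneg zero    h = ℚ.≤-refl
∑-nonneg (suc n) h = 0≤+ (∑-nonneg n h) (h n)

∑-mono-length : ∀ {m n} {f : ℕ → ℚ} → (∀ i → 0ℚ ≤ f i) → m ℕ.≤ n → ∑ m f ≤ ∑ n f
∑-mono-length {m} {f = f} h m≤n = go (ℕ.≤⇒≤′ m≤n)
  where
  go : ∀ {n} → m ℕ.≤′ n → ∑ m f ≤ ∑ n f
  go ℕ.≤′-refl                 = ℚ.≤-refl
  go (ℕ.≤′-step {n = n} m≤′n)  = ℚ.≤-trans (go m≤′n) (a≤a+s (h n))

∑-+ : ∀ n (f g : ℕ → ℚ) → ∑ n (λ i → f i + g i) ≡ ∑ n f + ∑ n g
∑-+ zero    f g = refl
∑-+ (suc n) f g = trans (cong (_+ (f n + g n)) (∑-+ n f g)) (lem (∑ n f) (∑ n g) (f n) (g n))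
  where
  lem : ∀ a b c d → a + b + (c + d) ≡ a + c + (b + d)
  lem = solve-∀ ℚ-ring

∑-sub : ∀ n (f g : ℕ → ℚ) → ∑ n (λ i → f i - g i) ≡ ∑ n f - ∑ n g
∑-sub zero    f g = refl
∑-sub (suc n) f g = trans (cong (_+ (f n - g n)) (∑-sub n f g)) (lem (∑ n f) (∑ n g) (f n) (g n))
  where
  lem : ∀ a b c d → a - b + (c - d) ≡ a + c - (b + d)
  lem = solve-∀ ℚ-ring

∑-*ˡ : ∀ n a (f : ℕ → ℚ) → ∑ n (λ i → a * f i) ≡ a * ∑ n f
∑-*ˡ zero    a f = sym (ℚ.*-zeroʳ a)
∑-*ˡ (suc n) a f = trans (cong (_+ a * f n) (∑-*ˡ n a f)) (sym (ℚ.*-distribˡ-+ a (∑ n f) (f n)))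

∑-const : ∀ n a → ∑ n (λ _ → a) ≡ ι n * a
∑-const zero    a = sym (trans (cong (_* a) ι-0) (ℚ.*-zeroˡ a))
∑-const (suc n) a = trans (cong (_+ a) (∑-const n a)) (trans (lem (ι n) a) (cong (_* a) (sym (ι-suc n))))
  where
  lem : ∀ x a → x * a + a ≡ (1ℚ + x) * a
  lem = solve-∀ ℚ-ring

∑-split : ∀ m n (f : ℕ → ℚ) → ∑ (m ℕ.+ n) f ≡ ∑ m f + ∑ n (λ i → f (m ℕ.+ i))
∑-split m zero    f = trans (cong (λ k → ∑ k f) (ℕ.+-identityʳ m)) (sym (ℚ.+-identityʳ (∑ m f)))
∑-split m (suc n) f = begin
  ∑ (m ℕ.+ suc n) f ≡⟨ cong (λ k → ∑ k f) (ℕ.+-suc m n) ⟩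
  ∑ (m ℕ.+ n) f + f (m ℕ.+ n) ≡⟨ cong (_+ f (m ℕ.+ n)) (∑-split m n f) ⟩
  ∑ m f + ∑ n (λ i → f (m ℕ.+ i)) + f (m ℕ.+ n) ≡⟨ ℚ.+-assoc (∑ m f) _ _ ⟩
  ∑ m f + (∑ n (λ i → f (m ℕ.+ i)) + f (m ℕ.+ n)) ∎
  where open ≡-Reasoning

∑-swap : ∀ m n (f : ℕ → ℕ → ℚ) → ∑ m (λ i → ∑ n (f i)) ≡ ∑ n (λ j → ∑ m (λ i → f i j))
∑-swap zero    n f = sym (trans (∑-const n 0ℚ) (ℚ.*-zeroʳ (ι n)))
∑-swap (suc m) n f = trans (cong (_+ ∑ n (f m)) (∑-swap m n f)) (sym (∑-+ n (λ j → ∑ m (λ i → f i j)) (f m)))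

𝟙 : ∀ {a} {A : Set a} → Dec A → ℚ
𝟙 (yes _) = 1ℚ
𝟙 (no  _) = 0ℚ

𝟙-yes : ∀ {a} {A : Set a} (d : Dec A) → A → 𝟙 d ≡ 1ℚ
𝟙-yes (yes _) _ = refl
𝟙-yes (no ¬x) x = contradiction x ¬x

𝟙-no : ∀ {a} {A : Set a} (d : Dec A) → ¬ A → 𝟙 d ≡ 0ℚ
𝟙-no (yes x) ¬x = contradiction x ¬x
𝟙-no (no  _) _  = refl

0≤𝟙 : ∀ {a} {A : Set a} (d : Dec A) → 0ℚ ≤ 𝟙 d
0≤𝟙 (yes _) = 0≤1
0≤𝟙 (no  _) = ℚ.≤-refl

𝟙≤1 : ∀ {a} {A : Set a} (d : Dec A) → 𝟙 d ≤ 1ℚ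
𝟙≤1 (yes _) = ℚ.≤-refl
𝟙≤1 (no  _) = 0≤1

𝟙-cong : ∀ {a b} {A : Set a} {B : Set b} (d : Dec A) (e : Dec B) → (A → B) → (B → A) → 𝟙 d ≡ 𝟙 e
𝟙-cong (yes x) e f g = sym (𝟙-yes e (f x))
𝟙-cong (no ¬x) e f g = sym (𝟙-no e (¬x ∘ g))

𝟙-mono : ∀ {a b} {A : Set a} {B : Set b} (d : Dec A) (e : Dec B) → (A → B) → 𝟙 d ≤ 𝟙 e
𝟙-mono (yes x) e f = ℚ.≤-reflexive (sym (𝟙-yes e (f x)))
𝟙-mono (no ¬x) e f = 0≤𝟙 e

𝟙-× : ∀ {a b} {A : Set a} {B : Set b} (d : Dec A) (e : Dec B) → 𝟙 (d ×-dec e) ≡ 𝟙 d * 𝟙 e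
𝟙-× (yes x) (yes y) = refl
𝟙-× (yes x) (no ¬y) = refl
𝟙-× (no ¬x) (yes y) = refl
𝟙-× (no ¬x) (no ¬y) = refl

χ : ℕ → ℕ → ℚ
χ d n = 𝟙 (d ∣? n)

-- The witness is ⌈x/e⌉, since 0 counts as a multiple; one m serves every weight `g`.
∑-multiples : ∀ e .{{_ : NonZero e}} x → ∃[ m ] (x ℕ.≤ e · m × e · m ℕ.< x ℕ.+ e ×
  (∀ (g : ℕ → ℚ) → ∑ x (λ n → χ e n * g n) ≡ ∑ m (λ i → g (e · i))))
∑-multiples e zero = 0 , z≤n , subst (ℕ._< e) (sym (ℕ.*-zeroʳ e)) (ℕ.>-nonZero⁻¹ e) , λ g → refl
∑-multiples e (suc x) with ∑-multiples e x | e ∣? x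
... | m , x≤em , em<x+e , sums | yes (divides k x≡ke) =
  suc m , subst (suc x ℕ.≤_) x+e≡ (ℕ.m<m+n x (ℕ.>-nonZero⁻¹ e)) ,
  subst (ℕ._< suc x ℕ.+ e) x+e≡ ℕ.≤-refl ,
  λ g → cong₂ _+_ (sums g) (trans (ℚ.*-identityˡ (g x)) (cong g x≡em))
  where
  k≤m : k ℕ.≤ m
  k≤m = ℕ.*-cancelˡ-≤ e (subst (ℕ._≤ e · m) (trans x≡ke (ℕ.*-comm k e)) x≤em)
  m<1+k : m ℕ.< suc k
  m<1+k = ℕ.*-cancelˡ-< e m (suc k)
    (subst (e · m ℕ.<_) (trans (cong (ℕ._+ e) x≡ke) (trans (ℕ.+-comm (k · e) e) (ℕ.*-comm (suc k) e))) em<x+e)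
  x≡em : x ≡ e · m
  x≡em = trans x≡ke (trans (ℕ.*-comm k e) (cong (e ·_) (ℕ.≤-antisym k≤m (ℕ.≤-pred m<1+k))))
  x+e≡ : x ℕ.+ e ≡ e · suc m
  x+e≡ = trans (cong (ℕ._+ e) x≡em) (trans (ℕ.+-comm (e · m) e) (sym (ℕ.*-suc e m)))
... | m , x≤em , em<x+e , sums | no e∤x =
  m , ℕ.≤∧≢⇒< x≤em (λ x≡em → e∤x (divides m (trans x≡em (ℕ.*-comm e m)))) ,
  ℕ.m<n⇒m<1+n em<x+e ,
  λ g → trans (cong₂ _+_ (sums g) (ℚ.*-zeroˡ (g x))) (ℚ.+-identityʳ _)

∑-χ-bounds : ∀ e .{{_ : NonZero e}} x → (ι x ≤ ι e * ∑ x (χ e)) × (ι e * ∑ x (χ e) ≤ ι x + ι e)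
∑-χ-bounds e x with ∑-multiples e x
... | m , x≤em , em<x+e , sums =
  subst (ι x ≤_) (sym count) (ι-mono-≤ x≤em) ,
  subst₂ _≤_ (sym count) (ι-+ x e) (ι-mono-≤ (ℕ.<⇒≤ em<x+e))
  where
  open ≡-Reasoning
  count : ι e * ∑ x (χ e) ≡ ι (e · m)
  count = begin
    ι e * ∑ x (χ e) ≡⟨ cong (ι e *_) (∑-cong x (λ i _ → sym (ℚ.*-identityʳ (χ e i)))) ⟩
    ι e * ∑ x (λ n → χ e n * 1ℚ) ≡⟨ cong (ι e *_) (sums (λ _ → 1ℚ)) ⟩
    ι e * ∑ m (λ _ → 1ℚ) ≡⟨ cong (ι e *_) (trans (∑-const m 1ℚ) (ℚ.*-identityʳ (ι m))) ⟩
    ι e * ι m ≡⟨ ι-* e m ⟨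
    ι (e · m) ∎

-- An initial segment of length x contains between x/e and x/e + 1 multiples of e. Subtracting the
-- segment of length c from that of length c + n leaves an error of at most 1, whatever c is.
progression-count : ∀ e .{{_ : NonZero e}} c n → ℚ.∣ ∑ n (λ i → χ e (c ℕ.+ i)) - ι n * recip e ∣ ≤ 1ℚ
progression-count e c n = abs-≤
  (*-cancel-≤ (0<ι e) (≤-by (lower (ι e) (ι n) (recip e) (ι c) S (∑ c (χ e)) (ι-recip e))
    (0≤+ (0≤b-a (subst₂ (λ x y → x ≤ ι e * y) (ι-+ c n) S+ (proj₁ (∑-χ-bounds e (c ℕ.+ n))))) (0≤b-a (proj₂ (∑-χ-bounds e c))))))
  (*-cancel-≤ (0<ι e) (≤-by (upper (ι e) (ι n) (recip e) (ι c) S (∑ c (χ e)) (ι-recip e))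
    (0≤+ (0≤b-a (subst₂ (λ x y → ι e * y ≤ x + ι e) (ι-+ c n) S+ (proj₂ (∑-χ-bounds e (c ℕ.+ n))))) (0≤b-a (proj₁ (∑-χ-bounds e c))))))
  where
  S = ∑ n (λ i → χ e (c ℕ.+ i))
  S+ : ∑ (c ℕ.+ n) (χ e) ≡ S + ∑ c (χ e)
  S+ = trans (∑-split c n (χ e)) (ℚ.+-comm (∑ c (χ e)) S)
  lower : ∀ e n r c s t → e * r ≡ 1ℚ → e * (s - n * r) ≡ e * (- 1ℚ) + ((e * (s + t) - (c + n)) + (c + e - e * t))
  lower e n r c s t er≡1 = trans (lem₁ e n r s) (trans (cong (λ x → e * s - n * x) er≡1) (lem₂ e n c s t))
    where
    lem₁ : ∀ e n r s → e * (s - n * r) ≡ e * s - n * (e * r)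
    lem₁ = solve-∀ ℚ-ring
    lem₂ : ∀ e n c s t → e * s - n * 1ℚ ≡ e * (- 1ℚ) + ((e * (s + t) - (c + n)) + (c + e - e * t))
    lem₂ = solve-∀ ℚ-ring
  upper : ∀ e n r c s t → e * r ≡ 1ℚ → e * 1ℚ ≡ e * (s - n * r) + ((c + n + e - e * (s + t)) + (e * t - c))
  upper e n r c s t er≡1 = sym (trans (lem₁ e n r c s t) (trans (cong (λ x → e + n - n * x) er≡1) (lem₂ e n)))
    where
    lem₁ : ∀ e n r c s t → e * (s - n * r) + ((c + n + e - e * (s + t)) + (e * t - c)) ≡ e + n - n * (e * r)
    lem₁ = solve-∀ ℚ-ring
    lem₂ : ∀ e n → e + n - n * 1ℚ ≡ e * 1ℚ
    lem₂ = solve-∀ ℚ-ring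

-- Coprimality and the Chinese remainder theorem

2≤prime : ∀ {p} → Prime p → 2 ℕ.≤ p
2≤prime {p} pr = ℕ.nonTrivial⇒n>1 p {{Pr.prime⇒nonTrivial pr}}

prime≢1 : ∀ {p} → Prime p → ¬ p ≡ 1
prime≢1 pr refl = Pr.¬prime[1] pr

prime-∣-prime : ∀ {p p′} → Prime p → Prime p′ → p ∣ p′ → p ≡ p′
prime-∣-prime pr pr′ p∣p′ with Pr.prime⇒irreducible pr′ p∣p′
... | inj₁ p≡1  = contradiction p≡1 (prime≢1 pr)
... | inj₂ p≡p′ = p≡p′

prime-∣-* : ∀ {p p′} i → Prime p → Prime p′ → p′ ℕ.< p → p′ ∣ p · i → p′ ∣ i
prime-∣-* {p} i pr pr′ p′<p h with Pr.euclidsLemma p i pr′ h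
... | inj₁ p′∣p = contradiction p′<p (ℕ.<-irrefl (prime-∣-prime pr′ pr p′∣p))
... | inj₂ p′∣i = p′∣i

prime∤⇒coprime : ∀ {p e} → Prime p → ¬ p ∣ e → Coprime e p
prime∤⇒coprime pr p∤e (d∣e , d∣p) with Pr.prime⇒irreducible pr d∣p
... | inj₁ d≡1 = d≡1
... | inj₂ d≡p = contradiction (subst (_∣ _) d≡p d∣e) p∤e

coprime-*-∣ : ∀ {d e n} → Coprime d e → d ∣ n → e ∣ n → d · e ∣ n
coprime-*-∣ {d} {e} {n} cop (divides k n≡kd) e∣n =
  subst (d · e ∣_) (trans (ℕ.*-comm d k) (sym n≡kd))
    (∣.*-monoʳ-∣ d (Cop.coprime-divisor (Cop.sym cop) (subst (e ∣_) (trans n≡kd (ℕ.*-comm k d)) e∣n)))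

-- Residue classes mod d are written d ∣ c + n, which avoids subtraction.
crt-solve : ∀ e p c d .{{_ : NonZero p}} → Coprime e p → ∃[ t ] ∃[ u ] ∃[ v ] (c ℕ.+ e · t ℕ.+ p · u ≡ d ℕ.+ p · v)
crt-solve e (suc p) c d cop with Cop.coprime-Bézout cop
... | GCD.Bézout.Identity.+- x y eq = x · (d ℕ.+ p · c) , 0 , c ℕ.+ y · (d ℕ.+ p · c) , (begin
  c ℕ.+ e · (x · (d ℕ.+ p · c)) ℕ.+ suc p · 0 ≡⟨ lem₁ c e x (d ℕ.+ p · c) p ⟩
  c ℕ.+ (x · e) · (d ℕ.+ p · c) ≡⟨ cong (λ z → c ℕ.+ z · (d ℕ.+ p · c)) eq ⟨
  c ℕ.+ (1 ℕ.+ y · suc p) · (d ℕ.+ p · c) ≡⟨ lem₂ c y p d ⟩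
  d ℕ.+ suc p · (c ℕ.+ y · (d ℕ.+ p · c)) ∎)
  where
  open ≡-Reasoning
  lem₁ : ∀ c e x z p → c ℕ.+ e · (x · z) ℕ.+ suc p · 0 ≡ c ℕ.+ (x · e) · z
  lem₁ = solve-ℕ
  lem₂ : ∀ c y p d → c ℕ.+ (1 ℕ.+ y · suc p) · (d ℕ.+ p · c) ≡ d ℕ.+ suc p · (c ℕ.+ y · (d ℕ.+ p · c))
  lem₂ = solve-ℕ
... | GCD.Bézout.Identity.-+ x y eq = x · (c ℕ.+ p · d) , d , y · (c ℕ.+ p · d) , (begin
  c ℕ.+ e · (x · (c ℕ.+ p · d)) ℕ.+ suc p · d ≡⟨ lem₁ c e x p d ⟩
  d ℕ.+ (1 ℕ.+ x · e) · (c ℕ.+ p · d) ≡⟨ cong (λ z → d ℕ.+ z · (c ℕ.+ p · d)) eq ⟩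
  d ℕ.+ (y · suc p) · (c ℕ.+ p · d) ≡⟨ lem₂ d y p (c ℕ.+ p · d) ⟩
  d ℕ.+ suc p · (y · (c ℕ.+ p · d)) ∎)
  where
  open ≡-Reasoning
  lem₁ : ∀ c e x p d → c ℕ.+ e · (x · (c ℕ.+ p · d)) ℕ.+ suc p · d ≡ d ℕ.+ (1 ℕ.+ x · e) · (c ℕ.+ p · d)
  lem₁ = solve-ℕ
  lem₂ : ∀ d y p z → d ℕ.+ (y · suc p) · z ≡ d ℕ.+ suc p · (y · z)
  lem₂ = solve-ℕ

∣m+n∣n⇒∣m : ∀ {d} m {n} → d ∣ m ℕ.+ n → d ∣ n → d ∣ m
∣m+n∣n⇒∣m {d} m {n} h = ∣.∣m+n∣m⇒∣n (subst (d ∣_) (ℕ.+-comm m n) h)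

-- The two conditions amount to one residue class modulo e · p. As `s` is found before n, the
-- identity holds along the whole progression.
χ-crt : ∀ e p c d .{{_ : NonZero p}} → Coprime e p →
  ∃[ s ] (∀ n → χ e (c ℕ.+ n) * χ p (d ℕ.+ n) ≡ χ (e · p) (s ℕ.+ n))
χ-crt e p c d cop with crt-solve e p c d cop
... | t , u , v , eq = c ℕ.+ e · t , λ n →
  trans (sym (𝟙-× (e ∣? (c ℕ.+ n)) (p ∣? (d ℕ.+ n)))) (𝟙-cong (e ∣? (c ℕ.+ n) ×-dec p ∣? (d ℕ.+ n)) (e · p ∣? (c ℕ.+ e · t ℕ.+ n)) (to n) (from n))
  where
  shiftₑ : ∀ n → e · t ℕ.+ (c ℕ.+ n) ≡ c ℕ.+ e · t ℕ.+ n
  shiftₑ n = trans (sym (ℕ.+-assoc (e · t) c n)) (cong (ℕ._+ n) (ℕ.+-comm (e · t) c))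
  swap : ∀ x y n → x ℕ.+ y ℕ.+ n ≡ x ℕ.+ n ℕ.+ y
  swap = solve-ℕ
  shiftₚ : ∀ n → c ℕ.+ e · t ℕ.+ n ℕ.+ p · u ≡ d ℕ.+ n ℕ.+ p · v
  shiftₚ n = trans (swap (c ℕ.+ e · t) n (p · u)) (trans (cong (ℕ._+ n) eq) (swap d (p · v) n))
  to : ∀ n → e ∣ c ℕ.+ n × p ∣ d ℕ.+ n → e · p ∣ c ℕ.+ e · t ℕ.+ n
  to n (e∣ , p∣) = coprime-*-∣ cop
    (subst (e ∣_) (shiftₑ n) (∣.∣m∣n⇒∣m+n (∣.m∣m*n t) e∣))
    (∣m+n∣n⇒∣m _ (subst (p ∣_) (sym (shiftₚ n)) (∣.∣m∣n⇒∣m+n p∣ (∣.m∣m*n v))) (∣.m∣m*n u))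
  from : ∀ n → e · p ∣ c ℕ.+ e · t ℕ.+ n → e ∣ c ℕ.+ n × p ∣ d ℕ.+ n
  from n h =
    ∣.∣m+n∣m⇒∣n (subst (e ∣_) (sym (shiftₑ n)) (∣.m*n∣⇒m∣ e p h)) (∣.m∣m*n t) ,
    ∣m+n∣n⇒∣m _ (subst (p ∣_) (shiftₚ n) (∣.∣m∣n⇒∣m+n (∣.m*n∣⇒n∣ e p h) (∣.m∣m*n u))) (∣.m∣m*n v)

-- f has mean m, up to a bounded error, on every progression to a modulus coprime to ps.
record Equidistributed (ps : List ℕ) (f : ℕ → ℚ) (m E : ℚ) : Set where
  constructor equi
  field
    close : ∀ e c n → NonZero e → All (λ p → ¬ p ∣ e) ps →
      ℚ.∣ ∑ n (λ i → χ e (c ℕ.+ i) * f i) - m * ι n * recip e ∣ ≤ E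
open Equidistributed

equi-1 : Equidistributed [] (λ _ → 1ℚ) 1ℚ 1ℚ
equi-1 = equi λ e c n e≢0 _ → subst (λ x → ℚ.∣ x ∣ ≤ 1ℚ)
  (cong₂ _-_ (∑-cong n (λ i _ → sym (ℚ.*-identityʳ _))) (cong (_* recip e) (sym (ℚ.*-identityˡ (ι n)))))
  (progression-count e {{e≢0}} c n)

equi-cong : ∀ {ps f g m m′ E} → (∀ n → f n ≡ g n) → m ≡ m′ → Equidistributed ps f m E → Equidistributed ps g m′ E
equi-cong {m = m} {E = E} f≗g refl eq = equi λ e c n e≢0 cop → subst (λ x → ℚ.∣ x - m * ι n * recip e ∣ ≤ E)
  (∑-cong n (λ i _ → cong (χ e (c ℕ.+ i) *_) (f≗g i))) (close eq e c n e≢0 cop)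

equi-weaken : ∀ {p ps f m E} → Equidistributed ps f m E → Equidistributed (p ∷ ps) f m E
equi-weaken eq = equi λ { e c n e≢0 (_ ∷ cop) → close eq e c n e≢0 cop }

equi-sub : ∀ {ps f g m m′ E E′} → Equidistributed ps f m E → Equidistributed ps g m′ E′ →
  Equidistributed ps (λ n → f n - g n) (m - m′) (E + E′)
equi-sub {f = f} {g} {m} {m′} {E} {E′} eqf eqg = equi λ e c n e≢0 cop →
  subst (λ x → ℚ.∣ x ∣ ≤ E + E′) (sym (split e c n))
    (ℚ.≤-trans (ℚ.∣p-q∣≤∣p∣+∣q∣ (∑ n (λ i → w e c i * f i) - m * ι n * recip e) (∑ n (λ i → w e c i * g i) - m′ * ι n * recip e)) (ℚ.+-mono-≤ (close eqf e c n e≢0 cop) (close eqg e c n e≢0 cop)))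
  where
  w : ℕ → ℕ → ℕ → ℚ
  w e c i = χ e (c ℕ.+ i)
  lem₁ : ∀ w a b → w * (a - b) ≡ w * a - w * b
  lem₁ = solve-∀ ℚ-ring
  lem₂ : ∀ s t m m′ n r → s - t - (m - m′) * n * r ≡ (s - m * n * r) - (t - m′ * n * r)
  lem₂ = solve-∀ ℚ-ring
  split : ∀ e c n → ∑ n (λ i → w e c i * (f i - g i)) - (m - m′) * ι n * recip e
    ≡ (∑ n (λ i → w e c i * f i) - m * ι n * recip e) - (∑ n (λ i → w e c i * g i) - m′ * ι n * recip e)
  split e c n = trans (cong (_- (m - m′) * ι n * recip e)
      (trans (∑-cong n (λ i _ → lem₁ (w e c i) (f i) (g i))) (∑-sub n (λ i → w e c i * f i) (λ i → w e c i * g i))))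
    (lem₂ (∑ n (λ i → w e c i * f i)) (∑ n (λ i → w e c i * g i)) m m′ (ι n) (recip e))

equi-zero : ∀ {ps} → Equidistributed ps (λ _ → 0ℚ) 0ℚ 0ℚ
equi-zero = equi λ e c n e≢0 _ → ℚ.≤-reflexive (cong ℚ.∣_∣ (trans
  (cong₂ _-_ (trans (∑-cong n (λ i _ → ℚ.*-zeroʳ (χ e (c ℕ.+ i)))) (trans (∑-const n 0ℚ) (ℚ.*-zeroʳ (ι n))))
             (trans (cong (_* recip e) (ℚ.*-zeroˡ (ι n))) (ℚ.*-zeroˡ (recip e)))) refl))

-- The new prime is absorbed into the modulus: the hypothesis applies to e · p with the same bound,
-- because E is uniform in e and c. Multiplying by a divisibility condition therefore costs nothing
-- in the error. That p exceeds all of `ps` keeps e · p free of their divisors.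
equi-χ : ∀ {p ps f m E} d → Prime p → All Prime ps → All (ℕ._< p) ps → Equidistributed ps f m E →
  Equidistributed (p ∷ ps) (λ n → χ p (d ℕ.+ n) * f n) (recip p * m) E
equi-χ {p} {ps} {f} {m} {E} d pr prs ps<p eq = equi bound
  where
  go : ∀ {e qs} → All Prime qs → All (ℕ._< p) qs → All (λ p′ → ¬ p′ ∣ e) qs → All (λ p′ → ¬ p′ ∣ e · p) qs
  go []           []         []            = []
  go {e} {p′ ∷ _} (pr′ ∷ prs) (p′<p ∷ ps<p) (p′∤e ∷ cop) = p′∤ep ∷ go prs ps<p cop
    where
    p′∤ep : ¬ p′ ∣ e · p
    p′∤ep h with Pr.euclidsLemma e p pr′ h
    ... | inj₁ p′∣e = p′∤e p′∣e
    ... | inj₂ p′∣p = ℕ.<-irrefl (prime-∣-prime pr′ pr p′∣p) p′<p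
  lem : ∀ m n r s → m * n * (r * s) ≡ s * m * n * r
  lem = solve-∀ ℚ-ring
  bound : ∀ e c n → NonZero e → All (λ p′ → ¬ p′ ∣ e) (p ∷ ps) →
    ℚ.∣ ∑ n (λ i → χ e (c ℕ.+ i) * (χ p (d ℕ.+ i) * f i)) - recip p * m * ι n * recip e ∣ ≤ E
  bound e c n e≢0 (p∤e ∷ cop) with χ-crt e p c d {{Pr.prime⇒nonZero pr}} (prime∤⇒coprime pr p∤e)
  ... | s , χχ≡χ = subst (λ x → ℚ.∣ x ∣ ≤ E)
    (cong₂ _-_ (∑-cong n (λ i _ → trans (cong (_* f i) (sym (χχ≡χ i))) (ℚ.*-assoc (χ e (c ℕ.+ i)) (χ p (d ℕ.+ i)) (f i))))
      (trans (cong (m * ι n *_) (recip-* e p)) (lem m (ι n) (recip e) (recip p))))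
    (close eq (e · p) s n (ℕ.m*n≢0 e p {{e≢0}} {{Pr.prime⇒nonZero pr}}) (go prs ps<p cop))

-- Truncated inclusion–exclusion

InUnit : ℚ → Set
InUnit x = 0ℚ ≤ x × x ≤ 1ℚ

-- truncated β xs is Σ_{k<β} (−1)^k e_k(xs), with e_k the elementary symmetric polynomials.
truncated : ℕ → List ℚ → ℚ
truncated zero    xs       = 0ℚ
truncated (suc β) []       = 1ℚ
truncated (suc β) (x ∷ xs) = truncated (suc β) xs - x * truncated β xs

elementary : ℕ → List ℚ → ℚ
elementary zero    xs       = 1ℚ
elementary (suc β) []       = 0ℚ
elementary (suc β) (x ∷ xs) = elementary (suc β) xs + x * elementary β xs

∏[1-_] : List ℚ → ℚ
∏[1- [] ]     = 1ℚ
∏[1- x ∷ xs ] = (1ℚ - x) * ∏[1- xs ]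

Σℚ : List ℚ → ℚ
Σℚ []       = 0ℚ
Σℚ (x ∷ xs) = x + Σℚ xs

infixr 8 _^ℚ_
_^ℚ_ : ℚ → ℕ → ℚ
x ^ℚ zero  = 1ℚ
x ^ℚ suc n = x * x ^ℚ n

sign : ℕ → ℚ
sign zero    = 1ℚ
sign (suc n) = - sign n

sign-double : ∀ t → sign (t ℕ.+ t) ≡ 1ℚ
sign-double zero    = refl
sign-double (suc t) = trans (cong (λ k → - sign k) (ℕ.+-suc t t)) (trans (neg-neg (sign (t ℕ.+ t))) (sign-double t))
  where
  neg-neg : ∀ x → - (- x) ≡ x
  neg-neg = solve-∀ ℚ-ring

∏-unit : ∀ {xs} → All InUnit xs → InUnit ∏[1- xs ]
∏-unit []                        = 0≤1 , ℚ.≤-refl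
∏-unit {x ∷ xs} ((0≤x , x≤1) ∷ us) =
  0≤* (0≤b-a x≤1) (proj₁ (∏-unit us)) ,
  *-mono-≤ (0≤b-a x≤1) (≤-by (lem x) 0≤x) (proj₁ (∏-unit us)) (proj₂ (∏-unit us))
  where
  lem : ∀ x → 1ℚ ≡ 1ℚ - x + x
  lem = solve-∀ ℚ-ring

-- The signed remainder of x ∷ xs at β + 1 is that of xs at β + 1 plus x times that of xs at β.
-- Allowing all values in [0,1] makes this serve both the indicators `hits` and their densities.
bonferroni : ∀ {xs} → All InUnit xs → ∀ β →
  0ℚ ≤ sign β * (∏[1- xs ] - truncated β xs) × sign β * (∏[1- xs ] - truncated β xs) ≤ elementary β xs
bonferroni {xs} us zero = subst InUnit (lem ∏[1- xs ]) (∏-unit us)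
  where
  lem : ∀ x → x ≡ 1ℚ * (x - 0ℚ)
  lem = solve-∀ ℚ-ring
bonferroni [] (suc β) = ℚ.≤-reflexive (sym (ℚ.*-zeroʳ (sign (suc β)))) , ℚ.≤-reflexive (ℚ.*-zeroʳ (sign (suc β)))
bonferroni {x ∷ xs} ((0≤x , _) ∷ us) (suc β) with bonferroni us (suc β) | bonferroni us β
... | l₁ , u₁ | l₀ , u₀ =
  subst (0ℚ ≤_) split (0≤+ l₁ (0≤* 0≤x l₀)) ,
  subst (_≤ elementary (suc β) (x ∷ xs)) split (ℚ.+-mono-≤ u₁ (*-monoʳ 0≤x u₀))
  where
  split : sign (suc β) * (∏[1- xs ] - truncated (suc β) xs) + x * (sign β * (∏[1- xs ] - truncated β xs))
    ≡ sign (suc β) * ((1ℚ - x) * ∏[1- xs ] - (truncated (suc β) xs - x * truncated β xs))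
  split = lem (sign β) x ∏[1- xs ] (truncated (suc β) xs) (truncated β xs)
    where
    lem : ∀ s x c t₁ t₀ → - s * (c - t₁) + x * (s * (c - t₀)) ≡ - s * ((1ℚ - x) * c - (t₁ - x * t₀))
    lem = solve-∀ ℚ-ring

truncated-odd : ∀ {xs} → All InUnit xs → ∀ t →
  ∏[1- xs ] ≤ truncated (suc (t ℕ.+ t)) xs ×
  truncated (suc (t ℕ.+ t)) xs ≤ ∏[1- xs ] + elementary (suc (t ℕ.+ t)) xs
truncated-odd {xs} us t with bonferroni us (suc (t ℕ.+ t))
... | l , u = ≤-by (lem₁ c T) (subst (0ℚ ≤_) flip l) , ≤-by (lem₂ c T e) (0≤b-a (subst (_≤ e) flip u))
  where
  c = ∏[1- xs ]
  T = truncated (suc (t ℕ.+ t)) xs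
  e = elementary (suc (t ℕ.+ t)) xs
  lem : ∀ c T → - 1ℚ * (c - T) ≡ T - c
  lem = solve-∀ ℚ-ring
  flip : sign (suc (t ℕ.+ t)) * (c - T) ≡ T - c
  flip = trans (cong (λ s → - s * (c - T)) (sign-double t)) (lem c T)
  lem₁ : ∀ c T → T ≡ c + (T - c)
  lem₁ = solve-∀ ℚ-ring
  lem₂ : ∀ c T e → c + e ≡ T + (e - (T - c))
  lem₂ = solve-∀ ℚ-ring

Σ-nonneg : ∀ {xs} → All (0ℚ ≤_) xs → 0ℚ ≤ Σℚ xs
Σ-nonneg []           = ℚ.≤-refl
Σ-nonneg (0≤x ∷ 0≤xs) = 0≤+ 0≤x (Σ-nonneg 0≤xs)

^-nonneg : ∀ {x} n → 0ℚ ≤ x → 0ℚ ≤ x ^ℚ n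
^-nonneg zero    0≤x = 0≤1
^-nonneg (suc n) 0≤x = 0≤* 0≤x (^-nonneg n 0≤x)

^-mono : ∀ {x y} n → 0ℚ ≤ x → x ≤ y → x ^ℚ n ≤ y ^ℚ n
^-mono zero    0≤x x≤y = ℚ.≤-refl
^-mono (suc n) 0≤x x≤y = *-mono-≤ 0≤x x≤y (^-nonneg n 0≤x) (^-mono n 0≤x x≤y)

elementary≤^ : ∀ {xs} → All (0ℚ ≤_) xs → ∀ β → elementary β xs ≤ Σℚ xs ^ℚ β
elementary≤^ 0≤xs zero = ℚ.≤-refl
elementary≤^ [] (suc β) = ^-nonneg (suc β) ℚ.≤-refl
elementary≤^ {x ∷ xs} (0≤x ∷ 0≤xs) (suc β) = begin
  elementary (suc β) xs + x * elementary β xs ≤⟨ ℚ.+-mono-≤ (elementary≤^ 0≤xs (suc β)) (*-monoʳ 0≤x (elementary≤^ 0≤xs β)) ⟩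
  S * S ^ℚ β + x * S ^ℚ β ≡⟨ lem S x (S ^ℚ β) ⟩
  (x + S) * S ^ℚ β ≤⟨ *-monoʳ (0≤+ 0≤x 0≤S) (^-mono β 0≤S (≤-by (ℚ.+-comm x S) 0≤x)) ⟩
  (x + S) * (x + S) ^ℚ β ∎
  where
  open ℚ.≤-Reasoning
  S = Σℚ xs
  0≤S = Σ-nonneg 0≤xs
  lem : ∀ S x y → S * y + x * y ≡ (x + S) * y
  lem = solve-∀ ℚ-ring

∏-++ : ∀ xs ys → ∏[1- xs ++ ys ] ≡ ∏[1- xs ] * ∏[1- ys ]
∏-++ []       ys = sym (ℚ.*-identityˡ ∏[1- ys ])
∏-++ (x ∷ xs) ys = trans (cong ((1ℚ - x) *_) (∏-++ xs ys)) (sym (ℚ.*-assoc (1ℚ - x) ∏[1- xs ] ∏[1- ys ]))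

1-Σ≤∏ : ∀ {xs} → All InUnit xs → 1ℚ - Σℚ xs ≤ ∏[1- xs ]
1-Σ≤∏ [] = ℚ.≤-refl
1-Σ≤∏ {x ∷ xs} ((0≤x , x≤1) ∷ us) = ≤-by (lem x (Σℚ xs) ∏[1- xs ])
  (0≤+ (0≤b-a (1-Σ≤∏ us)) (0≤* 0≤x (0≤b-a (proj₂ (∏-unit us)))))
  where
  lem : ∀ x s c → (1ℚ - x) * c ≡ 1ℚ - (x + s) + ((c - (1ℚ - s)) + x * (1ℚ - c))
  lem = solve-∀ ℚ-ring

-- The Brun–Hooley sieve

-- The number of residue classes mod p, among n ≡ 0 and n ≡ −h, that contain n; at most 1.
hits : ℕ → ℕ → ℕ → ℚ
hits h p n = χ p n + 𝟙 (¬? (p ∣? h)) * χ p (h ℕ.+ n)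

-- The proportion of classes mod p that are removed: the classes of 0 and -h coincide when p divides
-- h.
density : ℕ → ℕ → ℚ
density h p = recip p + 𝟙 (¬? (p ∣? h)) * recip p

hits-unit : ∀ h p n → InUnit (hits h p n)
hits-unit h p n with p ∣? n | p ∣? h
... | yes p∣n | yes p∣h = subst InUnit (sym (trans (cong (1ℚ +_) (ℚ.*-zeroˡ (χ p (h ℕ.+ n)))) (ℚ.+-identityʳ 1ℚ))) (0≤1 , ℚ.≤-refl)
... | yes p∣n | no  p∤h = subst (λ x → InUnit (1ℚ + 1ℚ * x)) (sym (𝟙-no (p ∣? (h ℕ.+ n)) (λ p∣h+n → p∤h (∣m+n∣n⇒∣m h p∣h+n p∣n)))) (0≤1 , ℚ.≤-refl)
... | no  p∤n | yes p∣h = subst InUnit (sym (trans (cong (0ℚ +_) (ℚ.*-zeroˡ (χ p (h ℕ.+ n)))) (ℚ.+-identityʳ 0ℚ))) (ℚ.≤-refl , 0≤1)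
... | no  p∤n | no  p∤h = subst InUnit (lem (χ p (h ℕ.+ n))) (0≤𝟙 (p ∣? (h ℕ.+ n)) , 𝟙≤1 (p ∣? (h ℕ.+ n)))
  where
  lem : ∀ x → x ≡ 0ℚ + 1ℚ * x
  lem = solve-∀ ℚ-ring

density-bounds : ∀ h p → 0ℚ ≤ density h p × density h p ≤ recip p + recip p
density-bounds h p = 0≤+ (0≤recip p) (0≤* (0≤𝟙 (¬? (p ∣? h))) (0≤recip p)) ,
  ℚ.+-monoʳ-≤ (recip p) (subst (𝟙 (¬? (p ∣? h)) * recip p ≤_) (ℚ.*-identityˡ (recip p)) (*-monoˡ (0≤recip p) (𝟙≤1 (¬? (p ∣? h)))))

density-unit : ∀ h {p} → Prime p → InUnit (density h p)
density-unit h {p} pr = proj₁ (density-bounds h p) ,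
  ℚ.≤-trans (proj₂ (density-bounds h p)) (2·recip≤1 (2≤prime pr))

-- The number of terms in truncated β over r primes, two residue classes per prime.
terms : ℕ → ℕ → ℕ
terms zero    r       = 0
terms (suc β) zero    = 1
terms (suc β) (suc r) = terms (suc β) r ℕ.+ terms β r ℕ.+ terms β r

terms≤ : ∀ β r → terms β r ℕ.≤ suc (r ℕ.+ r) ^ β
terms≤ zero r = z≤n
terms≤ (suc β) zero = ℕ.≤-reflexive (sym (ℕ.^-zeroˡ (suc β)))
terms≤ (suc β) (suc r) = begin
  terms (suc β) r ℕ.+ terms β r ℕ.+ terms β r ≤⟨ ℕ.+-mono-≤ (ℕ.+-mono-≤ (terms≤ (suc β) r) (terms≤ β r)) (terms≤ β r) ⟩
  suc (r ℕ.+ r) · y ℕ.+ y ℕ.+ y ≡⟨ lem r y ⟩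
  suc (suc r ℕ.+ suc r) · y ≤⟨ ℕ.*-monoʳ-≤ (suc (suc r ℕ.+ suc r)) (ℕ.^-monoˡ-≤ β (s≤s (ℕ.+-mono-≤ (ℕ.n≤1+n r) (ℕ.n≤1+n r)))) ⟩
  suc (suc r ℕ.+ suc r) · suc (suc r ℕ.+ suc r) ^ β ∎
  where
  open ℕ.≤-Reasoning
  y = suc (r ℕ.+ r) ^ β
  lem : ∀ r y → suc (r ℕ.+ r) · y ℕ.+ y ℕ.+ y ≡ suc (suc r ℕ.+ suc r) · y
  lem = solve-ℕ

equi-mono : ∀ {ps f m E E′} → E ≤ E′ → Equidistributed ps f m E → Equidistributed ps f m E′
equi-mono E≤E′ eq = equi λ e c n e≢0 cop → ℚ.≤-trans (close eq e c n e≢0 cop) E≤E′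

equi-𝟙 : ∀ {a} {A : Set a} {ps f m E} (d : Dec A) → 0ℚ ≤ E → Equidistributed ps f m E →
  Equidistributed ps (λ n → 𝟙 d * f n) (𝟙 d * m) E
equi-𝟙 {f = f} {m} (yes _) 0≤E eq = equi-cong (λ n → sym (ℚ.*-identityˡ (f n))) (sym (ℚ.*-identityˡ m)) eq
equi-𝟙 {f = f} {m} (no  _) 0≤E eq = equi-mono 0≤E (equi-cong (λ n → sym (ℚ.*-zeroˡ (f n))) (sym (ℚ.*-zeroˡ m)) equi-zero)

Descending : List ℕ → Set
Descending = AllPairs ℕ._>_

-- The factor 1 - `hits` is expanded one residue class at a time, so each step is a difference of
-- functions already known to be equidistributed, and the errors add up exactly as `terms` counts.
equi-truncated : ∀ h {qs f m E} → 0ℚ ≤ E → Equidistributed qs f m E →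
  ∀ β ps → All Prime (ps ++ qs) → Descending (ps ++ qs) →
  Equidistributed (ps ++ qs) (λ n → truncated β (map (λ p → hits h p n) ps) * f n)
    (truncated β (map (density h) ps) * m) (ι (terms β (length ps)) * E)
equi-truncated h {f = f} {m} {E} 0≤E eq zero ps prs desc = equi-mono (0≤* (0≤ι (terms zero (length ps))) 0≤E)
  (equi-cong (λ n → sym (ℚ.*-zeroˡ (f n))) (sym (ℚ.*-zeroˡ m)) equi-zero)
equi-truncated h {f = f} {m} {E} 0≤E eq (suc β) [] prs desc =
  equi-mono (ℚ.≤-reflexive (sym (trans (cong (_* E) ι-1) (ℚ.*-identityˡ E))))
    (equi-cong (λ n → sym (ℚ.*-identityˡ (f n))) (sym (ℚ.*-identityˡ m)) eq)
equi-truncated h {qs} {f} {m} {E} 0≤E eq (suc β) (p ∷ ps) (pr ∷ prs) (p> ∷ desc) =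
  equi-mono (ℚ.≤-reflexive error)
    (equi-cong (λ n → lem (T₁ n) (T₀ n) (χ p n) (δ * χ p (h ℕ.+ n)) δ (χ p (h ℕ.+ n)) (f n) refl)
               (lem τ₁ τ₀ (recip p) (δ * recip p) δ (recip p) m refl)
      (equi-sub (equi-sub (equi-weaken F₁) (equi-χ 0 pr prs p> F₀)) (equi-𝟙 (¬? (p ∣? h)) 0≤E₀ (equi-χ h pr prs p> F₀))))
  where
  F₁ = equi-truncated h 0≤E eq (suc β) ps prs desc
  F₀ = equi-truncated h 0≤E eq β ps prs desc
  δ  = 𝟙 (¬? (p ∣? h))
  T₁ : ℕ → ℚ
  T₁ n = truncated (suc β) (map (λ p → hits h p n) ps)
  T₀ : ℕ → ℚ
  T₀ n = truncated β (map (λ p → hits h p n) ps)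
  τ₁ = truncated (suc β) (map (density h) ps)
  τ₀ = truncated β (map (density h) ps)
  r  = length ps
  0≤E₀ : 0ℚ ≤ ι (terms β r) * E
  0≤E₀ = 0≤* (0≤ι (terms β r)) 0≤E
  lem : ∀ T₁ T₀ x y δ z f → y ≡ δ * z → T₁ * f - x * (T₀ * f) - δ * (z * (T₀ * f)) ≡ (T₁ - (x + y) * T₀) * f
  lem T₁ T₀ x y δ z f refl = go T₁ T₀ x δ z f
    where
    go : ∀ T₁ T₀ x δ z f → T₁ * f - x * (T₀ * f) - δ * (z * (T₀ * f)) ≡ (T₁ - (x + δ * z) * T₀) * f
    go = solve-∀ ℚ-ring
  error : ι (terms (suc β) r) * E + ι (terms β r) * E + ι (terms β r) * E ≡ ι (terms (suc β) (suc r)) * E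
  error = trans (distrib (ι (terms (suc β) r)) (ι (terms β r)) E)
    (cong (_* E) (sym (trans (ι-+ (terms (suc β) r ℕ.+ terms β r) (terms β r)) (cong (_+ ι (terms β r)) (ι-+ (terms (suc β) r) (terms β r))))))
    where
    distrib : ∀ a b E → a * E + b * E + b * E ≡ (a + b + b) * E
    distrib = solve-∀ ℚ-ring

-- A block (t , ps) sieves by the primes ps with inclusion–exclusion truncated after 2t primes.
Block : Set
Block = ℕ × List ℕ

depth : ℕ → ℕ
depth t = suc (t ℕ.+ t)

primes : List Block → List ℕ
primes []             = []
primes ((_ , ps) ∷ B) = ps ++ primes B

majorant : ℕ → List Block → ℕ → ℚ
majorant h []             n = 1ℚ
majorant h ((t , ps) ∷ B) n = truncated (depth t) (map (λ p → hits h p n) ps) * majorant h B n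

mean : ℕ → List Block → ℚ
mean h []             = 1ℚ
mean h ((t , ps) ∷ B) = truncated (depth t) (map (density h) ps) * mean h B

totalTerms : List Block → ℕ
totalTerms []             = 1
totalTerms ((t , ps) ∷ B) = terms (depth t) (length ps) · totalTerms B

AllPairs-++⁻ʳ : ∀ {a r} {A : Set a} {R : A → A → Set r} xs {ys} → AllPairs R (xs ++ ys) → AllPairs R ys
AllPairs-++⁻ʳ []       rs       = rs
AllPairs-++⁻ʳ (x ∷ xs) (_ ∷ rs) = AllPairs-++⁻ʳ xs rs

equi-majorant : ∀ h B → All Prime (primes B) → Descending (primes B) →
  Equidistributed (primes B) (majorant h B) (mean h B) (ι (totalTerms B))
equi-majorant h [] prs desc = equi-mono (ℚ.≤-reflexive (sym ι-1)) equi-1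
equi-majorant h ((t , ps) ∷ B) prs desc =
  equi-mono (ℚ.≤-reflexive (sym (ι-* (terms (depth t) (length ps)) (totalTerms B))))
    (equi-truncated h (0≤ι (totalTerms B))
      (equi-majorant h B (All.++⁻ʳ ps prs) (AllPairs-++⁻ʳ ps desc)) (depth t) ps prs desc)

unsifted : ℕ → List ℕ → ℕ → ℚ
unsifted h ps n = ∏[1- map (λ p → hits h p n) ps ]

unsifted-unit : ∀ h ps n → InUnit (unsifted h ps n)
unsifted-unit h ps n = ∏-unit (All.map⁺ (All.universal (λ p → hits-unit h p n) ps))

unsifted≤majorant : ∀ h B n → unsifted h (primes B) n ≤ majorant h B n
unsifted≤majorant h [] n = ℚ.≤-refl
unsifted≤majorant h ((t , ps) ∷ B) n = subst (_≤ majorant h ((t , ps) ∷ B) n)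
  (sym (trans (cong ∏[1-_] (List.map-++ (λ p → hits h p n) ps (primes B)))
              (∏-++ (map (λ p → hits h p n) ps) (map (λ p → hits h p n) (primes B)))))
  (*-mono-≤ (proj₁ (unsifted-unit h ps n))
    (proj₁ (truncated-odd (All.map⁺ (All.universal (λ p → hits-unit h p n) ps)) t))
    (proj₁ (unsifted-unit h (primes B) n)) (unsifted≤majorant h B n))

sieve-bound : ∀ h B n → All Prime (primes B) → Descending (primes B) →
  ∑ n (unsifted h (primes B)) ≤ mean h B * ι n + ι (totalTerms B)
sieve-bound h B n prs desc = begin
  ∑ n (unsifted h (primes B)) ≤⟨ ∑-mono n (λ i _ → unsifted≤majorant h B i) ⟩
  ∑ n (majorant h B) ≡⟨ ∑-cong n (λ i _ → sym (trans (cong (_* majorant h B i) (𝟙-yes (1 ∣? i) (∣.1∣ i))) (ℚ.*-identityˡ (majorant h B i)))) ⟩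
  S ≡⟨ lem S (mean h B * ι n) ⟩
  mean h B * ι n + (S - mean h B * ι n) ≤⟨ ℚ.+-monoʳ-≤ (mean h B * ι n) (ℚ.≤-trans (x≤∣x∣ (S - mean h B * ι n)) S-mean) ⟩
  mean h B * ι n + ι (totalTerms B) ∎
  where
  open ℚ.≤-Reasoning
  S = ∑ n (λ i → χ 1 i * majorant h B i)
  lem : ∀ s m → s ≡ m + (s - m)
  lem = solve-∀ ℚ-ring
  S-mean : ℚ.∣ S - mean h B * ι n ∣ ≤ ι (totalTerms B)
  S-mean = subst (λ x → ℚ.∣ S - x ∣ ≤ ι (totalTerms B))
    (trans (cong (mean h B * ι n *_) recip-1) (ℚ.*-identityʳ (mean h B * ι n)))
    (close (equi-majorant h B prs desc) 1 0 n _ (All.map (λ pr p∣1 → prime≢1 pr (∣.∣1⇒≡1 p∣1)) prs))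

-- The relative excess of a block over its Euler product.
excess : ℕ → ℚ
excess t = 2ℚ * recip 4 ^ℚ depth t

totalExcess : List Block → ℚ
totalExcess []            = 0ℚ
totalExcess ((t , _) ∷ B) = excess t + totalExcess B

Thin : ℕ → Block → Set
Thin h (_ , ps) = Σℚ (map (density h) ps) ≤ recip 4

excess-nonneg : ∀ t → 0ℚ ≤ excess t
excess-nonneg t = 0≤* 0≤2 (^-nonneg (depth t) (0≤recip 4))

recip4≤½ : 1ℚ ≤ 2ℚ * (1ℚ - recip 4)
recip4≤½ = ≤-by (lem (recip 4)) (0≤b-a (2·recip≤1 {4} (s≤s (s≤s z≤n))))
  where
  lem : ∀ x → 2ℚ * (1ℚ - x) ≡ 1ℚ + (1ℚ - (x + x))
  lem = solve-∀ ℚ-ring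

-- Thinness bounds e_β by 4^(-β) and, through 1 - Σ ≤ ∏, the Euler product of the block from below
-- by 3/4. So the absolute error of the truncation is a relative one up to a factor 2.
truncated-thin : ∀ h t ps → All Prime ps → Thin h (t , ps) →
  truncated (depth t) (map (density h) ps) ≤ ∏[1- map (density h) ps ] * (1ℚ + excess t)
truncated-thin h t ps prs thin = begin
  truncated (depth t) xs ≤⟨ proj₂ (truncated-odd us t) ⟩
  c + elementary (depth t) xs ≤⟨ ℚ.+-monoʳ-≤ c (ℚ.≤-trans (elementary≤^ 0≤xs (depth t)) (^-mono (depth t) (Σ-nonneg 0≤xs) thin)) ⟩
  c + y ≤⟨ ≤-by (lem c y (recip 4)) (0≤* 0≤y (0≤+ (0≤b-a recip4≤½) (0≤+ diff diff))) ⟩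
  c * (1ℚ + 2ℚ * y) ∎
  where
  open ℚ.≤-Reasoning
  xs = map (density h) ps
  us : All InUnit xs
  us = All.map⁺ (All.map (λ pr → density-unit h pr) prs)
  0≤xs = All.map proj₁ us
  c = ∏[1- xs ]
  y = recip 4 ^ℚ depth t
  0≤y = ^-nonneg (depth t) (0≤recip 4)
  diff : 0ℚ ≤ c - (1ℚ - recip 4)
  diff = 0≤b-a (ℚ.≤-trans (≤-by (lem′ (Σℚ xs) (recip 4)) (0≤b-a thin)) (1-Σ≤∏ us))
    where
    lem′ : ∀ s q → 1ℚ - s ≡ 1ℚ - q + (q - s)
    lem′ = solve-∀ ℚ-ring
  lem : ∀ c y q → c * (1ℚ + 2ℚ * y) ≡ c + y + y * ((2ℚ * (1ℚ - q) - 1ℚ) + ((c - (1ℚ - q)) + (c - (1ℚ - q))))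
  lem = solve-∀ ℚ-ring

mean-nonneg : ∀ h B → All Prime (primes B) → 0ℚ ≤ mean h B
mean-nonneg h [] prs = 0≤1
mean-nonneg h ((t , ps) ∷ B) prs = 0≤* (ℚ.≤-trans (proj₁ (∏-unit us)) (proj₁ (truncated-odd us t))) (mean-nonneg h B (All.++⁻ʳ ps prs))
  where
  us = All.map⁺ (All.map (λ pr → density-unit h pr) (All.++⁻ˡ ps prs))

-- Rests on (1 + ε)(1 - ε - σ) ≤ 1 - σ, which keeps the estimate linear in the total excess.
mean≤ : ∀ h B → All Prime (primes B) → All (Thin h) B → totalExcess B ≤ 1ℚ →
  mean h B * (1ℚ - totalExcess B) ≤ ∏[1- map (density h) (primes B) ]
mean≤ h [] prs thin exc = ℚ.≤-refl
mean≤ h ((t , ps) ∷ B) prs (th ∷ thin) exc = begin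
  T * M * (1ℚ - (ε + σ)) ≤⟨ *-monoˡ (0≤b-a exc) (*-monoˡ (mean-nonneg h B prs′) (truncated-thin h t ps (All.++⁻ˡ ps prs) th)) ⟩
  c * (1ℚ + ε) * M * (1ℚ - (ε + σ)) ≤⟨ ≤-by (lem c ε M σ) (0≤* (0≤* 0≤c (mean-nonneg h B prs′)) (0≤* 0≤ε (0≤+ 0≤ε 0≤σ))) ⟩
  c * (M * (1ℚ - σ)) ≤⟨ *-monoʳ 0≤c (mean≤ h B prs′ thin (ℚ.≤-trans (≤-by (ℚ.+-comm ε σ) 0≤ε) exc)) ⟩
  c * ∏[1- map (density h) (primes B) ] ≡⟨ trans (cong ∏[1-_] (List.map-++ (density h) ps (primes B))) (∏-++ (map (density h) ps) (map (density h) (primes B))) ⟨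
  ∏[1- map (density h) (ps ++ primes B) ] ∎
  where
  open ℚ.≤-Reasoning
  prs′ = All.++⁻ʳ ps prs
  T = truncated (depth t) (map (density h) ps)
  M = mean h B
  c = ∏[1- map (density h) ps ]
  ε = excess t
  σ = totalExcess B
  0≤ε = excess-nonneg t
  0≤σ : 0ℚ ≤ totalExcess B
  0≤σ = go B
    where
    go : ∀ B → 0ℚ ≤ totalExcess B
    go []            = ℚ.≤-refl
    go ((t , _) ∷ B) = 0≤+ (excess-nonneg t) (go B)
  0≤c : 0ℚ ≤ c
  0≤c = proj₁ (∏-unit (All.map⁺ (All.map (λ pr → density-unit h pr) (All.++⁻ˡ ps prs))))
  lem : ∀ c ε M σ → c * (M * (1ℚ - σ)) ≡ c * (1ℚ + ε) * M * (1ℚ - (ε + σ)) + c * M * (ε * (ε + σ))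
  lem = solve-∀ ℚ-ring

-- Lists of primes and Chebyshev's upper bound

primesIn : ℕ → ℕ → List ℕ
primesIn a zero    = []
primesIn a (suc b) with a ℕ.≤? b ×-dec prime? b
... | yes _ = b ∷ primesIn a b
... | no  _ = primesIn a b

primesIn-All : ∀ {P : ℕ → Set} a b → (∀ p → a ℕ.≤ p → p ℕ.< b → Prime p → P p) → All P (primesIn a b)
primesIn-All a zero h = []
primesIn-All a (suc b) h with a ℕ.≤? b ×-dec prime? b | primesIn-All a b (λ p a≤p p<b → h p a≤p (ℕ.m<n⇒m<1+n p<b))
... | yes (a≤b , pr) | ih = h b a≤b ℕ.≤-refl pr ∷ ih
... | no  _          | ih = ih

primesIn-prime : ∀ a b → All Prime (primesIn a b)
primesIn-prime a b = primesIn-All a b (λ _ _ _ pr → pr)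

primesIn-descending : ∀ a b → Descending (primesIn a b)
primesIn-descending a zero = []
primesIn-descending a (suc b) with a ℕ.≤? b ×-dec prime? b
... | yes _ = primesIn-All a b (λ _ _ p<b _ → p<b) ∷ primesIn-descending a b
... | no  _ = primesIn-descending a b

∈-primesIn : ∀ {a b p} → Prime p → a ℕ.≤ p → p ℕ.< b → p ∈ primesIn a b
∈-primesIn {a} {suc b} {p} pr a≤p p<1+b with a ℕ.≤? b ×-dec prime? b | p ℕ.≟ b
... | yes _  | yes p≡b = here p≡b
... | no ¬pb | yes refl = contradiction (a≤p , pr) ¬pb
... | yes _  | no p≢b  = there (∈-primesIn pr a≤p (ℕ.≤∧≢⇒< (ℕ.≤-pred p<1+b) p≢b))
... | no _   | no p≢b  = ∈-primesIn pr a≤p (ℕ.≤∧≢⇒< (ℕ.≤-pred p<1+b) p≢b)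

primesIn-empty : ∀ {a} b → b ℕ.≤ a → primesIn a b ≡ []
primesIn-empty zero b≤a = refl
primesIn-empty {a} (suc b) b<a with a ℕ.≤? b ×-dec prime? b
... | yes (a≤b , _) = contradiction b<a (ℕ.≤⇒≯ a≤b)
... | no  _         = primesIn-empty b (ℕ.<⇒≤ b<a)

primesIn-++ : ∀ {a b c} → a ℕ.≤ b → b ℕ.≤ c → primesIn b c ++ primesIn a b ≡ primesIn a c
primesIn-++ {a} {b} {c} a≤b b≤c = go (ℕ.≤⇒≤′ b≤c)
  where
  go : ∀ {c} → b ℕ.≤′ c → primesIn b c ++ primesIn a b ≡ primesIn a c
  go ℕ.≤′-refl = cong (_++ primesIn a b) (primesIn-empty b ℕ.≤-refl)
  go (ℕ.≤′-step {n = c} b≤′c) with b ℕ.≤? c ×-dec prime? c | a ℕ.≤? c ×-dec prime? c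
  ... | yes _          | yes _          = cong (c ∷_) (go b≤′c)
  ... | no  _          | no  _          = go b≤′c
  ... | yes (b≤c , pr) | no ¬ac         = contradiction (ℕ.≤-trans a≤b b≤c , pr) ¬ac
  ... | no ¬bc         | yes (a≤c , pr) = contradiction (ℕ.≤′⇒≤ b≤′c , pr) ¬bc

length-primesIn : ∀ a b → length (primesIn a b) ℕ.≤ b
length-primesIn a zero = z≤n
length-primesIn a (suc b) with a ℕ.≤? b ×-dec prime? b
... | yes _ = s≤s (length-primesIn a b)
... | no  _ = ℕ.m≤n⇒m≤1+n (length-primesIn a b)

prime∤product : ∀ {p ps} → Prime p → All Prime ps → All (ℕ._< p) ps → ¬ p ∣ product ps
prime∤product pr [] [] p∣1 = prime≢1 pr (∣.∣1⇒≡1 p∣1)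
prime∤product {p} {p′ ∷ ps} pr (pr′ ∷ prs) (p′<p ∷ ps<p) h with Pr.euclidsLemma p′ (product ps) pr h
... | inj₁ p∣p′ = ℕ.<-irrefl (sym (prime-∣-prime pr pr′ p∣p′)) p′<p
... | inj₂ p∣ps = prime∤product pr prs ps<p p∣ps

product-∣ : ∀ {m ps} → All Prime ps → Descending ps → All (_∣ m) ps → product ps ∣ m
product-∣ [] [] [] = ∣.1∣ _
product-∣ (pr ∷ prs) (p> ∷ desc) (p∣m ∷ ps∣m) =
  coprime-*-∣ (Cop.sym (prime∤⇒coprime pr (prime∤product pr prs p>))) p∣m (product-∣ prs desc ps∣m)

^-length≤product : ∀ {a ps} → All (a ℕ.≤_) ps → a ^ length ps ℕ.≤ product ps
^-length≤product []         = ℕ.≤-refl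
^-length≤product (a≤p ∷ a≤) = ℕ.*-mono-≤ a≤p (^-length≤product a≤)

prime∤! : ∀ {p} n → Prime p → n ℕ.< p → ¬ p ∣ n !
prime∤! zero pr n<p p∣1 = prime≢1 pr (∣.∣1⇒≡1 p∣1)
prime∤! (suc n) pr n<p h with Pr.euclidsLemma (suc n) (n !) pr h
... | inj₁ p∣1+n = ∣.>⇒∤ n<p p∣1+n
... | inj₂ p∣n!  = prime∤! n pr (ℕ.<-trans (ℕ.n<1+n n) n<p) p∣n!

∣! : ∀ {p} n .{{_ : NonZero p}} → p ℕ.≤ n → p ∣ n !
∣! {suc p} n p≤n = ∣.∣-trans (∣.m∣m*n (p !)) (∣.m≤n⇒m!∣n! p≤n)

[2n]!≤ : ∀ n → (n ℕ.+ n) ! ℕ.≤ 4 ^ n · (n ! · n !)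
[2n]!≤ zero = ℕ.≤-refl
[2n]!≤ (suc n) = begin
  (suc n ℕ.+ suc n) ! ≡⟨ cong _! (ℕ.+-suc (suc n) n) ⟩
  suc (suc (n ℕ.+ n)) · (suc (n ℕ.+ n) · (n ℕ.+ n) !) ≤⟨ ℕ.*-monoʳ-≤ (suc (suc (n ℕ.+ n))) (ℕ.*-mono-≤ (ℕ.n≤1+n (suc (n ℕ.+ n))) ([2n]!≤ n)) ⟩
  suc (suc (n ℕ.+ n)) · (suc (suc (n ℕ.+ n)) · (x · (y · y))) ≡⟨ lem n x y ⟩
  4 · x · (suc n · y · (suc n · y)) ∎
  where
  open ℕ.≤-Reasoning
  x = 4 ^ n
  y = n !
  lem : ∀ n x y → suc (suc (n ℕ.+ n)) · (suc (suc (n ℕ.+ n)) · (x · (y · y))) ≡ 4 · x · (suc n · y · (suc n · y))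
  lem = solve-ℕ

-- Such primes divide the central binomial coefficient.
product≤4^ : ∀ {n ps} → All Prime ps → Descending ps → All (λ p → n ℕ.< p × p ℕ.≤ n ℕ.+ n) ps → product ps ℕ.≤ 4 ^ n
product≤4^ {n} {ps} prs desc bounds with Comb.k![n∸k]!∣n! {n ℕ.+ n} {n} (ℕ.m≤m+n n n)
... | divides C eq = ℕ.≤-trans (∣.∣⇒≤ {{C≢0}} (product-∣ prs desc (go prs bounds))) C≤
  where
  D = n ! · n !
  eq′ : (n ℕ.+ n) ! ≡ C · D
  eq′ = trans eq (cong (λ k → C · (n ! · k !)) (ℕ.m+n∸m≡n n n))
  instance
    D≢0 : NonZero D
    D≢0 = ℕ.m*n≢0 (n !) (n !) {{n ℕ.!≢0}} {{n ℕ.!≢0}}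
  C≤ : C ℕ.≤ 4 ^ n
  C≤ = ℕ.*-cancelʳ-≤ C (4 ^ n) D (subst (ℕ._≤ 4 ^ n · D) eq′ ([2n]!≤ n))
  C≢0 : NonZero C
  C≢0 = ℕ.≢-nonZero (λ C≡0 → ℕ.≢-nonZero⁻¹ ((n ℕ.+ n) !) {{(n ℕ.+ n) ℕ.!≢0}} (trans eq′ (cong (_· D) C≡0)))
  go : ∀ {ps} → All Prime ps → All (λ p → n ℕ.< p × p ℕ.≤ n ℕ.+ n) ps → All (_∣ C) ps
  go [] [] = []
  go {p ∷ _} (pr ∷ prs) ((n<p , p≤2n) ∷ bounds) = p∣C ∷ go prs bounds
    where
    p∣C : p ∣ C
    p∣C with Pr.euclidsLemma C D pr (subst (p ∣_) eq′ (∣! (n ℕ.+ n) {{Pr.prime⇒nonZero pr}} p≤2n))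
    ... | inj₁ p∣C = p∣C
    ... | inj₂ p∣D with Pr.euclidsLemma (n !) (n !) pr p∣D
    ...   | inj₁ p∣n! = contradiction p∣n! (prime∤! n pr n<p)
    ...   | inj₂ p∣n! = contradiction p∣n! (prime∤! n pr n<p)

2^-cancel-≤ : ∀ {m n} → 2 ^ m ℕ.≤ 2 ^ n → m ℕ.≤ n
2^-cancel-≤ h = ℕ.≮⇒≥ (λ n<m → ℕ.<⇒≱ (ℕ.^-monoʳ-< 2 ℕ.≤-refl n<m) h)

prime≢2^ : ∀ i → ¬ Prime (2 ^ suc (suc i))
prime≢2^ i pr = ℕ.<-irrefl (prime-∣-prime Pr.prime[2] pr (∣.m∣m*n (2 ^ suc i))) 2<
  where
  2< : 2 ℕ.< 2 ^ suc (suc i)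
  2< = ℕ.*-monoʳ-< 2 (ℕ.*-mono-≤ {2} {2} {1} ℕ.≤-refl (ℕ.m^n>0 2 i))

2^≢0 : ∀ i → NonZero (2 ^ i)
2^≢0 i = ℕ.m^n≢0 2 i

2^suc : ∀ i → 2 ^ suc i ≡ 2 ^ i ℕ.+ 2 ^ i
2^suc i = cong (2 ^ i ℕ.+_) (ℕ.+-identityʳ (2 ^ i))

dyadicPrimes : ℕ → List ℕ
dyadicPrimes i = primesIn (2 ^ i) (2 ^ suc i)

-- For i ≥ 2 the endpoint n = 2^i is not prime, so these primes lie in (n, 2n] and their product is
-- at most 4^n. Each is at least 2^i; compare exponents of 2.
chebyshev-dyadic : ∀ i → 2 ℕ.≤ i → i · length (dyadicPrimes i) ℕ.≤ 2 ^ suc i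
chebyshev-dyadic i@(suc (suc j)) (s≤s (s≤s z≤n)) = 2^-cancel-≤ (begin
  2 ^ (i · r) ≡⟨ ℕ.^-*-assoc 2 i r ⟨
  (2 ^ i) ^ r ≤⟨ ^-length≤product {2 ^ i} {dyadicPrimes i} (primesIn-All (2 ^ i) (2 ^ suc i) (λ p 2^i≤p _ _ → 2^i≤p)) ⟩
  product (dyadicPrimes i) ≤⟨ product≤4^ {2 ^ i} {dyadicPrimes i} (primesIn-prime (2 ^ i) (2 ^ suc i)) (primesIn-descending (2 ^ i) (2 ^ suc i)) (primesIn-All (2 ^ i) (2 ^ suc i) bounds) ⟩
  4 ^ (2 ^ i) ≡⟨ ℕ.^-*-assoc 2 2 (2 ^ i) ⟩
  2 ^ (2 ^ suc i) ∎)
  where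
  open ℕ.≤-Reasoning
  r = length (dyadicPrimes i)
  bounds : ∀ p → 2 ^ i ℕ.≤ p → p ℕ.< 2 ^ suc i → Prime p → 2 ^ i ℕ.< p × p ℕ.≤ 2 ^ i ℕ.+ 2 ^ i
  bounds p l u pr = ℕ.≤∧≢⇒< l (λ { refl → prime≢2^ j pr }) , subst (p ℕ.≤_) (2^suc i) (ℕ.<⇒≤ u)

Σℚ-++ : ∀ xs ys → Σℚ (xs ++ ys) ≡ Σℚ xs + Σℚ ys
Σℚ-++ []       ys = sym (ℚ.+-identityˡ (Σℚ ys))
Σℚ-++ (x ∷ xs) ys = trans (cong (x +_) (Σℚ-++ xs ys)) (sym (ℚ.+-assoc x (Σℚ xs) (Σℚ ys)))

Σℚ≤ : ∀ {b xs} → All (_≤ b) xs → Σℚ xs ≤ ι (length xs) * b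
Σℚ≤ {b} [] = ℚ.≤-reflexive (sym (trans (cong (_* b) ι-0) (ℚ.*-zeroˡ b)))
Σℚ≤ {b} {x ∷ xs} (x≤b ∷ xs≤b) = ℚ.≤-trans (ℚ.+-mono-≤ x≤b (Σℚ≤ xs≤b))
  (ℚ.≤-reflexive (trans (lem b (ι (length xs))) (cong (_* b) (sym (ι-suc (length xs))))))
  where
  lem : ∀ b l → b + l * b ≡ (1ℚ + l) * b
  lem = solve-∀ ℚ-ring

2^mono : ∀ {m n} → m ℕ.≤ n → 2 ^ m ℕ.≤ 2 ^ n
2^mono = ℕ.^-monoʳ-≤ 2

dyadic-density : ∀ h i → 2 ℕ.≤ i → ι i * Σℚ (map (density h) (dyadicPrimes i)) ≤ ι 4
dyadic-density h i 2≤i = begin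
  ι i * Σℚ (map (density h) (dyadicPrimes i)) ≤⟨ *-monoʳ (0≤ι i) (Σℚ≤ (All.map⁺ (primesIn-All (2 ^ i) (2 ^ suc i) small))) ⟩
  ι i * (ι (length (map (density h) (dyadicPrimes i))) * (ρ + ρ)) ≡⟨ cong (λ k → ι i * (ι k * (ρ + ρ))) (List.length-map (density h) (dyadicPrimes i)) ⟩
  ι i * (ι r * (ρ + ρ)) ≡⟨ lem₁ (ι i) (ι r) ρ ⟩
  ι i * ι r * (ρ + ρ) ≤⟨ *-monoˡ (0≤+ (0≤recip (2 ^ i)) (0≤recip (2 ^ i))) (subst₂ _≤_ (ι-* i r) refl (ι-mono-≤ (chebyshev-dyadic i 2≤i))) ⟩
  ι (2 · 2 ^ i) * (ρ + ρ) ≡⟨ cong (_* (ρ + ρ)) (ι-* 2 (2 ^ i)) ⟩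
  ι 2 * ι (2 ^ i) * (ρ + ρ) ≡⟨ lem₂ (ι 2) (ι (2 ^ i)) ρ ⟩
  (ι 2 + ι 2) * (ι (2 ^ i) * ρ) ≡⟨ cong₂ _*_ (sym (ι-+ 2 2)) (ι-recip (2 ^ i) {{2^≢0 i}}) ⟩
  ι 4 * 1ℚ ≡⟨ ℚ.*-identityʳ (ι 4) ⟩
  ι 4 ∎
  where
  open ℚ.≤-Reasoning
  ρ = recip (2 ^ i)
  r = length (dyadicPrimes i)
  small : ∀ p → 2 ^ i ℕ.≤ p → p ℕ.< 2 ^ suc i → Prime p → density h p ≤ ρ + ρ
  small p l _ _ = ℚ.≤-trans (proj₂ (density-bounds h p)) (ℚ.+-mono-≤ (recip-≤ {{2^≢0 i}} l) (recip-≤ {{2^≢0 i}} l))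
  lem₁ : ∀ i r ρ → i * (r * (ρ + ρ)) ≡ i * r * (ρ + ρ)
  lem₁ = solve-∀ ℚ-ring
  lem₂ : ∀ t z ρ → t * z * (ρ + ρ) ≡ (t + t) * (z * ρ)
  lem₂ = solve-∀ ℚ-ring

-- Each of the t dyadic intervals contributes at most 4/m, its exponent being at least m.
block-density : ∀ h m t → 2 ℕ.≤ m → ι m * Σℚ (map (density h) (primesIn (2 ^ m) (2 ^ (m ℕ.+ t)))) ≤ ι t * ι 4
block-density h m zero 2≤m = ℚ.≤-reflexive (trans
  (cong (λ ps → ι m * Σℚ (map (density h) ps)) (primesIn-empty (2 ^ (m ℕ.+ 0)) (ℕ.≤-reflexive (cong (2 ^_) (ℕ.+-identityʳ m)))))
  (trans (ℚ.*-zeroʳ (ι m)) (sym (trans (cong (_* ι 4) ι-0) (ℚ.*-zeroˡ (ι 4))))))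
block-density h m (suc t) 2≤m = begin
  ι m * Σd (primesIn (2 ^ m) (2 ^ (m ℕ.+ suc t))) ≡⟨ cong (λ k → ι m * Σd (primesIn (2 ^ m) (2 ^ k))) (ℕ.+-suc m t) ⟩
  ι m * Σd (primesIn (2 ^ m) (2 ^ suc n)) ≡⟨ cong (λ ps → ι m * Σd ps) (primesIn-++ (2^mono (ℕ.m≤m+n m t)) (2^mono (ℕ.n≤1+n n))) ⟨
  ι m * Σd (dyadicPrimes n ++ ps) ≡⟨ cong (ι m *_) (trans (cong Σℚ (List.map-++ (density h) (dyadicPrimes n) ps)) (Σℚ-++ (map (density h) (dyadicPrimes n)) (map (density h) ps))) ⟩
  ι m * (Σd (dyadicPrimes n) + Σd ps) ≡⟨ ℚ.*-distribˡ-+ (ι m) (Σd (dyadicPrimes n)) (Σd ps) ⟩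
  ι m * Σd (dyadicPrimes n) + ι m * Σd ps ≤⟨ ℚ.+-mono-≤ (*-monoˡ (Σ-nonneg (All.map⁺ (All.universal (λ p → proj₁ (density-bounds h p)) (dyadicPrimes n)))) (ι-mono-≤ (ℕ.m≤m+n m t))) (block-density h m t 2≤m) ⟩
  ι n * Σd (dyadicPrimes n) + ι t * ι 4 ≤⟨ ℚ.+-monoˡ-≤ (ι t * ι 4) (dyadic-density h n (ℕ.≤-trans 2≤m (ℕ.m≤m+n m t))) ⟩
  ι 4 + ι t * ι 4 ≡⟨ lem (ι 4) (ι t) ⟩
  (1ℚ + ι t) * ι 4 ≡⟨ cong (_* ι 4) (ι-suc t) ⟨
  ι (suc t) * ι 4 ∎
  where
  open ℚ.≤-Reasoning
  n = m ℕ.+ t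
  Σd : List ℕ → ℚ
  Σd ps = Σℚ (map (density h) ps)
  ps = primesIn (2 ^ m) (2 ^ n)
  lem : ∀ a t → a + t * a ≡ (1ℚ + t) * a
  lem = solve-∀ ℚ-ring

-- The system of blocks

-- H is the number of blocks per level, and the primes below 2 ^ H are not sieved by; it is opaque so that
-- 2 ^ H and the primes below it are never computed.
opaque
  H : ℕ
  H = 16

  H≡16 : H ≡ 16
  H≡16 = refl

-- As s runs from 0 to H - 1, the exponents grow in steps of 2^ℓ from H · 2^ℓ to H · 2^(ℓ+1), where
-- the next level begins.
blockPrimes : ℕ → ℕ → List ℕ
blockPrimes ℓ s = primesIn (2 ^ ((H ℕ.+ s) · 2 ^ ℓ)) (2 ^ ((H ℕ.+ s) · 2 ^ ℓ ℕ.+ 2 ^ ℓ))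

-- The primes of [2^(H·2^ℓ), 2^((H+s)·2^ℓ)), cut into s blocks.
level : ℕ → ℕ → ℕ → List Block → List Block
level t ℓ zero    B = B
level t ℓ (suc s) B = (t , blockPrimes ℓ s) ∷ level t ℓ s B

-- The truncation depth grows towards the small primes, which keeps both the total excess and the number of terms in check.
levels : ℕ → ℕ → List Block
levels zero    t = []
levels (suc r) t = level t r H (levels r (suc t))

2H2^≡ : ∀ r → (H ℕ.+ H) · 2 ^ r ≡ H · 2 ^ suc r
2H2^≡ r = lem H (2 ^ r)
  where
  lem : ∀ h x → (h ℕ.+ h) · x ≡ h · (2 · x)
  lem = solve-ℕ

primes-level : ∀ t ℓ s B → primes B ≡ primesIn (2 ^ H) (2 ^ (H · 2 ^ ℓ)) →
  primes (level t ℓ s B) ≡ primesIn (2 ^ H) (2 ^ ((H ℕ.+ s) · 2 ^ ℓ))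
primes-level t ℓ zero B eq = trans eq (cong (λ k → primesIn (2 ^ H) (2 ^ (k · 2 ^ ℓ))) (sym (ℕ.+-identityʳ H)))
primes-level t ℓ (suc s) B eq = begin
  primesIn b c ++ primes (level t ℓ s B) ≡⟨ cong (primesIn b c ++_) (primes-level t ℓ s B eq) ⟩
  primesIn b c ++ primesIn (2 ^ H) b ≡⟨ primesIn-++ a≤b (2^mono (ℕ.m≤m+n m (2 ^ ℓ))) ⟩
  primesIn (2 ^ H) c ≡⟨ cong (λ k → primesIn (2 ^ H) (2 ^ k)) (lem H s (2 ^ ℓ)) ⟩
  primesIn (2 ^ H) (2 ^ ((H ℕ.+ suc s) · 2 ^ ℓ)) ∎
  where
  open ≡-Reasoning
  m = (H ℕ.+ s) · 2 ^ ℓ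
  b = 2 ^ m
  c = 2 ^ (m ℕ.+ 2 ^ ℓ)
  a≤b : 2 ^ H ℕ.≤ b
  a≤b = 2^mono (ℕ.≤-trans (ℕ.m≤m+n H s) (ℕ.m≤m*n (H ℕ.+ s) (2 ^ ℓ) {{2^≢0 ℓ}}))
  lem : ∀ h s x → (h ℕ.+ s) · x ℕ.+ x ≡ (h ℕ.+ suc s) · x
  lem = solve-ℕ

primes-levels : ∀ r t → primes (levels r t) ≡ primesIn (2 ^ H) (2 ^ (H · 2 ^ r))
primes-levels zero t = sym (primesIn-empty (2 ^ (H · 1)) (ℕ.≤-reflexive (cong (2 ^_) (ℕ.*-identityʳ H))))
primes-levels (suc r) t = trans (primes-level t r H (levels r (suc t)) (primes-levels r (suc t)))
  (cong (λ k → primesIn (2 ^ H) (2 ^ k)) (2H2^≡ r))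

16·2^≤ : ∀ s ℓ → 16 · 2 ^ ℓ ℕ.≤ (H ℕ.+ s) · 2 ^ ℓ
16·2^≤ s ℓ = ℕ.*-monoˡ-≤ (2 ^ ℓ) (ℕ.≤-trans (ℕ.≤-reflexive (sym H≡16)) (ℕ.m≤m+n H s))

2≤16·2^ : ∀ ℓ → 2 ℕ.≤ 16 · 2 ^ ℓ
2≤16·2^ ℓ = ℕ.*-mono-≤ {2} {16} {1} (s≤s (s≤s z≤n)) (ℕ.m^n>0 2 ℓ)

-- Here H = 16 is decisive: the block consists of 2^ℓ dyadic intervals with exponents at least 16 ·
-- 2^ℓ, so its densities add up to at most 4/16.
thin-block : ∀ h t ℓ s → Thin h (t , blockPrimes ℓ s)
thin-block h t ℓ s = *-cancel-≤ (0<ι (16 · 2 ^ ℓ) {{ℕ.m*n≢0 16 (2 ^ ℓ) {{_}} {{2^≢0 ℓ}}}}) (begin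
  ι (16 · 2 ^ ℓ) * S ≤⟨ *-monoˡ 0≤S (ι-mono-≤ (16·2^≤ s ℓ)) ⟩
  ι m * S ≤⟨ block-density h m (2 ^ ℓ) (ℕ.≤-trans (2≤16·2^ ℓ) (16·2^≤ s ℓ)) ⟩
  ι (2 ^ ℓ) * ι 4 ≡⟨ cong (ι (2 ^ ℓ) *_) (ℚ.*-identityʳ (ι 4)) ⟨
  ι (2 ^ ℓ) * (ι 4 * 1ℚ) ≡⟨ cong (λ x → ι (2 ^ ℓ) * (ι 4 * x)) (ι-recip 4) ⟨
  ι (2 ^ ℓ) * (ι 4 * (ι 4 * recip 4)) ≡⟨ lem (ι (2 ^ ℓ)) (ι 4) (recip 4) ⟩
  (ι 4 * ι 4) * ι (2 ^ ℓ) * recip 4 ≡⟨ cong (_* recip 4) (trans (cong (_* ι (2 ^ ℓ)) (sym (ι-* 4 4))) (sym (ι-* 16 (2 ^ ℓ)))) ⟩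
  ι (16 · 2 ^ ℓ) * recip 4 ∎)
  where
  open ℚ.≤-Reasoning
  m = (H ℕ.+ s) · 2 ^ ℓ
  S = Σℚ (map (density h) (primesIn (2 ^ m) (2 ^ (m ℕ.+ 2 ^ ℓ))))
  0≤S : 0ℚ ≤ S
  0≤S = Σ-nonneg (All.map⁺ (All.universal (λ p → proj₁ (density-bounds h p)) (primesIn (2 ^ m) (2 ^ (m ℕ.+ 2 ^ ℓ)))))
  lem : ∀ x f q → x * (f * (f * q)) ≡ (f * f) * x * q
  lem = solve-∀ ℚ-ring

thin-levels : ∀ h r t → All (Thin h) (levels r t)
thin-levels h zero t = []
thin-levels h (suc r) t = go H
  where
  go : ∀ s → All (Thin h) (level t r s (levels r (suc t)))
  go zero    = thin-levels h r (suc t)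
  go (suc s) = thin-block h t r s ∷ go s

totalExcess-level : ∀ t ℓ s B → totalExcess (level t ℓ s B) ≡ ι s * excess t + totalExcess B
totalExcess-level t ℓ zero B = sym (trans (cong (λ x → x * excess t + totalExcess B) ι-0) (lem (excess t) (totalExcess B)))
  where
  lem : ∀ x y → 0ℚ * x + y ≡ y
  lem = solve-∀ ℚ-ring
totalExcess-level t ℓ (suc s) B = trans (cong (excess t +_) (totalExcess-level t ℓ s B))
  (trans (lem (excess t) (ι s) (totalExcess B)) (cong (λ x → x * excess t + totalExcess B) (sym (ι-suc s))))
  where
  lem : ∀ e s b → e + (s * e + b) ≡ (1ℚ + s) * e + b
  lem = solve-∀ ℚ-ring

excess-suc : ∀ t → excess (suc t) + excess (suc t) ≤ excess t
excess-suc t = begin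
  excess (suc t) + excess (suc t) ≡⟨ cong (λ k → 2ℚ * (q * (q * q ^ℚ k)) + 2ℚ * (q * (q * q ^ℚ k))) (ℕ.+-suc t t) ⟩
  2ℚ * (q * (q * y)) + 2ℚ * (q * (q * y)) ≡⟨ lem q y ⟩
  (q + q) * (q * (2ℚ * y)) ≤⟨ *-mono-≤ (0≤+ 0≤q 0≤q) 2q≤1 (0≤* 0≤q 0≤e) (*-mono-≤ 0≤q (recip≤1 {4} (s≤s (s≤s z≤n))) 0≤e ℚ.≤-refl) ⟩
  1ℚ * (1ℚ * (2ℚ * y)) ≡⟨ lem′ y ⟩
  2ℚ * y ∎
  where
  open ℚ.≤-Reasoning
  q = recip 4
  y = q ^ℚ depth t
  0≤q = 0≤recip 4
  0≤e = excess-nonneg t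
  2q≤1 : q + q ≤ 1ℚ
  2q≤1 = 2·recip≤1 {4} (s≤s (s≤s z≤n))
  lem : ∀ q y → 2ℚ * (q * (q * y)) + 2ℚ * (q * (q * y)) ≡ (q + q) * (q * (2ℚ * y))
  lem = solve-∀ ℚ-ring
  lem′ : ∀ y → 1ℚ * (1ℚ * (2ℚ * y)) ≡ 2ℚ * y
  lem′ = solve-∀ ℚ-ring

-- The excess at least halves from each level to the next one towards the small primes, so the total
-- is at most twice the contribution of the top level.
totalExcess-levels : ∀ r t → totalExcess (levels r t) ≤ (ι H + ι H) * excess t
totalExcess-levels zero t = 0≤* (0≤+ (0≤ι H) (0≤ι H)) (excess-nonneg t)
totalExcess-levels (suc r) t = begin
  totalExcess (level t r H (levels r (suc t))) ≡⟨ totalExcess-level t r H (levels r (suc t)) ⟩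
  ι H * excess t + totalExcess (levels r (suc t)) ≤⟨ ℚ.+-monoʳ-≤ (ι H * excess t) (totalExcess-levels r (suc t)) ⟩
  ι H * excess t + (ι H + ι H) * excess (suc t) ≡⟨ lem (ι H) (excess t) (excess (suc t)) ⟩
  ι H * (excess t + (excess (suc t) + excess (suc t))) ≤⟨ *-monoʳ (0≤ι H) (ℚ.+-monoʳ-≤ (excess t) (excess-suc t)) ⟩
  ι H * (excess t + excess t) ≡⟨ lem′ (ι H) (excess t) ⟩
  (ι H + ι H) * excess t ∎
  where
  open ℚ.≤-Reasoning
  lem : ∀ h e f → h * e + (h + h) * f ≡ h * (e + (f + f))
  lem = solve-∀ ℚ-ring
  lem′ : ∀ h e → h * (e + e) ≡ (h + h) * e
  lem′ = solve-∀ ℚ-ring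

opaque
  unfolding ι recip H

  -- This selects the starting depth 2: the left side is 32 · 2 · 4^(-5) = 1/16, while depth 1 would
  -- give 1.
  totalExcess-2≤½ : (ι H + ι H) * excess 2 ≤ recip 2
  totalExcess-2≤½ = ℚ.≤ᵇ⇒≤ _

totalExcess≤½ : ∀ r → totalExcess (levels r 2) ≤ recip 2
totalExcess≤½ r = ℚ.≤-trans (totalExcess-levels r 2) totalExcess-2≤½

-- The block lies below 2^(32 · 2^ℓ), as H + s + 1 ≤ 32. Two more units in the exponent, at most 2 ·
-- 2^ℓ, cover the passage from r to 2r + 1.
terms-block : ∀ t ℓ s → s ℕ.< H →
  terms (depth t) (length (blockPrimes ℓ s)) ℕ.≤ 2 ^ (34 · 2 ^ ℓ · depth t)
terms-block t ℓ s s<H = begin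
  terms (depth t) r ≤⟨ terms≤ (depth t) r ⟩
  suc (r ℕ.+ r) ^ depth t ≤⟨ ℕ.^-monoˡ-≤ (depth t) base ⟩
  (2 ^ (34 · y)) ^ depth t ≡⟨ ℕ.^-*-assoc 2 (34 · y) (depth t) ⟩
  2 ^ (34 · y · depth t) ∎
  where
  open ℕ.≤-Reasoning
  y = 2 ^ ℓ
  m = (H ℕ.+ s) · y
  r = length (primesIn (2 ^ m) (2 ^ (m ℕ.+ y)))
  c = 2 ^ (m ℕ.+ y)
  exponent : suc (suc (m ℕ.+ y)) ℕ.≤ 34 · y
  exponent = begin
    2 ℕ.+ (m ℕ.+ y) ≤⟨ ℕ.+-mono-≤ (ℕ.*-mono-≤ {2} {2} {1} ℕ.≤-refl (ℕ.m^n>0 2 ℓ)) ℕ.≤-refl ⟩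
    2 · y ℕ.+ ((H ℕ.+ s) · y ℕ.+ y) ≡⟨ lem H s y ⟩
    (2 ℕ.+ (H ℕ.+ suc s)) · y ≤⟨ ℕ.*-monoˡ-≤ y (ℕ.+-monoʳ-≤ 2 (ℕ.+-monoʳ-≤ H s<H)) ⟩
    (2 ℕ.+ (H ℕ.+ H)) · y ≡⟨ cong (λ k → (2 ℕ.+ (k ℕ.+ k)) · y) H≡16 ⟩
    34 · y ∎
    where
    lem : ∀ h s y → 2 · y ℕ.+ ((h ℕ.+ s) · y ℕ.+ y) ≡ (2 ℕ.+ (h ℕ.+ suc s)) · y
    lem = solve-ℕ
  base : suc (r ℕ.+ r) ℕ.≤ 2 ^ (34 · y)
  base = begin
    suc (r ℕ.+ r) ≤⟨ ℕ.+-mono-≤ (ℕ.m^n>0 2 (suc (m ℕ.+ y))) (ℕ.+-mono-≤ (length-primesIn (2 ^ m) c) (length-primesIn (2 ^ m) c)) ⟩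
    2 ^ suc (m ℕ.+ y) ℕ.+ (c ℕ.+ c) ≡⟨ lem′ c ⟩
    2 ^ suc (suc (m ℕ.+ y)) ≤⟨ 2^mono exponent ⟩
    2 ^ (34 · y) ∎
    where
    lem′ : ∀ c → 2 · c ℕ.+ (c ℕ.+ c) ≡ 2 · (2 · c)
    lem′ = solve-ℕ

totalTerms-level : ∀ t ℓ s B → s ℕ.≤ H →
  totalTerms (level t ℓ s B) ℕ.≤ 2 ^ (s · (34 · 2 ^ ℓ · depth t)) · totalTerms B
totalTerms-level t ℓ zero B _ = ℕ.≤-reflexive (sym (ℕ.*-identityˡ (totalTerms B)))
totalTerms-level t ℓ (suc s) B s<H = begin
  terms (depth t) (length ps) · totalTerms (level t ℓ s B) ≤⟨ ℕ.*-mono-≤ (terms-block t ℓ s s<H) (totalTerms-level t ℓ s B (ℕ.<⇒≤ s<H)) ⟩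
  2 ^ x · (2 ^ (s · x) · totalTerms B) ≡⟨ ℕ.*-assoc (2 ^ x) (2 ^ (s · x)) (totalTerms B) ⟨
  2 ^ x · 2 ^ (s · x) · totalTerms B ≡⟨ cong (_· totalTerms B) (ℕ.^-distribˡ-+-* 2 x (s · x)) ⟨
  2 ^ (suc s · x) · totalTerms B ∎
  where
  open ℕ.≤-Reasoning
  x = 34 · 2 ^ ℓ · depth t
  ps = blockPrimes ℓ s

-- Level ℓ contributes 544 · 2^ℓ · (2t' + 1) to the exponent, where 544 = 16 · 34 and t' grows by
-- one as ℓ drops by one. The factor t + t + 3 is the value of the infinite series Σ_j 2^(-1-j) (2t
-- + 1 + 2j).
totalTerms-levels : ∀ r t → totalTerms (levels r t) ℕ.≤ 2 ^ (544 · (t ℕ.+ t ℕ.+ 3) · 2 ^ r)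
totalTerms-levels zero t = ℕ.m^n>0 2 (544 · (t ℕ.+ t ℕ.+ 3) · 1)
totalTerms-levels (suc r) t = begin
  totalTerms (level t r H (levels r (suc t))) ≤⟨ totalTerms-level t r H (levels r (suc t)) ℕ.≤-refl ⟩
  2 ^ (H · x) · totalTerms (levels r (suc t)) ≤⟨ ℕ.*-monoʳ-≤ (2 ^ (H · x)) (totalTerms-levels r (suc t)) ⟩
  2 ^ (H · x) · 2 ^ x′ ≡⟨ ℕ.^-distribˡ-+-* 2 (H · x) x′ ⟨
  2 ^ (H · x ℕ.+ x′) ≡⟨ cong (λ k → 2 ^ (k · x ℕ.+ x′)) H≡16 ⟩
  2 ^ (16 · x ℕ.+ x′) ≡⟨ cong (2 ^_) (lem (2 ^ r) t) ⟩
  2 ^ (544 · (t ℕ.+ t ℕ.+ 3) · 2 ^ suc r) ∎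
  where
  open ℕ.≤-Reasoning
  x = 34 · 2 ^ r · depth t
  x′ = 544 · (suc t ℕ.+ suc t ℕ.+ 3) · 2 ^ r
  lem : ∀ y t → 16 · (34 · y · suc (t ℕ.+ t)) ℕ.+ 544 · (suc t ℕ.+ suc t ℕ.+ 3) · y ≡ 544 · (t ℕ.+ t ℕ.+ 3) · (2 · y)
  lem = solve-ℕ

sievingPrimes : ℕ → List ℕ
sievingPrimes r = primesIn (2 ^ H) (2 ^ (H · 2 ^ r))

-- 3808 = 544 · (2 + 2 + 3) comes from totalTerms-levels at t = 2.
brun-hooley : ∀ h r n →
  ∑ n (unsifted h (sievingPrimes r)) ≤ 2ℚ * ∏[1- map (density h) (sievingPrimes r) ] * ι n + ι (2 ^ (3808 · 2 ^ r))
brun-hooley h r n = begin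
  ∑ n (unsifted h (sievingPrimes r)) ≡⟨ cong (λ ps → ∑ n (unsifted h ps)) (primes-levels r 2) ⟨
  ∑ n (unsifted h (primes B)) ≤⟨ sieve-bound h B n prs (subst Descending (sym (primes-levels r 2)) (primesIn-descending (2 ^ H) (2 ^ (H · 2 ^ r)))) ⟩
  mean h B * ι n + ι (totalTerms B) ≤⟨ ℚ.+-mono-≤ (*-monoˡ (0≤ι n) mean≤2V) (ι-mono-≤ (totalTerms-levels r 2)) ⟩
  2ℚ * V * ι n + ι (2 ^ (3808 · 2 ^ r)) ∎
  where
  open ℚ.≤-Reasoning
  B = levels r 2
  V = ∏[1- map (density h) (sievingPrimes r) ]
  prs : All Prime (primes B)
  prs = subst (All Prime) (sym (primes-levels r 2)) (primesIn-prime (2 ^ H) (2 ^ (H · 2 ^ r)))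
  σ = totalExcess B
  σ≤½ = totalExcess≤½ r
  mean-V : mean h B * (1ℚ - σ) ≤ V
  mean-V = subst (λ ps → mean h B * (1ℚ - σ) ≤ ∏[1- map (density h) ps ]) (primes-levels r 2)
    (mean≤ h B prs (thin-levels h r 2) (ℚ.≤-trans σ≤½ (recip≤1 {2} ℕ.≤-refl)))
  mean≤2V : mean h B ≤ 2ℚ * V
  mean≤2V = ≤-by (lem (mean h B) V σ (recip 2))
    (0≤+ (0≤+ (0≤b-a mean-V) (0≤b-a mean-V))
         (0≤* (mean-nonneg h B prs) (0≤+ (0≤+ (0≤b-a σ≤½) (0≤b-a σ≤½)) (0≤b-a (2·recip≤1 {2} ℕ.≤-refl)))))
    where
    lem : ∀ m v s q → 2ℚ * v ≡ m + (((v - m * (1ℚ - s)) + (v - m * (1ℚ - s))) + m * (((q - s) + (q - s)) + (1ℚ - (q + q))))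
    lem = solve-∀ ℚ-ring

-- Mertens' upper bound for the Euler product

euler : List ℕ → ℚ
euler ps = ∏[1- map recip ps ]

coprimeTo : List ℕ → ℕ → ℚ
coprimeTo ps n = ∏[1- map (λ p → χ p n) ps ]

coprimeTo-unit : ∀ ps n → InUnit (coprimeTo ps n)
coprimeTo-unit ps n = ∏-unit (All.map⁺ (All.universal (λ p → 0≤𝟙 (p ∣? n) , 𝟙≤1 (p ∣? n)) ps))

coprimeTo≡0 : ∀ {ps p n} → p ∈ ps → p ∣ n → coprimeTo ps n ≡ 0ℚ
coprimeTo≡0 {p ∷ ps} {n = n} (here refl) p∣n = trans
  (cong (λ x → (1ℚ - x) * coprimeTo ps n) (𝟙-yes (p ∣? n) p∣n)) (ℚ.*-zeroˡ (coprimeTo ps n))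
coprimeTo≡0 {p′ ∷ ps} {n = n} (there p∈ps) p∣n = trans
  (cong ((1ℚ - χ p′ n) *_) (coprimeTo≡0 p∈ps p∣n)) (ℚ.*-zeroʳ (1ℚ - χ p′ n))

coprimeTo≡1 : ∀ {ps n} → All (λ p → ¬ p ∣ n) ps → coprimeTo ps n ≡ 1ℚ
coprimeTo≡1 [] = refl
coprimeTo≡1 {p ∷ ps} {n} (p∤n ∷ ps∤n) = cong₂ (λ x y → (1ℚ - x) * y) (𝟙-no (p ∣? n) p∤n) (coprimeTo≡1 ps∤n)

coprimeTo-*≤ : ∀ ps d n → coprimeTo ps (d · n) ≤ coprimeTo ps n
coprimeTo-*≤ [] d n = ℚ.≤-refl
coprimeTo-*≤ (p ∷ ps) d n = *-mono-≤ (0≤b-a (𝟙≤1 (p ∣? (d · n))))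
  (ℚ.+-monoʳ-≤ 1ℚ (ℚ.neg-antimono-≤ (𝟙-mono (p ∣? n) (p ∣? (d · n)) (∣.∣n⇒∣m*n d))))
  (proj₁ (coprimeTo-unit ps (d · n))) (coprimeTo-*≤ ps d n)

∑-sieve-step : ∀ p ps n (f : ℕ → ℚ) →
  ∑ n (λ i → coprimeTo (p ∷ ps) i * f i) ≡ ∑ n (λ i → coprimeTo ps i * f i) - ∑ n (λ i → χ p i * (coprimeTo ps i * f i))
∑-sieve-step p ps n f = trans (∑-cong n (λ i _ → lem (χ p i) (coprimeTo ps i) (f i)))
  (∑-sub n (λ i → coprimeTo ps i * f i) (λ i → χ p i * (coprimeTo ps i * f i)))
  where
  lem : ∀ x u f → (1ℚ - x) * u * f ≡ u * f - x * (u * f)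
  lem = solve-∀ ℚ-ring

-- The multiples of p are p · i with i in a shorter range, and if p · i survives the earlier primes
-- then so does i. Sieving by p thus removes at most 1/p of the sum.
euler-harmonic : ∀ {ps} → All NonZero ps → ∀ n → euler ps * ∑ n recip ≤ ∑ n (λ i → coprimeTo ps i * recip i)
euler-harmonic [] n = ℚ.≤-reflexive (trans (ℚ.*-identityˡ (∑ n recip)) (∑-cong n (λ i _ → sym (ℚ.*-identityˡ (recip i)))))
euler-harmonic {p ∷ ps} (p≢0 ∷ ps≢0) n with ∑-multiples p {{p≢0}} n
... | m , _ , pm<n+p , sums = begin
  (1ℚ - recip p) * euler ps * ∑ n recip ≡⟨ ℚ.*-assoc (1ℚ - recip p) (euler ps) (∑ n recip) ⟩
  (1ℚ - recip p) * (euler ps * ∑ n recip) ≤⟨ *-monoʳ (0≤b-a (ℚ.≤-trans (recip-≤ {1} (ℕ.>-nonZero⁻¹ p {{p≢0}})) (ℚ.≤-reflexive recip-1))) (euler-harmonic ps≢0 n) ⟩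
  (1ℚ - recip p) * S ≡⟨ lem (recip p) S ⟩
  S - recip p * S ≤⟨ ℚ.+-monoʳ-≤ S (ℚ.neg-antimono-≤ multiples≤) ⟩
  S - ∑ n (λ i → χ p i * (coprimeTo ps i * recip i)) ≡⟨ ∑-sieve-step p ps n recip ⟨
  ∑ n (λ i → coprimeTo (p ∷ ps) i * recip i) ∎
  where
  open ℚ.≤-Reasoning
  g : ℕ → ℚ
  g i = coprimeTo ps i * recip i
  S = ∑ n g
  0≤g : ∀ i → 0ℚ ≤ g i
  0≤g i = 0≤* (proj₁ (coprimeTo-unit ps i)) (0≤recip i)
  lem : ∀ r s → (1ℚ - r) * s ≡ s - r * s
  lem = solve-∀ ℚ-ring
  lem′ : ∀ u r s → u * (r * s) ≡ r * (u * s)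
  lem′ = solve-∀ ℚ-ring
  m≤n : m ℕ.≤ n
  m≤n = ℕ.≮⇒≥ (λ n<m → ℕ.<⇒≱ pm<n+p (n+p≤pm n<m))
    where
    n+p≤pm : n ℕ.< m → n ℕ.+ p ℕ.≤ p · m
    n+p≤pm n<m = ℕ.≤-trans (ℕ.+-monoˡ-≤ p (ℕ.m≤n*m n p {{p≢0}}))
      (ℕ.≤-trans (ℕ.≤-reflexive (trans (ℕ.+-comm (p · n) p) (sym (ℕ.*-suc p n)))) (ℕ.*-monoʳ-≤ p n<m))
  multiples≤ : ∑ n (λ i → χ p i * g i) ≤ recip p * S
  multiples≤ = begin
    ∑ n (λ i → χ p i * g i) ≡⟨ sums g ⟩
    ∑ m (λ i → g (p · i)) ≤⟨ ∑-mono m (λ i _ → ℚ.≤-trans (*-monoˡ (0≤recip (p · i)) (coprimeTo-*≤ ps p i))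
                                                                   (ℚ.≤-reflexive (trans (cong (coprimeTo ps i *_) (recip-* p i)) (lem′ (coprimeTo ps i) (recip p) (recip i))))) ⟩
    ∑ m (λ i → recip p * g i) ≡⟨ ∑-*ˡ m (recip p) g ⟩
    recip p * ∑ m g ≤⟨ *-monoʳ (0≤recip p) (∑-mono-length 0≤g m≤n) ⟩
    recip p * S ∎

prime-divisor : ∀ n → 2 ℕ.≤ n → ∃[ p ] (Prime p × p ∣ n)
prime-divisor n 2≤n = go (factors f) (factorsPrime f) (isFactorisation f)
  where
  open Fact.PrimeFactorisation
  f = Fact.factorise n {{ℕ.>-nonZero (ℕ.<-trans (s≤s z≤n) 2≤n)}}
  go : ∀ ps → All Prime ps → n ≡ product ps → ∃[ p ] (Prime p × p ∣ n)
  go [] [] n≡1 = contradiction (subst (2 ℕ.≤_) n≡1 2≤n) λ { (s≤s ()) }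
  go (p ∷ ps) (pr ∷ _) n≡ = p , pr , subst (p ∣_) (sym n≡) (∣.m∣m*n (product ps))

-- Every i with 2 ≤ i < z has a prime divisor below z, so only i = 1 is left; i = 0 contributes
-- nothing because `recip 0` is 0.
coprime-harmonic≤1 : ∀ z → ∑ z (λ i → coprimeTo (primesIn 0 z) i * recip i) ≤ 1ℚ
coprime-harmonic≤1 z = go z ℕ.≤-refl
  where
  f : ℕ → ℚ
  f i = coprimeTo (primesIn 0 z) i * recip i
  f0≡0 : f 0 ≡ 0ℚ
  f0≡0 = trans (cong (coprimeTo (primesIn 0 z) 0 *_) recip-0) (ℚ.*-zeroʳ (coprimeTo (primesIn 0 z) 0))
  f≡0 : ∀ n → 2 ℕ.≤ n → n ℕ.< z → f n ≡ 0ℚ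
  f≡0 n 2≤n n<z with prime-divisor n 2≤n
  ... | p , pr , p∣n = trans (cong (_* recip n) (coprimeTo≡0 (∈-primesIn pr z≤n (ℕ.≤-<-trans (∣.∣⇒≤ {{ℕ.>-nonZero (ℕ.<-trans (s≤s z≤n) 2≤n)}} p∣n) n<z)) p∣n)) (ℚ.*-zeroˡ (recip n))
  go : ∀ k → k ℕ.≤ z → ∑ k f ≤ 1ℚ
  go zero _ = 0≤1
  go (suc zero) _ = subst (_≤ 1ℚ) (sym (trans (ℚ.+-identityˡ (f 0)) f0≡0)) 0≤1
  go (suc (suc zero)) _ = begin
    0ℚ + f 0 + f 1 ≡⟨ cong₂ _+_ (trans (ℚ.+-identityˡ (f 0)) f0≡0) refl ⟩
    0ℚ + f 1 ≡⟨ ℚ.+-identityˡ (f 1) ⟩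
    f 1 ≤⟨ *-monoˡ (0≤recip 1) (proj₂ (coprimeTo-unit (primesIn 0 z) 1)) ⟩
    1ℚ * recip 1 ≡⟨ trans (ℚ.*-identityˡ (recip 1)) recip-1 ⟩
    1ℚ ∎
    where open ℚ.≤-Reasoning
  go (suc k@(suc (suc _))) k<z = subst (_≤ 1ℚ)
    (sym (trans (cong (∑ k f +_) (f≡0 k (s≤s (s≤s z≤n)) k<z)) (ℚ.+-identityʳ (∑ k f)))) (go k (ℕ.<⇒≤ k<z))

harmonic≥ : ∀ k → ι k ≤ 2ℚ * ∑ (2 ^ k) recip
harmonic≥ zero = subst (_≤ 2ℚ * ∑ 1 recip) (sym ι-0) (0≤* 0≤2 (∑-nonneg 1 0≤recip))
harmonic≥ (suc k) = begin
  ι (suc k) ≡⟨ trans (ι-suc k) (ℚ.+-comm 1ℚ (ι k)) ⟩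
  ι k + 1ℚ ≤⟨ ℚ.+-mono-≤ (harmonic≥ k) half ⟩
  2ℚ * ∑ y recip + 2ℚ * ∑ y (λ i → recip (y ℕ.+ i)) ≡⟨ ℚ.*-distribˡ-+ 2ℚ (∑ y recip) (∑ y (λ i → recip (y ℕ.+ i))) ⟨
  2ℚ * (∑ y recip + ∑ y (λ i → recip (y ℕ.+ i))) ≡⟨ cong (2ℚ *_) (trans (sym (∑-split y y recip)) (cong (λ n → ∑ n recip) (sym (2^suc k)))) ⟩
  2ℚ * ∑ (2 ^ suc k) recip ∎
  where
  open ℚ.≤-Reasoning
  y = 2 ^ k
  z = 2 ^ suc k
  half : 1ℚ ≤ 2ℚ * ∑ y (λ i → recip (y ℕ.+ i))
  half = begin
    1ℚ ≡⟨ ι-recip z {{2^≢0 (suc k)}} ⟨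
    ι z * recip z ≡⟨ cong (_* recip z) (trans (cong ι (2^suc k)) (ι-+ y y)) ⟩
    (ι y + ι y) * recip z ≡⟨ lem (ι y) (recip z) ⟩
    2ℚ * (ι y * recip z) ≡⟨ cong (2ℚ *_) (∑-const y (recip z)) ⟨
    2ℚ * ∑ y (λ _ → recip z) ≤⟨ *-monoʳ 0≤2 (∑-mono y (λ i i<y → recip-≤ {{ℕ.>-nonZero (ℕ.<-≤-trans (ℕ.m^n>0 2 k) (ℕ.m≤m+n y i))}}
                                                 (subst (y ℕ.+ i ℕ.≤_) (sym (2^suc k)) (ℕ.+-monoʳ-≤ y (ℕ.<⇒≤ i<y))))) ⟩
    2ℚ * ∑ y (λ i → recip (y ℕ.+ i)) ∎
    where
    lem : ∀ y r → (y + y) * r ≡ 2ℚ * (y * r)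
    lem = solve-∀ ℚ-ring

prime-recip-unit : ∀ {p} → Prime p → InUnit (recip p)
prime-recip-unit {p} pr = 0≤recip p , recip≤1 (2≤prime pr)

euler-unit : ∀ {ps} → All Prime ps → InUnit (euler ps)
euler-unit prs = ∏-unit (All.map⁺ (All.map prime-recip-unit prs))

mertens : ∀ w → euler (primesIn 0 (2 ^ w)) * ι w ≤ 2ℚ
mertens w = begin
  e * ι w ≤⟨ *-monoʳ (proj₁ (euler-unit (primesIn-prime 0 z))) (harmonic≥ w) ⟩
  e * (2ℚ * ∑ z recip) ≡⟨ lem e (∑ z recip) ⟩
  2ℚ * (e * ∑ z recip) ≤⟨ *-monoʳ 0≤2 (ℚ.≤-trans (euler-harmonic (All.map Pr.prime⇒nonZero (primesIn-prime 0 z)) z) (coprime-harmonic≤1 z)) ⟩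
  2ℚ * 1ℚ ≡⟨ ℚ.*-identityʳ 2ℚ ⟩
  1ℚ + 1ℚ ∎
  where
  open ℚ.≤-Reasoning
  z = 2 ^ w
  e = euler (primesIn 0 z)
  lem : ∀ e s → e * (2ℚ * s) ≡ 2ℚ * (e * s)
  lem = solve-∀ ℚ-ring

-- The product of 1 - 1/n over all n from 2 to a + 1 is smaller still, and telescopes to 1/(a + 1).
euler-lower : ∀ a → 1ℚ ≤ euler (primesIn 0 (suc (suc a))) * ι (suc a)
euler-lower zero = ℚ.≤-reflexive (sym (trans (ℚ.*-identityˡ (ι 1)) ι-1))
euler-lower (suc a) with 0 ℕ.≤? suc (suc a) ×-dec prime? (suc (suc a))
... | yes _ = ℚ.≤-trans (euler-lower a) (ℚ.≤-reflexive (sym (begin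
  (1ℚ - recip n) * e * ι n ≡⟨ lem (recip n) e (ι n) ⟩
  e * (ι n - ι n * recip n) ≡⟨ cong₂ (λ x y → e * (x - y)) (ι-suc (suc a)) (ι-recip n) ⟩
  e * (1ℚ + ι (suc a) - 1ℚ) ≡⟨ cong (e *_) (lem′ (ι (suc a))) ⟩
  e * ι (suc a) ∎)))
  where
  open ≡-Reasoning
  n = suc (suc a)
  e = euler (primesIn 0 (suc (suc a)))
  lem : ∀ r e n → (1ℚ - r) * e * n ≡ e * (n - n * r)
  lem = solve-∀ ℚ-ring
  lem′ : ∀ x → 1ℚ + x - 1ℚ ≡ x
  lem′ = solve-∀ ℚ-ring
... | no _ = ℚ.≤-trans (euler-lower a) (*-monoʳ (proj₁ (euler-unit (primesIn-prime 0 (suc (suc a))))) (ι-mono-≤ (ℕ.n≤1+n (suc a))))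

2^H≡3+a : ∃[ a ] (2 ^ H ≡ suc (suc (suc a)))
2^H≡3+a with ℕ.m≤n⇒∃[o]m+o≡n {3} {2 ^ H} (ℕ.≤-trans (ℕ.n≤1+n 3) (2^mono {2} {H} (subst (2 ℕ.≤_) (sym H≡16) (s≤s (s≤s z≤n)))))
... | a , eq = a , sym eq

-- The primes below 2^H are divided out of Mertens' bound; their Euler product is at least 2^(-H),
-- whence the constant.
mertens-sieving : ∀ r → euler (sievingPrimes r) * ι (H · 2 ^ r) ≤ 2ℚ * ι (2 ^ H)
mertens-sieving r with 2^H≡3+a
... | a , 2^H≡ = begin
  e * ι w ≡⟨ ℚ.*-identityʳ (e * ι w) ⟨
  e * ι w * 1ℚ ≤⟨ *-monoʳ (0≤* 0≤e (0≤ι w)) (ℚ.≤-trans (subst (λ n → 1ℚ ≤ euler (primesIn 0 n) * ι (suc (suc a))) (sym 2^H≡) (euler-lower (suc a)))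
                                        (*-monoʳ (proj₁ (euler-unit (primesIn-prime 0 (2 ^ H)))) (ι-mono-≤ (ℕ.≤-trans (ℕ.n≤1+n (suc (suc a))) (ℕ.≤-reflexive (sym 2^H≡)))))) ⟩
  e * ι w * (e₀ * ι (2 ^ H)) ≡⟨ lem e (ι w) e₀ (ι (2 ^ H)) ⟩
  (e * e₀) * ι w * ι (2 ^ H) ≡⟨ cong (λ x → x * ι w * ι (2 ^ H)) split ⟨
  euler (primesIn 0 (2 ^ w)) * ι w * ι (2 ^ H) ≤⟨ *-monoˡ (0≤ι (2 ^ H)) (mertens w) ⟩
  2ℚ * ι (2 ^ H) ∎
  where
  open ℚ.≤-Reasoning
  w = H · 2 ^ r
  e = euler (sievingPrimes r)
  0≤e = proj₁ (euler-unit (primesIn-prime (2 ^ H) (2 ^ w)))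
  e₀ = euler (primesIn 0 (2 ^ H))
  split : euler (primesIn 0 (2 ^ w)) ≡ e * e₀
  split = trans (cong euler (sym (primesIn-++ {0} {2 ^ H} {2 ^ w} z≤n (2^mono (ℕ.m≤m*n H (2 ^ r) {{2^≢0 r}})))))
    (trans (cong ∏[1-_] (List.map-++ recip (sievingPrimes r) (primesIn 0 (2 ^ H)))) (∏-++ (map recip (sievingPrimes r)) (map recip (primesIn 0 (2 ^ H)))))
  lem : ∀ e w f h → e * w * (f * h) ≡ (e * f) * w * h
  lem = solve-∀ ℚ-ring

-- The totient

length-filter-upTo : ∀ {ℓ} {P : Pred ℕ ℓ} (P? : Decidable P) n → ι (length (filter P? (upTo n))) ≡ ∑ n (λ i → 𝟙 (P? i))
length-filter-upTo P? zero = ι-0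
length-filter-upTo P? (suc n) = begin
  ι (length (filter P? (upTo (suc n)))) ≡⟨ cong (λ xs → ι (length (filter P? xs))) (List.upTo-∷ʳ n) ⟨
  ι (length (filter P? (upTo n ++ n ∷ []))) ≡⟨ cong (ι ∘ length) (List.filter-++ P? (upTo n) (n ∷ [])) ⟩
  ι (length (filter P? (upTo n) ++ filter P? (n ∷ []))) ≡⟨ cong ι (List.length-++ (filter P? (upTo n))) ⟩
  ι (length (filter P? (upTo n)) ℕ.+ length (filter P? (n ∷ []))) ≡⟨ ι-+ (length (filter P? (upTo n))) (length (filter P? (n ∷ []))) ⟩
  ι (length (filter P? (upTo n))) + ι (length (filter P? (n ∷ []))) ≡⟨ cong₂ _+_ (length-filter-upTo P? n) last ⟩
  ∑ n (λ i → 𝟙 (P? i)) + 𝟙 (P? n) ∎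
  where
  open ≡-Reasoning
  last : ι (length (filter P? (n ∷ []))) ≡ 𝟙 (P? n)
  last with P? n
  ... | yes _ = ι-1
  ... | no  _ = ι-0

φ≡∑ : ∀ q → ι (φ q) ≡ ∑ q (λ k → 𝟙 (coprime? k q))
φ≡∑ q = length-filter-upTo (λ k → coprime? k q) q

coprimeTo-* : ∀ {p ps} → Prime p → All Prime ps → All (ℕ._< p) ps → ∀ i → coprimeTo ps (p · i) ≡ coprimeTo ps i
coprimeTo-* pr [] [] i = refl
coprimeTo-* {p} {p′ ∷ ps} pr (pr′ ∷ prs) (p′<p ∷ ps<p) i =
  cong₂ (λ x y → (1ℚ - x) * y) (𝟙-cong (p′ ∣? (p · i)) (p′ ∣? i) (prime-∣-* i pr pr′ p′<p) (∣.∣n⇒∣m*n p)) (coprimeTo-* pr prs ps<p i)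

∑-multiples-exact : ∀ p .{{_ : NonZero p}} z (g : ℕ → ℚ) → ∑ (p · z) (λ n → χ p n * g n) ≡ ∑ z (λ i → g (p · i))
∑-multiples-exact p z g with ∑-multiples p (p · z)
... | m , pz≤pm , pm<pz+p , sums = trans (sums g) (cong (λ k → ∑ k (λ i → g (p · i))) (ℕ.≤-antisym
  (ℕ.≤-pred (ℕ.*-cancelˡ-< p m (suc z) (subst (p · m ℕ.<_) (trans (ℕ.+-comm (p · z) p) (sym (ℕ.*-suc p z))) pm<pz+p)))
  (ℕ.*-cancelˡ-≤ p pz≤pm)))

-- Over whole periods the sieve is exact. Since p · i avoids the smaller primes `ps` exactly when i
-- does, removing the multiples of p subtracts the same sum over a range shorter by the factor p.
∑-coprimeTo : ∀ {ps} → All Prime ps → Descending ps → ∀ m →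
  ∑ (product ps · m) (coprimeTo ps) ≡ ι (product ps · m) * euler ps
∑-coprimeTo [] [] m = ∑-const (1 · m) 1ℚ
∑-coprimeTo {p ∷ ps} (pr ∷ prs) (p> ∷ desc) m = begin
  ∑ n (coprimeTo (p ∷ ps)) ≡⟨ ∑-cong n (λ i _ → sym (ℚ.*-identityʳ (coprimeTo (p ∷ ps) i))) ⟩
  ∑ n (λ i → coprimeTo (p ∷ ps) i * 1ℚ) ≡⟨ ∑-sieve-step p ps n (λ _ → 1ℚ) ⟩
  ∑ n (λ i → coprimeTo ps i * 1ℚ) - ∑ n (λ i → χ p i * (coprimeTo ps i * 1ℚ)) ≡⟨ cong₂ _-_ (∑-cong n (λ i _ → ℚ.*-identityʳ (coprimeTo ps i))) (∑-cong n (λ i _ → cong (χ p i *_) (ℚ.*-identityʳ (coprimeTo ps i)))) ⟩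
  ∑ n (coprimeTo ps) - ∑ n (λ i → χ p i * coprimeTo ps i) ≡⟨ cong₂ _-_ all multiples ⟩
  ι p * (ι Πm * e) - ι Πm * e ≡⟨ cong (λ x → ι p * (ι Πm * e) - x) (ℚ.*-identityˡ (ι Πm * e)) ⟨
  ι p * (ι Πm * e) - 1ℚ * (ι Πm * e) ≡⟨ cong (λ x → ι p * (ι Πm * e) - x * (ι Πm * e)) (ι-recip p {{p≢0}}) ⟨
  ι p * (ι Πm * e) - (ι p * recip p) * (ι Πm * e) ≡⟨ lem (ι p) (ι Πm) e (recip p) ⟩
  ι p * ι Πm * ((1ℚ - recip p) * e) ≡⟨ cong (_* ((1ℚ - recip p) * e)) (trans (sym (ι-* p Πm)) (cong ι (sym (ℕ.*-assoc p (product ps) m)))) ⟩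
  ι n * ((1ℚ - recip p) * e) ∎
  where
  open ≡-Reasoning
  p≢0 : NonZero p
  p≢0 = Pr.prime⇒nonZero pr
  n = p · product ps · m
  Πm = product ps · m
  e = euler ps
  lem : ∀ p x e r → p * (x * e) - (p * r) * (x * e) ≡ p * x * ((1ℚ - r) * e)
  lem = solve-∀ ℚ-ring
  n≡₁ : n ≡ product ps · (p · m)
  n≡₁ = trans (cong (_· m) (ℕ.*-comm p (product ps))) (ℕ.*-assoc (product ps) p m)
  n≡₂ : n ≡ p · Πm
  n≡₂ = ℕ.*-assoc p (product ps) m
  all : ∑ n (coprimeTo ps) ≡ ι p * (ι Πm * e)
  all = trans (cong (λ k → ∑ k (coprimeTo ps)) n≡₁) (trans (∑-coprimeTo prs desc (p · m))
    (trans (cong (λ k → ι k * e) (trans (sym n≡₁) n≡₂)) (trans (cong (_* e) (ι-* p Πm)) (ℚ.*-assoc (ι p) (ι Πm) e))))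
  multiples : ∑ n (λ i → χ p i * coprimeTo ps i) ≡ ι Πm * e
  multiples = trans (cong (λ k → ∑ k (λ i → χ p i * coprimeTo ps i)) n≡₂)
    (trans (∑-multiples-exact p {{p≢0}} Πm (coprimeTo ps))
    (trans (∑-cong Πm (λ i _ → coprimeTo-* pr prs p> i)) (∑-coprimeTo prs desc m)))

∑-coprimeTo-∣ : ∀ {ps q} → All Prime ps → Descending ps → All (_∣ q) ps → ∑ q (coprimeTo ps) ≡ ι q * euler ps
∑-coprimeTo-∣ {ps} {q} prs desc ps∣q with product-∣ prs desc ps∣q
... | divides m q≡ = subst (λ k → ∑ k (coprimeTo ps) ≡ ι k * euler ps) (sym (trans q≡ (ℕ.*-comm m (product ps)))) (∑-coprimeTo prs desc m)

-- Stated for any set of prime divisors, since it is applied to those divisors of q that occur among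
-- the sieving primes.
φ≤ : ∀ {ps q} → All Prime ps → Descending ps → All (_∣ q) ps → ι (φ q) ≤ ι q * euler ps
φ≤ {ps} {q} prs desc ps∣q = subst₂ _≤_ (sym (φ≡∑ q)) (∑-coprimeTo-∣ prs desc ps∣q) (∑-mono q (λ k _ → bound k (coprime? k q)))
  where
  bound : ∀ k (d : Dec (Coprime k q)) → 𝟙 d ≤ coprimeTo ps k
  bound k (no _)    = proj₁ (coprimeTo-unit ps k)
  bound k (yes cop) = ℚ.≤-reflexive (sym (coprimeTo≡1 (go prs ps∣q)))
    where
    go : ∀ {ps} → All Prime ps → All (_∣ q) ps → All (λ p → ¬ p ∣ k) ps
    go [] [] = []
    go (pr ∷ prs) (p∣q ∷ ps∣q) = (λ p∣k → prime≢1 pr (cop (p∣k , p∣q))) ∷ go prs ps∣q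

primeDivisors : ℕ → List ℕ
primeDivisors q = filter (_∣? q) (primesIn 0 (suc q))

filter-descending : ∀ {ℓ} {P : Pred ℕ ℓ} (P? : Decidable P) {ps} → Descending ps → Descending (filter P? ps)
filter-descending P? [] = []
filter-descending P? {p ∷ _} (p> ∷ desc) with P? p
... | yes _ = All.filter⁺ P? p> ∷ filter-descending P? desc
... | no  _ = filter-descending P? desc

φ≥ : ∀ q .{{_ : NonZero q}} → ι q * euler (primeDivisors q) ≤ ι (φ q)
φ≥ q = subst₂ _≤_ (∑-coprimeTo-∣ (All.filter⁺ (_∣? q) (primesIn-prime 0 (suc q)))
    (filter-descending (_∣? q) (primesIn-descending 0 (suc q))) (All.all-filter (_∣? q) (primesIn 0 (suc q))))
  (sym (φ≡∑ q)) (∑-mono q (λ k _ → bound k (coprime? k q)))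
  where
  bound : ∀ k (d : Dec (Coprime k q)) → coprimeTo (primeDivisors q) k ≤ 𝟙 d
  bound k (yes _)   = proj₂ (coprimeTo-unit (primeDivisors q) k)
  bound k (no ¬cop) with prime-divisor g 2≤g
    where
    g = GCD.gcd k q
    g≢0 : ¬ g ≡ 0
    g≢0 g≡0 = ℕ.≢-nonZero⁻¹ q (GCD.gcd[m,n]≡0⇒n≡0 k {q} g≡0)
    2≤g : 2 ℕ.≤ g
    2≤g = ℕ.≤∧≢⇒< (ℕ.n≢0⇒n>0 g≢0) (λ 1≡g → ¬cop (Cop.gcd≡1⇒coprime (sym 1≡g)))
  ... | p , pr , p∣g = ℚ.≤-reflexive (coprimeTo≡0 {primeDivisors q}
    (∈.∈-filter⁺ (_∣? q) (∈-primesIn pr z≤n (s≤s (∣.∣⇒≤ p∣q))) p∣q) (∣.∣-trans p∣g (GCD.gcd[m,n]∣m k q)))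
    where
    p∣q = ∣.∣-trans p∣g (GCD.gcd[m,n]∣n k q)

opaque
  unfolding ι recip

  euler-2 : 2ℚ * (euler (2 ∷ []) * euler (2 ∷ []) * ι 2) ≡ 1ℚ
  euler-2 = refl

  ι-3 : ι 3 ≡ 1ℚ + 1ℚ + 1ℚ
  ι-3 = refl

-- The exceptional factor 2 is due to the prime 2.
1≤2·euler²·product : ∀ {ps} → All Prime ps → Descending ps → 1ℚ ≤ 2ℚ * (euler ps * euler ps * ι (product ps))
1≤2·euler²·product [] [] = ≤-by (trans (cong (λ x → 2ℚ * (1ℚ * 1ℚ * x)) ι-1) refl) 0≤1
1≤2·euler²·product {p ∷ ps} (pr ∷ prs) (p> ∷ desc) with p ℕ.≟ 2
-- In a descending list of primes nothing can follow 2, so a single factor 2 · (1/2)² · 2 = 1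
-- remains.
... | yes refl with ps | p> | prs
...   | [] | [] | [] = ℚ.≤-reflexive (sym euler-2)
...   | p′ ∷ _ | p′<2 ∷ _ | pr′ ∷ _ = contradiction (2≤prime pr′) (ℕ.<⇒≱ p′<2)
1≤2·euler²·product {p ∷ ps} (pr ∷ prs) (p> ∷ desc) | no p≢2 = begin
  1ℚ ≤⟨ 1≤2·euler²·product prs desc ⟩
  2ℚ * (e * e * ι (product ps)) ≡⟨ ℚ.*-identityˡ (2ℚ * (e * e * ι (product ps))) ⟨
  1ℚ * (2ℚ * (e * e * ι (product ps))) ≤⟨ *-monoˡ (0≤* 0≤2 (0≤* (0≤* 0≤e 0≤e) (0≤ι (product ps)))) factor ⟩
  ((1ℚ - r) * (1ℚ - r) * ι p) * (2ℚ * (e * e * ι (product ps))) ≡⟨ lem r (ι p) e (ι (product ps)) ⟩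
  2ℚ * ((1ℚ - r) * e * ((1ℚ - r) * e) * (ι p * ι (product ps))) ≡⟨ cong (λ x → 2ℚ * ((1ℚ - r) * e * ((1ℚ - r) * e) * x)) (ι-* p (product ps)) ⟨
  2ℚ * ((1ℚ - r) * e * ((1ℚ - r) * e) * ι (p · product ps)) ∎
  where
  open ℚ.≤-Reasoning
  r = recip p
  e = euler ps
  0≤e = proj₁ (euler-unit prs)
  3≤p : 3 ℕ.≤ p
  3≤p = ℕ.≤∧≢⇒< (2≤prime pr) (p≢2 ∘ sym)
  -- (1 - 1/p)² p = p - 2 + 1/p, which is at least 1 + 1/p once p ≥ 3.
  factor : 1ℚ ≤ (1ℚ - r) * (1ℚ - r) * ι p
  factor = begin
    1ℚ ≤⟨ ≤-by refl (0≤recip p) ⟩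
    1ℚ + r ≡⟨ lem₃ r ⟩
    1ℚ + 1ℚ + 1ℚ - 1ℚ - 1ℚ + r ≤⟨ ℚ.+-monoˡ-≤ r (ℚ.+-monoˡ-≤ (- 1ℚ) (ℚ.+-monoˡ-≤ (- 1ℚ) (ℚ.≤-trans (ℚ.≤-reflexive (sym ι-3)) (ι-mono-≤ 3≤p)))) ⟩
    ι p - 1ℚ - 1ℚ + r ≡⟨ lem₁ (ι p) r ⟩
    ι p - 1ℚ - 1ℚ + 1ℚ * r ≡⟨ cong (λ x → ι p - x - x + x * r) (ι-recip p {{Pr.prime⇒nonZero pr}}) ⟨
    ι p - ι p * r - ι p * r + ι p * r * r ≡⟨ lem₂ (ι p) r ⟩
    (1ℚ - r) * (1ℚ - r) * ι p ∎
    where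
    lem₁ : ∀ p r → p - 1ℚ - 1ℚ + r ≡ p - 1ℚ - 1ℚ + 1ℚ * r
    lem₁ = solve-∀ ℚ-ring
    lem₂ : ∀ p r → p - p * r - p * r + p * r * r ≡ (1ℚ - r) * (1ℚ - r) * p
    lem₂ = solve-∀ ℚ-ring
    lem₃ : ∀ r → 1ℚ + r ≡ 1ℚ + 1ℚ + 1ℚ - 1ℚ - 1ℚ + r
    lem₃ = solve-∀ ℚ-ring
  lem : ∀ r p e x → ((1ℚ - r) * (1ℚ - r) * p) * (2ℚ * (e * e * x)) ≡ 2ℚ * ((1ℚ - r) * e * ((1ℚ - r) * e) * (p * x))
  lem = solve-∀ ℚ-ring

-- With e the Euler product over the primes dividing q and P the product of these primes, 2φ(q)² ≥
-- 2e²q²; and 2e²q ≥ 2e²P ≥ 1 because P divides q.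
q≤2φ² : ∀ q .{{_ : NonZero q}} → q ℕ.≤ 2 · (φ q · φ q)
q≤2φ² q = ι-cancel-≤ (begin
  ι q ≡⟨ ℚ.*-identityʳ (ι q) ⟨
  ι q * 1ℚ ≤⟨ *-monoʳ (0≤ι q) (1≤2·euler²·product prs desc) ⟩
  ι q * (2ℚ * (e * e * ι (product ps))) ≤⟨ *-monoʳ (0≤ι q) (*-monoʳ 0≤2 (*-monoʳ (0≤* 0≤e 0≤e) (ι-mono-≤ (∣.∣⇒≤ (product-∣ prs desc (All.all-filter (_∣? q) (primesIn 0 (suc q)))))))) ⟩
  ι q * (2ℚ * (e * e * ι q)) ≡⟨ lem (ι q) e ⟩
  2ℚ * ((ι q * e) * (ι q * e)) ≤⟨ *-monoʳ 0≤2 (*-mono-≤ (0≤* (0≤ι q) 0≤e) (φ≥ q) (0≤* (0≤ι q) 0≤e) (φ≥ q)) ⟩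
  2ℚ * (ι (φ q) * ι (φ q)) ≡⟨ cong₂ _*_ (sym ι-2) (sym (ι-* (φ q) (φ q))) ⟩
  ι 2 * ι (φ q · φ q) ≡⟨ ι-* 2 (φ q · φ q) ⟨
  ι (2 · (φ q · φ q)) ∎)
  where
  open ℚ.≤-Reasoning
  ps = primeDivisors q
  prs = All.filter⁺ (_∣? q) (primesIn-prime 0 (suc q))
  desc = filter-descending (_∣? q) (primesIn-descending 0 (suc q))
  e = euler ps
  0≤e = proj₁ (euler-unit prs)
  lem : ∀ q e → q * (2ℚ * (e * e * q)) ≡ 2ℚ * ((q * e) * (q * e))
  lem = solve-∀ ℚ-ring

-- The singular series on average

-- 1 + 1/(p - 1) is the inverse of 1 - 1/p, so `weights ps m` is m/φ(m) restricted to the primes in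
-- `ps`.
weight : ℕ → ℕ → ℚ
weight p m = 1ℚ + χ p m * recip (ℕ.pred p)

weights : List ℕ → ℕ → ℚ
weights []       m = 1ℚ
weights (p ∷ ps) m = weight p m * weights ps m

1≤weight : ∀ p m → 1ℚ ≤ weight p m
1≤weight p m = ≤-by refl (0≤* (0≤𝟙 (p ∣? m)) (0≤recip (ℕ.pred p)))

0≤weight : ∀ p m → 0ℚ ≤ weight p m
0≤weight p m = ℚ.≤-trans 0≤1 (1≤weight p m)

0≤weights : ∀ ps m → 0ℚ ≤ weights ps m
0≤weights []       m = 0≤1
0≤weights (p ∷ ps) m = 0≤* (0≤weight p m) (0≤weights ps m)

recip-pred : ∀ {p} → 2 ℕ.≤ p → recip (ℕ.pred p) ≡ recip p + recip p * recip (ℕ.pred p)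
recip-pred {suc p@(suc _)} (s≤s (s≤s _)) = begin
  r ≡⟨ ℚ.*-identityʳ r ⟨
  r * 1ℚ ≡⟨ cong (r *_) (ι-recip (suc p)) ⟨
  r * (ι (suc p) * s) ≡⟨ cong (λ x → r * (x * s)) (ι-suc p) ⟩
  r * ((1ℚ + ι p) * s) ≡⟨ lem r (ι p) s ⟩
  (ι p * r) * s + s * r ≡⟨ cong (λ x → x * s + s * r) (ι-recip p) ⟩
  1ℚ * s + s * r ≡⟨ cong (_+ s * r) (ℚ.*-identityˡ s) ⟩
  s + s * r ∎
  where
  open ≡-Reasoning
  r = recip p
  s = recip (suc p)
  lem : ∀ r p s → r * ((1ℚ + p) * s) ≡ (p * r) * s + s * r
  lem = solve-∀ ℚ-ring

euler*weight : ∀ {p m} → 2 ℕ.≤ p → p ∣ m → (1ℚ - recip p) * weight p m ≡ 1ℚ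
euler*weight {p} {m} 2≤p p∣m = begin
  (1ℚ - r) * (1ℚ + χ p m * s) ≡⟨ cong (λ x → (1ℚ - r) * (1ℚ + x * s)) (𝟙-yes (p ∣? m) p∣m) ⟩
  (1ℚ - r) * (1ℚ + 1ℚ * s) ≡⟨ lem r s ⟩
  1ℚ + (s - (r + r * s)) ≡⟨ cong (λ x → 1ℚ + (x - (r + r * s))) (recip-pred 2≤p) ⟩
  1ℚ + (r + r * s - (r + r * s)) ≡⟨ lem′ (r + r * s) ⟩
  1ℚ ∎
  where
  open ≡-Reasoning
  r = recip p
  s = recip (ℕ.pred p)
  lem : ∀ r s → (1ℚ - r) * (1ℚ + 1ℚ * s) ≡ 1ℚ + (s - (r + r * s))
  lem = solve-∀ ℚ-ring
  lem′ : ∀ x → 1ℚ + (x - x) ≡ 1ℚ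
  lem′ = solve-∀ ℚ-ring

-- If p divides neither k nor q, then 1 - 2/p ≤ (1 - 1/p)². Otherwise only one class is removed, and
-- the weight of whichever of k and q is divisible by p cancels one factor 1 - 1/p. The bound
-- separates k from q, so that k can be averaged.
1-density≤ : ∀ {p} → Prime p → ∀ q k →
  1ℚ - density (k · q) p ≤ (1ℚ - recip p) * (1ℚ - recip p) * (weight p q * weight p k)
1-density≤ {p} pr q k with p ∣? (k · q)
... | no _ = begin
  1ℚ - (r + 1ℚ * r) ≤⟨ ≤-by (lem r) (0≤* 0≤r 0≤r) ⟩
  (1ℚ - r) * (1ℚ - r) * (1ℚ * 1ℚ) ≤⟨ *-monoʳ (0≤* 0≤1-r 0≤1-r) (*-mono-≤ 0≤1 (1≤weight p q) 0≤1 (1≤weight p k)) ⟩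
  (1ℚ - r) * (1ℚ - r) * (weight p q * weight p k) ∎
  where
  open ℚ.≤-Reasoning
  r = recip p
  0≤r = 0≤recip p
  0≤1-r = 0≤b-a (proj₂ (prime-recip-unit pr))
  lem : ∀ r → (1ℚ - r) * (1ℚ - r) * (1ℚ * 1ℚ) ≡ 1ℚ - (r + 1ℚ * r) + r * r
  lem = solve-∀ ℚ-ring
... | yes p∣kq = begin
  1ℚ - (r + 0ℚ * r) ≡⟨ lem r ⟩
  (1ℚ - r) * 1ℚ ≤⟨ *-monoʳ (0≤b-a (proj₂ (prime-recip-unit pr))) (one (Pr.euclidsLemma k q pr p∣kq)) ⟩
  (1ℚ - r) * ((1ℚ - r) * (x * y)) ≡⟨ ℚ.*-assoc (1ℚ - r) (1ℚ - r) (x * y) ⟨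
  (1ℚ - r) * (1ℚ - r) * (x * y) ∎
  where
  open ℚ.≤-Reasoning
  r = recip p
  x = weight p q
  y = weight p k
  lem : ∀ r → 1ℚ - (r + 0ℚ * r) ≡ (1ℚ - r) * 1ℚ
  lem = solve-∀ ℚ-ring
  swap : ∀ r x y → y * ((1ℚ - r) * x) ≡ (1ℚ - r) * (x * y)
  swap = solve-∀ ℚ-ring
  one : p ∣ k ⊎ p ∣ q → 1ℚ ≤ (1ℚ - r) * (x * y)
  one (inj₁ p∣k) = subst (1ℚ ≤_) (trans (cong (x *_) (sym (euler*weight (2≤prime pr) p∣k))) (trans (swap r y x) (cong ((1ℚ - r) *_) (ℚ.*-comm y x))))
    (subst (1ℚ ≤_) (sym (ℚ.*-identityʳ x)) (1≤weight p q))
  one (inj₂ p∣q) = subst (1ℚ ≤_) (trans (cong (y *_) (sym (euler*weight (2≤prime pr) p∣q))) (swap r x y))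
    (subst (1ℚ ≤_) (sym (ℚ.*-identityʳ y)) (1≤weight p k))

∏-density≤ : ∀ {ps} → All Prime ps → ∀ q k →
  ∏[1- map (density (k · q)) ps ] ≤ euler ps * euler ps * (weights ps q * weights ps k)
∏-density≤ [] q k = ℚ.≤-refl
∏-density≤ {p ∷ ps} (pr ∷ prs) q k = ℚ.≤-trans
  (*-mono-≤ (0≤b-a (proj₂ (density-unit (k · q) pr))) (1-density≤ pr q k)
    (proj₁ (∏-unit (All.map⁺ (All.map (λ pr → density-unit (k · q) pr) prs)))) (∏-density≤ prs q k))
  (ℚ.≤-reflexive (lem (recip p) (weight p q) (weight p k) (euler ps) (weights ps q) (weights ps k)))
  where
  lem : ∀ r x y e X Y → (1ℚ - r) * (1ℚ - r) * (x * y) * (e * e * (X * Y)) ≡ (1ℚ - r) * e * ((1ℚ - r) * e) * (x * X * (y * Y))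
  lem = solve-∀ ℚ-ring

euler-filter*weights : ∀ {ps} → All Prime ps → ∀ q → euler (filter (_∣? q) ps) * weights ps q ≡ 1ℚ
euler-filter*weights [] q = refl
euler-filter*weights {p ∷ ps} (pr ∷ prs) q = step (p ∣? q)
  where
  e = euler (filter (_∣? q) ps)
  W = weights ps q
  lem : ∀ r e w W → (1ℚ - r) * e * (w * W) ≡ ((1ℚ - r) * w) * (e * W)
  lem = solve-∀ ℚ-ring
  lem′ : ∀ e s W → e * ((1ℚ + 0ℚ * s) * W) ≡ e * W
  lem′ = solve-∀ ℚ-ring
  step : Dec (p ∣ q) → euler (filter (_∣? q) (p ∷ ps)) * (weight p q * W) ≡ 1ℚ
  step (yes p∣q) = trans (cong (λ xs → euler xs * (weight p q * W)) (List.filter-accept (_∣? q) p∣q))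
    (trans (lem (recip p) e (weight p q) W) (cong₂ _*_ (euler*weight (2≤prime pr) p∣q) (euler-filter*weights prs q)))
  step (no p∤q) = trans (cong₂ (λ xs x → euler xs * ((1ℚ + x * recip (ℕ.pred p)) * W)) (List.filter-reject (_∣? q) p∤q) (𝟙-no (p ∣? q) p∤q))
    (trans (lem′ e (recip (ℕ.pred p)) W) (euler-filter*weights prs q))

-- The weights of q invert the Euler product over the primes in `ps` dividing q, so this is the
-- upper bound for φ(q) rearranged.
φ*weights≤ : ∀ {ps} → All Prime ps → Descending ps → ∀ q → ι (φ q) * weights ps q ≤ ι q
φ*weights≤ {ps} prs desc q = begin
  ι (φ q) * weights ps q ≤⟨ *-monoˡ (0≤weights ps q) (φ≤ (All.filter⁺ (_∣? q) prs) (filter-descending (_∣? q) desc) (All.all-filter (_∣? q) ps)) ⟩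
  ι q * euler (filter (_∣? q) ps) * weights ps q ≡⟨ ℚ.*-assoc (ι q) (euler (filter (_∣? q) ps)) (weights ps q) ⟩
  ι q * (euler (filter (_∣? q) ps) * weights ps q) ≡⟨ cong (ι q *_) (euler-filter*weights prs q) ⟩
  ι q * 1ℚ ≡⟨ ℚ.*-identityʳ (ι q) ⟩
  ι q ∎
  where open ℚ.≤-Reasoning

∏[1+_] : List ℚ → ℚ
∏[1+ [] ]     = 1ℚ
∏[1+ x ∷ xs ] = (1ℚ + x) * ∏[1+ xs ]

0≤∏[1+] : ∀ {xs} → All (0ℚ ≤_) xs → 0ℚ ≤ ∏[1+ xs ]
0≤∏[1+] []           = 0≤1
0≤∏[1+] (0≤x ∷ 0≤xs) = 0≤* (0≤+ 0≤1 0≤x) (0≤∏[1+] 0≤xs)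

∏[1+]*[1-Σ]≤1 : ∀ {xs} → All (0ℚ ≤_) xs → ∏[1+ xs ] * (1ℚ - Σℚ xs) ≤ 1ℚ
∏[1+]*[1-Σ]≤1 [] = ℚ.≤-refl
∏[1+]*[1-Σ]≤1 {x ∷ xs} (0≤x ∷ 0≤xs) = ℚ.≤-trans
  (≤-by (lem x ∏[1+ xs ] (Σℚ xs)) (0≤* (0≤∏[1+] 0≤xs) (0≤* 0≤x (0≤+ 0≤x (Σ-nonneg 0≤xs)))))
  (∏[1+]*[1-Σ]≤1 0≤xs)
  where
  lem : ∀ x P s → P * (1ℚ - s) ≡ (1ℚ + x) * P * (1ℚ - (x + s)) + P * (x * (x + s))
  lem = solve-∀ ℚ-ring

-- The amount by which the mean of `weight p` over all integers exceeds 1.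
secondOrder : ℕ → ℚ
secondOrder p = recip p * recip (ℕ.pred p)

0≤secondOrder : ∀ p → 0ℚ ≤ secondOrder p
0≤secondOrder p = 0≤* (0≤recip p) (0≤recip (ℕ.pred p))

-- Telescopes 1/(b(b - 1)) = 1/(b - 1) - 1/b over all b, prime or not.
Σ-secondOrder : ∀ a n → Σℚ (map secondOrder (primesIn (suc (suc a)) (suc (suc a) ℕ.+ n))) + recip (suc a ℕ.+ n) ≤ recip (suc a)
Σ-secondOrder a zero = ℚ.≤-reflexive (trans
  (cong₂ (λ ps k → Σℚ (map secondOrder ps) + recip (suc k)) (primesIn-empty (suc (suc a) ℕ.+ 0) (ℕ.≤-reflexive (ℕ.+-identityʳ (suc (suc a))))) (ℕ.+-identityʳ a))
  (ℚ.+-identityˡ (recip (suc a))))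
Σ-secondOrder a (suc n) = ℚ.≤-trans (subst (λ k → Σs (suc (suc k)) + recip (suc k) ≤ Σs b + recip (suc (a ℕ.+ n))) (sym (ℕ.+-suc a n)) step) (Σ-secondOrder a n)
  where
  b = suc (suc a) ℕ.+ n
  Σs : ℕ → ℚ
  Σs c = Σℚ (map secondOrder (primesIn (suc (suc a)) c))
  telescope : recip (suc (a ℕ.+ n)) ≡ recip b + recip b * recip (suc (a ℕ.+ n))
  telescope = recip-pred {b} (s≤s (s≤s z≤n))
  step : Σs (suc b) + recip b ≤ Σs b + recip (suc (a ℕ.+ n))
  step with suc (suc a) ℕ.≤? b ×-dec prime? b
  ... | yes _ = ℚ.≤-reflexive (trans (lem (secondOrder b) (Σs b) (recip b)) (cong (Σs b +_) (sym telescope)))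
    where
    lem : ∀ x s r → x + s + r ≡ s + (r + x)
    lem = solve-∀ ℚ-ring
  ... | no _ = ℚ.+-monoʳ-≤ (Σs b) (≤-by telescope (0≤* (0≤recip b) (0≤recip (suc (a ℕ.+ n)))))

-- From ∏(1 + x) · (1 - Σx) ≤ 1 and Σx ≤ 1/2, the latter because the sieving primes are at least 2^H
-- ≥ 3.
∏-secondOrder≤2 : ∀ r → ∏[1+ map secondOrder (sievingPrimes r) ] ≤ 2ℚ
∏-secondOrder≤2 r with 2^H≡3+a | ℕ.m≤n⇒∃[o]m+o≡n (2^mono (ℕ.m≤m*n H (2 ^ r) {{2^≢0 r}}))
... | a , 2^H≡ | n , 2^H+n≡ = ≤-by (lem P S (recip 2)) (0≤+ (0≤+ (0≤b-a PS≤1) (0≤b-a PS≤1))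
    (0≤* 0≤P (0≤+ (0≤+ (0≤b-a S≤½) (0≤b-a S≤½)) (0≤b-a (2·recip≤1 {2} ℕ.≤-refl)))))
  where
  xs = map secondOrder (sievingPrimes r)
  P = ∏[1+ xs ]
  S = Σℚ xs
  0≤xs : All (0ℚ ≤_) xs
  0≤xs = All.map⁺ (All.universal 0≤secondOrder (sievingPrimes r))
  0≤P = 0≤∏[1+] 0≤xs
  PS≤1 = ∏[1+]*[1-Σ]≤1 0≤xs
  S≤½ : S ≤ recip 2
  S≤½ = subst₂ (λ c d → Σℚ (map secondOrder (primesIn c d)) ≤ recip 2) (sym 2^H≡) (trans (cong (ℕ._+ n) (sym 2^H≡)) 2^H+n≡)
    (ℚ.≤-trans (≤-by refl (0≤recip (suc (suc a) ℕ.+ n))) (ℚ.≤-trans (Σ-secondOrder (suc a) n) (recip-≤ {2} (s≤s (s≤s z≤n)))))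
  lem : ∀ P S h → 1ℚ + 1ℚ ≡ P + (((1ℚ - P * (1ℚ - S)) + (1ℚ - P * (1ℚ - S))) + P * (((h - S) + (h - S)) + (1ℚ - (h + h))))
  lem = solve-∀ ℚ-ring

-- Selects the shifts k ≥ 1 in sums that start at 0. The index 0 is divisible by every prime and
-- would spoil the average of the weights.
positive : ℕ → ℚ
positive zero    = 0ℚ
positive (suc _) = 1ℚ

0≤positive : ∀ k → 0ℚ ≤ positive k
0≤positive zero    = ℚ.≤-refl
0≤positive (suc _) = 0≤1

weights-* : ∀ {p ps} → Prime p → All Prime ps → All (ℕ._< p) ps → ∀ i → weights ps (p · i) ≡ weights ps i
weights-* pr [] [] i = refl
weights-* {p} {p′ ∷ ps} pr (pr′ ∷ prs) (p′<p ∷ ps<p) i =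
  cong₂ (λ x y → (1ℚ + x * recip (ℕ.pred p′)) * y) (𝟙-cong (p′ ∣? (p · i)) (p′ ∣? i) (prime-∣-* i pr pr′ p′<p) (∣.∣n⇒∣m*n p)) (weights-* pr prs ps<p i)

positive-* : ∀ p .{{_ : NonZero p}} i → positive (p · i) ≡ positive i
positive-* p zero          = cong positive (ℕ.*-zeroʳ p)
positive-* (suc p) (suc i) = refl

-- Splitting `weight p k` into 1 and a part supported on multiples of p, the second part is again a
-- sum of weights over `ps`, of length M ≤ K/p. Rounding goes the right way, so no error term
-- arises.
∑-weights : ∀ {ps} → All Prime ps → Descending ps → ∀ K →
  ∑ (suc K) (λ k → positive k * weights ps k) ≤ ι K * ∏[1+ map secondOrder ps ]
∑-weights [] [] K = go K
  where
  go : ∀ K → ∑ (suc K) (λ k → positive k * 1ℚ) ≤ ι K * 1ℚ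
  go zero    = ℚ.≤-reflexive (sym (trans (ℚ.*-identityʳ (ι 0)) ι-0))
  go (suc K) = ℚ.≤-trans (ℚ.+-monoˡ-≤ (1ℚ * 1ℚ) (go K)) (ℚ.≤-reflexive (trans (lem (ι K)) (cong (_* 1ℚ) (sym (ι-suc K)))))
    where
    lem : ∀ k → k * 1ℚ + 1ℚ * 1ℚ ≡ (1ℚ + k) * 1ℚ
    lem = solve-∀ ℚ-ring
∑-weights {p ∷ ps} (pr ∷ prs) (p> ∷ desc) K with ∑-multiples p {{Pr.prime⇒nonZero pr}} (suc K)
... | zero , K<p0 , _ , _ = contradiction (subst (suc K ℕ.≤_) (ℕ.*-zeroʳ p) K<p0) λ ()
... | suc M , _ , pM<K+p , sums = begin
  ∑ (suc K) (λ k → positive k * (weight p k * weights ps k)) ≡⟨ ∑-cong (suc K) (λ k _ → lem₁ (positive k) (χ p k) s (weights ps k)) ⟩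
  ∑ (suc K) (λ k → g k + s * (χ p k * g k)) ≡⟨ ∑-+ (suc K) g (λ k → s * (χ p k * g k)) ⟩
  ∑ (suc K) g + ∑ (suc K) (λ k → s * (χ p k * g k)) ≡⟨ cong (∑ (suc K) g +_) (∑-*ˡ (suc K) s (λ k → χ p k * g k)) ⟩
  ∑ (suc K) g + s * ∑ (suc K) (λ k → χ p k * g k) ≡⟨ cong (λ x → ∑ (suc K) g + s * x) (trans (sums g) (∑-cong (suc M) (λ i _ → cong₂ _*_ (positive-* p i) (weights-* pr prs p> i)))) ⟩
  ∑ (suc K) g + s * ∑ (suc M) g ≤⟨ ℚ.+-mono-≤ (∑-weights prs desc K) (*-monoʳ (0≤recip (ℕ.pred p)) (∑-weights prs desc M)) ⟩
  ι K * P + s * (ι M * P) ≤⟨ ℚ.+-monoʳ-≤ (ι K * P) (*-monoʳ (0≤recip (ℕ.pred p)) (*-monoˡ 0≤P M≤rK)) ⟩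
  ι K * P + s * (r * ι K * P) ≡⟨ lem₂ (ι K) P s r ⟩
  ι K * ((1ℚ + r * s) * P) ∎
  where
  open ℚ.≤-Reasoning
  instance
    p≢0 : NonZero p
    p≢0 = Pr.prime⇒nonZero pr
  s = recip (ℕ.pred p)
  r = recip p
  P = ∏[1+ map secondOrder ps ]
  0≤P : 0ℚ ≤ P
  0≤P = 0≤∏[1+] (All.map⁺ (All.universal 0≤secondOrder ps))
  g : ℕ → ℚ
  g k = positive k * weights ps k
  pM≤K : p · M ℕ.≤ K
  pM≤K = ℕ.+-cancelʳ-≤ p (p · M) K (ℕ.≤-pred (subst (ℕ._< suc K ℕ.+ p) (trans (ℕ.*-suc p M) (ℕ.+-comm p (p · M))) pM<K+p))
  M≤rK : ι M ≤ r * ι K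
  M≤rK = *-cancel-≤ (0<ι p) (subst₂ _≤_ (ι-* p M) (trans (sym (ℚ.*-identityˡ (ι K))) (trans (cong (_* ι K) (sym (ι-recip p))) (ℚ.*-assoc (ι p) r (ι K)))) (ι-mono-≤ pM≤K))
  lem₁ : ∀ n x s w → n * ((1ℚ + x * s) * w) ≡ n * w + s * (x * (n * w))
  lem₁ = solve-∀ ℚ-ring
  lem₂ : ∀ k P s r → k * P + s * (r * k * P) ≡ k * ((1ℚ + r * s) * P)
  lem₂ = solve-∀ ℚ-ring

-- The factor φ(q) on the left pays for the weights of q, for which no constant bound is available;
-- those of k are bounded on average.
singularSeries-average : ∀ r q K →
  ι (φ q) * ∑ (suc K) (λ k → positive k * ∏[1- map (density (k · q)) (sievingPrimes r) ])
    ≤ euler (sievingPrimes r) * euler (sievingPrimes r) * (ι q * (ι K * 2ℚ))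
singularSeries-average r q K = begin
  ι (φ q) * ∑ (suc K) (λ k → positive k * ∏[1- map (density (k · q)) ps ])
    ≤⟨ *-monoʳ (0≤ι (φ q)) (∑-mono (suc K) (λ k _ → ℚ.≤-trans (*-monoʳ (0≤positive k) (∏-density≤ prs q k)) (ℚ.≤-reflexive (lem₁ (positive k) e (weights ps q) (weights ps k))))) ⟩
  ι (φ q) * ∑ (suc K) (λ k → e * e * weights ps q * (positive k * weights ps k))
    ≡⟨ cong (ι (φ q) *_) (∑-*ˡ (suc K) (e * e * weights ps q) (λ k → positive k * weights ps k)) ⟩
  ι (φ q) * (e * e * weights ps q * S)
    ≡⟨ lem₂ (ι (φ q)) e (weights ps q) S ⟩
  e * e * (ι (φ q) * weights ps q * S)
    ≤⟨ *-monoʳ (0≤* 0≤e 0≤e) (*-mono-≤ (0≤* (0≤ι (φ q)) (0≤weights ps q)) (φ*weights≤ prs desc q)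
         (∑-nonneg (suc K) (λ k → 0≤* (0≤positive k) (0≤weights ps k)))
         (ℚ.≤-trans (∑-weights prs desc K) (*-monoʳ (0≤ι K) (∏-secondOrder≤2 r)))) ⟩
  e * e * (ι q * (ι K * 2ℚ)) ∎
  where
  open ℚ.≤-Reasoning
  ps = sievingPrimes r
  prs = primesIn-prime (2 ^ H) (2 ^ (H · 2 ^ r))
  desc = primesIn-descending (2 ^ H) (2 ^ (H · 2 ^ r))
  e = euler ps
  0≤e = proj₁ (euler-unit prs)
  S = ∑ (suc K) (λ k → positive k * weights ps k)
  lem₁ : ∀ n e x y → n * (e * e * (x * y)) ≡ e * e * x * (n * y)
  lem₁ = solve-∀ ℚ-ring
  lem₂ : ∀ f e w S → f * (e * e * w * S) ≡ e * e * (f * w * S)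
  lem₂ = solve-∀ ℚ-ring

-- Counting primes

π : ℕ → ℕ
π n = length (primesIn 0 n)

log-floor : ∀ b → 2 ℕ.≤ b → ∀ n .{{_ : NonZero n}} → ∃[ e ] (b ^ e ℕ.≤ n × n ℕ.< b ^ suc e)
log-floor b 2≤b 1 = 0 , ℕ.≤-refl , subst (1 ℕ.<_) (sym (ℕ.*-identityʳ b)) 2≤b
log-floor b 2≤b (suc n@(suc _)) with log-floor b 2≤b n
... | e , l , u with suc n ℕ.<? b ^ suc e
...   | yes 1+n< = e , ℕ.m≤n⇒m≤1+n l , 1+n<
...   | no  1+n≮ = suc e , ℕ.≮⇒≥ 1+n≮ , ℕ.≤-<-trans u (ℕ.^-monoʳ-< b 2≤b (ℕ.n<1+n (suc e)))

length-primesIn-split : ∀ {a b c} → a ℕ.≤ b → b ℕ.≤ c →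
  length (primesIn a c) ≡ length (primesIn b c) ℕ.+ length (primesIn a b)
length-primesIn-split {a} {b} {c} a≤b b≤c = trans (cong length (sym (primesIn-++ a≤b b≤c))) (List.length-++ (primesIn b c))

π-mono : ∀ {m n} → m ℕ.≤ n → π m ℕ.≤ π n
π-mono {m} {n} m≤n = subst (π m ℕ.≤_) (sym (length-primesIn-split {0} {m} {n} z≤n m≤n)) (ℕ.m≤n+m (π m) (length (primesIn m n)))

-- The dyadic bounds form a geometric series, whose sum is at most twice its last term.
chebyshev-range : ∀ s n → 2 ℕ.≤ s → s · length (primesIn (2 ^ s) (2 ^ (s ℕ.+ n))) ℕ.≤ 2 ^ suc (s ℕ.+ n)
chebyshev-range s zero 2≤s = subst (ℕ._≤ 2 ^ suc (s ℕ.+ 0))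
  (sym (trans (cong (λ ps → s · length ps) (primesIn-empty (2 ^ (s ℕ.+ 0)) (ℕ.≤-reflexive (cong (2 ^_) (ℕ.+-identityʳ s))))) (ℕ.*-zeroʳ s))) z≤n
chebyshev-range s (suc n) 2≤s = begin
  s · length (primesIn (2 ^ s) (2 ^ (s ℕ.+ suc n))) ≡⟨ cong (λ k → s · length (primesIn (2 ^ s) (2 ^ k))) (ℕ.+-suc s n) ⟩
  s · length (primesIn (2 ^ s) (2 ^ suc m)) ≡⟨ cong (s ·_) (length-primesIn-split (2^mono (ℕ.m≤m+n s n)) (2^mono (ℕ.n≤1+n m))) ⟩
  s · (length (dyadicPrimes m) ℕ.+ length ps) ≡⟨ ℕ.*-distribˡ-+ s (length (dyadicPrimes m)) (length ps) ⟩
  s · length (dyadicPrimes m) ℕ.+ s · length ps ≤⟨ ℕ.+-mono-≤ (ℕ.≤-trans (ℕ.*-monoˡ-≤ (length (dyadicPrimes m)) (ℕ.m≤m+n s n)) (chebyshev-dyadic m (ℕ.≤-trans 2≤s (ℕ.m≤m+n s n)))) (chebyshev-range s n 2≤s) ⟩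
  2 ^ suc m ℕ.+ 2 ^ suc m ≡⟨ 2^suc (suc m) ⟨
  2 ^ suc (suc m) ≡⟨ cong (λ k → 2 ^ suc k) (ℕ.+-suc s n) ⟨
  2 ^ suc (s ℕ.+ suc n) ∎
  where
  open ℕ.≤-Reasoning
  m = s ℕ.+ n
  ps = primesIn (2 ^ s) (2 ^ m)

-- The free cut-off s stands in for log Y: primes below 2^s are counted trivially, the others by
-- dyadic estimates up to the power of 2 just above Y.
π-upper : ∀ s Y → 2 ℕ.≤ s → s · π Y ℕ.≤ s · 2 ^ s ℕ.+ 4 · Y
π-upper s Y 2≤s with Y ℕ.≤? 2 ^ s
... | yes Y≤ = ℕ.≤-trans (ℕ.*-monoʳ-≤ s (ℕ.≤-trans (length-primesIn 0 Y) Y≤)) (ℕ.m≤m+n (s · 2 ^ s) (4 · Y))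
... | no  Y≰ with log-floor 2 ℕ.≤-refl Y {{ℕ.>-nonZero (ℕ.≤-<-trans z≤n (ℕ.≰⇒> Y≰))}}
...   | e , l , u with ℕ.m≤n⇒∃[o]m+o≡n {s} {suc e} (2^-cancel-≤ (ℕ.≤-trans (ℕ.<⇒≤ (ℕ.≰⇒> Y≰)) (ℕ.<⇒≤ u)))
...     | n , s+n≡ = begin
  s · π Y ≤⟨ ℕ.*-monoʳ-≤ s (π-mono (ℕ.<⇒≤ u)) ⟩
  s · π (2 ^ suc e) ≡⟨ cong (λ k → s · π (2 ^ k)) s+n≡ ⟨
  s · π (2 ^ (s ℕ.+ n)) ≡⟨ cong (s ·_) (length-primesIn-split {0} {2 ^ s} {2 ^ (s ℕ.+ n)} z≤n (2^mono (ℕ.m≤m+n s n))) ⟩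
  s · (r ℕ.+ π (2 ^ s)) ≡⟨ ℕ.*-distribˡ-+ s r (π (2 ^ s)) ⟩
  s · r ℕ.+ s · π (2 ^ s) ≤⟨ ℕ.+-mono-≤ (chebyshev-range s n 2≤s) (ℕ.*-monoʳ-≤ s (length-primesIn 0 (2 ^ s))) ⟩
  2 ^ suc (s ℕ.+ n) ℕ.+ s · 2 ^ s ≡⟨ cong (λ k → 2 ^ suc k ℕ.+ s · 2 ^ s) s+n≡ ⟩
  2 ^ suc (suc e) ℕ.+ s · 2 ^ s ≡⟨ trans (ℕ.+-comm (2 ^ suc (suc e)) (s · 2 ^ s)) (cong (s · 2 ^ s ℕ.+_) (sym (ℕ.*-assoc 2 2 (2 ^ e)))) ⟩
  s · 2 ^ s ℕ.+ 4 · 2 ^ e ≤⟨ ℕ.+-monoʳ-≤ (s · 2 ^ s) (ℕ.*-monoʳ-≤ 4 l) ⟩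
  s · 2 ^ s ℕ.+ 4 · Y ∎
  where
  open ℕ.≤-Reasoning
  r = length (primesIn (2 ^ s) (2 ^ (s ℕ.+ n)))

-- M / (i+j+1)! · i! j! is M times the integral of x^i (1−x)^j over [0,1]; the induction on j expands (1−x)^(j+1).
beta-integral-∣ : ∀ {M N} → (∀ m → 1 ℕ.≤ m → m ℕ.≤ N → m ∣ M) →
  ∀ j i → suc (i ℕ.+ j) ℕ.≤ N → (suc (i ℕ.+ j)) ! ∣ M · (i ! · j !)
beta-integral-∣ {M} {N} common zero i i<N = subst₂ _∣_
  (cong (λ k → suc k !) (sym (ℕ.+-identityʳ i))) (cong (M ·_) (sym (ℕ.*-identityʳ (i !))))
  (∣.*-monoˡ-∣ (i !) (common (suc i) (s≤s z≤n) (subst (λ k → suc k ℕ.≤ N) (ℕ.+-identityʳ i) i<N)))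
beta-integral-∣ {M} {N} common (suc j) i i+j<N = subst (λ k → suc k ! ∣ M · (i ! · suc j !)) (sym (ℕ.+-suc i j))
  (∣.∣m+n∣m⇒∣n (subst (suc (suc (i ℕ.+ j)) ! ∣_) (lem M (i !) (j !) i j) first) second)
  where
  i+j<N′ : suc (suc (i ℕ.+ j)) ℕ.≤ N
  i+j<N′ = subst (λ k → suc k ℕ.≤ N) (ℕ.+-suc i j) i+j<N
  first : suc (suc (i ℕ.+ j)) ! ∣ suc (suc (i ℕ.+ j)) · (M · (i ! · j !))
  first = ∣.*-monoʳ-∣ (suc (suc (i ℕ.+ j))) (beta-integral-∣ common j i (ℕ.<⇒≤ i+j<N′))
  second : suc (suc (i ℕ.+ j)) ! ∣ M · (suc i ! · j !)
  second = beta-integral-∣ common j (suc i) i+j<N′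
  lem : ∀ M x y i j → suc (suc (i ℕ.+ j)) · (M · (x · y)) ≡ M · (suc i · x · y) ℕ.+ M · (x · (suc j · y))
  lem = solve-ℕ

4^*≤[2n+1]! : ∀ n → 4 ^ n · (n ! · n !) ℕ.≤ (suc (n ℕ.+ n)) !
4^*≤[2n+1]! zero = ℕ.≤-refl
4^*≤[2n+1]! (suc n) = begin
  4 · x · (suc n · y · (suc n · y)) ≡⟨ lem n x y ⟩
  suc (suc (n ℕ.+ n)) · (suc (suc (n ℕ.+ n)) · (x · (y · y))) ≤⟨ ℕ.*-mono-≤ (ℕ.n≤1+n (suc (suc (n ℕ.+ n)))) (ℕ.*-monoʳ-≤ (suc (suc (n ℕ.+ n))) (4^*≤[2n+1]! n)) ⟩
  suc (suc (suc (n ℕ.+ n))) ! ≡⟨ cong (λ k → suc k !) (ℕ.+-suc (suc n) n) ⟨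
  suc (suc n ℕ.+ suc n) ! ∎
  where
  open ℕ.≤-Reasoning
  x = 4 ^ n
  y = n !
  lem : ∀ n x y → 4 · x · (suc n · y · (suc n · y)) ≡ suc (suc (n ℕ.+ n)) · (suc (suc (n ℕ.+ n)) · (x · (y · y)))
  lem = solve-ℕ

-- Nair's argument: M times the integral of (x(1 - x))^n over [0,1] is a positive integer, hence at
-- least 1, while that integral n!²/(2n+1)! is at most 4^(-n).
common-multiple≥4^ : ∀ {M} n .{{_ : NonZero M}} → (∀ m → 1 ℕ.≤ m → m ℕ.≤ suc (n ℕ.+ n) → m ∣ M) → 4 ^ n ℕ.≤ M
common-multiple≥4^ {M} n {{M≢0}} common = ℕ.*-cancelʳ-≤ (4 ^ n) M (n ! · n !) {{D≢0}}
  (ℕ.≤-trans (4^*≤[2n+1]! n) (∣.∣⇒≤ {{ℕ.m*n≢0 M (n ! · n !) {{M≢0}} {{D≢0}}}} (beta-integral-∣ common n n ℕ.≤-refl)))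
  where
  D≢0 : NonZero (n ! · n !)
  D≢0 = ℕ.m*n≢0 (n !) (n !) {{n ℕ.!≢0}} {{n ℕ.!≢0}}

^-∣ : ∀ p {m n} → m ℕ.≤ n → p ^ m ∣ p ^ n
^-∣ p {m} {n} m≤n = subst (p ^ m ∣_) (trans (sym (ℕ.^-distribˡ-+-* p m (n ∸ m))) (cong (p ^_) (ℕ.m+[n∸m]≡n m≤n))) (∣.m∣m*n (p ^ (n ∸ m)))

remove-prime : ∀ {p} → Prime p → ∀ m → 1 ℕ.≤ m → ∃[ a ] ∃[ m′ ] (m ≡ p ^ a · m′ × ¬ p ∣ m′)
remove-prime {p} pr = <-rec (λ m → 1 ℕ.≤ m → ∃[ a ] ∃[ m′ ] (m ≡ p ^ a · m′ × ¬ p ∣ m′)) go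
  where
  go : ∀ m → (∀ {k} → k ℕ.< m → 1 ℕ.≤ k → ∃[ a ] ∃[ m′ ] (k ≡ p ^ a · m′ × ¬ p ∣ m′)) →
    1 ℕ.≤ m → ∃[ a ] ∃[ m′ ] (m ≡ p ^ a · m′ × ¬ p ∣ m′)
  go m rec 1≤m with p ∣? m
  ... | no p∤m = 0 , m , sym (ℕ.*-identityˡ m) , p∤m
  ... | yes (divides zero m≡0) = contradiction (subst (1 ℕ.≤_) m≡0 1≤m) λ ()
  ... | yes (divides k@(suc _) m≡kp) with rec (subst (k ℕ.<_) (sym m≡kp) (ℕ.m<m*n k p (2≤prime pr))) (s≤s z≤n)
  ...   | a , m′ , k≡ , p∤m′ = suc a , m′ , trans m≡kp (trans (cong (_· p) k≡) (lem (p ^ a) m′ p)) , p∤m′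
    where
    lem : ∀ x y p → x · y · p ≡ p · x · y
    lem = solve-ℕ

maxPower : ∀ N .{{_ : NonZero N}} → ∀ {p} → Prime p → ∃[ P ] (NonZero P × P ℕ.≤ N × (∀ a → p ^ a ℕ.≤ N → p ^ a ∣ P))
maxPower N {p} pr with log-floor p (2≤prime pr) N
... | e , l , u = p ^ e , ℕ.m^n≢0 p e {{Pr.prime⇒nonZero pr}} , l ,
  λ a p^a≤N → ^-∣ p {a} {e} (ℕ.≮⇒≥ (λ e<a → ℕ.<⇒≱ u (ℕ.≤-trans (ℕ.^-monoʳ-≤ p {{Pr.prime⇒nonZero pr}} e<a) p^a≤N)))

-- M is the product of the largest powers not exceeding N of the primes in `ps`. Confining m to
-- numbers composed of these primes permits induction on `ps`: once the power of p is stripped from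
-- m, the rest is composed of the tail.
smooth-common-multiple : ∀ N .{{_ : NonZero N}} {ps} → All Prime ps → ∃[ M ] (NonZero M × M ℕ.≤ N ^ length ps ×
  (∀ m → 1 ℕ.≤ m → m ℕ.≤ N → (∀ p → Prime p → p ∣ m → p ∈ ps) → m ∣ M))
smooth-common-multiple N [] = 1 , _ , ℕ.≤-refl , λ m 1≤m m≤N smooth → ∣.∣-reflexive (sym (m≡1 m 1≤m smooth))
  where
  m≡1 : ∀ m → 1 ℕ.≤ m → (∀ p → Prime p → p ∣ m → p ∈ []) → 1 ≡ m
  m≡1 m 1≤m smooth with 1 ℕ.≟ m
  ... | yes eq = eq
  ... | no  ne with prime-divisor m (ℕ.≤∧≢⇒< 1≤m ne)
  ...   | p , pr , p∣m with smooth p pr p∣m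
  ...     | ()
smooth-common-multiple N {p ∷ ps} (pr ∷ prs) with maxPower N pr | smooth-common-multiple N prs
... | P , P≢0 , P≤N , P-max | M , M≢0 , M≤ , M-common =
  P · M , ℕ.m*n≢0 P M {{P≢0}} {{M≢0}} , ℕ.*-mono-≤ P≤N M≤ , common
  where
  common : ∀ m → 1 ℕ.≤ m → m ℕ.≤ N → (∀ p′ → Prime p′ → p′ ∣ m → p′ ∈ p ∷ ps) → m ∣ P · M
  common m 1≤m m≤N smooth with remove-prime pr m 1≤m
  ... | a , m′ , m≡ , p∤m′ = subst (_∣ P · M) (sym m≡)
    (∣.*-pres-∣ (P-max a (ℕ.≤-trans (∣.∣⇒≤ {{m≢0}} (subst (p ^ a ∣_) (sym m≡) (∣.m∣m*n m′))) m≤N))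
                (M-common m′ (ℕ.n≢0⇒n>0 m′≢0) (ℕ.≤-trans (∣.∣⇒≤ {{m≢0}} m′∣m) m≤N) smooth′))
    where
    m≢0 : NonZero m
    m≢0 = ℕ.>-nonZero 1≤m
    m′∣m : m′ ∣ m
    m′∣m = subst (m′ ∣_) (sym m≡) (∣.n∣m*n (p ^ a))
    m′≢0 : ¬ m′ ≡ 0
    m′≢0 refl = p∤m′ (p ∣.∣0)
    smooth′ : ∀ p′ → Prime p′ → p′ ∣ m′ → p′ ∈ ps
    smooth′ p′ pr′ p′∣m′ with smooth p′ pr′ (∣.∣-trans p′∣m′ m′∣m)
    ... | here refl = contradiction p′∣m′ p∤m′
    ... | there p′∈ = p′∈

chebyshev-lower : ∀ n → 4 ^ n ℕ.≤ suc (n ℕ.+ n) ^ π (suc (suc (n ℕ.+ n)))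
chebyshev-lower n with smooth-common-multiple (suc (n ℕ.+ n)) (primesIn-prime 0 (suc (suc (n ℕ.+ n))))
... | M , M≢0 , M≤ , common = ℕ.≤-trans (common-multiple≥4^ n {{M≢0}}
  (λ m 1≤m m≤N → common m 1≤m m≤N (λ p pr p∣m → ∈-primesIn pr z≤n (s≤s (ℕ.≤-trans (∣.∣⇒≤ {{ℕ.>-nonZero 1≤m}} p∣m) m≤N))))) M≤

halve : ∀ N → ∃[ n ] (n ℕ.+ n ℕ.≤ N × N ℕ.≤ suc (n ℕ.+ n))
halve zero          = 0 , z≤n , z≤n
halve (suc zero)    = 0 , z≤n , s≤s z≤n
halve (suc (suc N)) with halve N
... | n , l , u = suc n , subst (ℕ._≤ suc (suc N)) eq (s≤s (s≤s l)) , subst (suc (suc N) ℕ.≤_) (cong suc eq) (s≤s (s≤s u))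
  where
  eq : suc (suc (n ℕ.+ n)) ≡ suc n ℕ.+ suc n
  eq = cong suc (sym (ℕ.+-suc n n))

-- Taking exponents of 2 in 4^n ≤ (2n+1)^π(2n+2); the 3 absorbs the gap between 2n and N, which is
-- 2n + 2 or 2n + 3.
π-lower : ∀ w N → N ℕ.≤ 2 ^ w → N ℕ.≤ w · π N ℕ.+ 3
π-lower w zero _ = z≤n
π-lower w (suc zero) _ = ℕ.≤-trans (s≤s z≤n) (ℕ.m≤n+m 3 (w · π 1))
π-lower w (suc (suc N)) N≤2^w with halve N
... | n , l , u = begin
  suc (suc N) ≤⟨ s≤s (s≤s u) ⟩
  3 ℕ.+ (n ℕ.+ n) ≡⟨ ℕ.+-comm 3 (n ℕ.+ n) ⟩
  n ℕ.+ n ℕ.+ 3 ≤⟨ ℕ.+-monoˡ-≤ 3 (2^-cancel-≤ pow) ⟩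
  w · π (suc (suc N)) ℕ.+ 3 ∎
  where
  open ℕ.≤-Reasoning
  pow : 2 ^ (n ℕ.+ n) ℕ.≤ 2 ^ (w · π (suc (suc N)))
  pow = begin
    2 ^ (n ℕ.+ n) ≡⟨ cong (2 ^_) (cong (n ℕ.+_) (sym (ℕ.+-identityʳ n))) ⟩
    2 ^ (2 · n) ≡⟨ ℕ.^-*-assoc 2 2 n ⟨
    4 ^ n ≤⟨ chebyshev-lower n ⟩
    suc (n ℕ.+ n) ^ π (suc (suc (n ℕ.+ n))) ≤⟨ ℕ.^-monoˡ-≤ (π (suc (suc (n ℕ.+ n)))) (ℕ.≤-trans (s≤s l) (ℕ.≤-trans (ℕ.n≤1+n (suc N)) N≤2^w)) ⟩
    (2 ^ w) ^ π (suc (suc (n ℕ.+ n))) ≤⟨ ℕ.^-monoʳ-≤ (2 ^ w) {{2^≢0 w}} (π-mono (s≤s (s≤s l))) ⟩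
    (2 ^ w) ^ π (suc (suc N)) ≡⟨ ℕ.^-*-assoc 2 w (π (suc (suc N))) ⟩
    2 ^ (w · π (suc (suc N))) ∎

-- Residue classes containing a prime

hit? : ∀ q .{{_ : NonZero q}} xs a → Dec (Any (λ p → Prime p × p % q ≡ a) xs)
hit? q xs a = any? (λ p → prime? p ×-dec (p % q ℕ.≟ a)) xs

classes : ∀ q .{{_ : NonZero q}} → List ℕ → ℚ
classes q xs = ∑ q (λ a → 𝟙 (hit? q xs a))

R≡classes : ∀ X q .{{_ : NonZero q}} → ι (R X q) ≡ classes q (below X)
R≡classes X q = length-filter-upTo (hit? q (below X)) q

Any-⊆ : ∀ {ℓ} {P : Pred ℕ ℓ} {xs ys} → (∀ {x} → x ∈ xs → x ∈ ys) → Any P xs → Any P ys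
Any-⊆ sub any with ∈.find any
... | x , x∈xs , px = ∈.lose (sub x∈xs) px

classes-mono : ∀ q .{{_ : NonZero q}} {xs ys} → (∀ {x} → x ∈ xs → x ∈ ys) → classes q xs ≤ classes q ys
classes-mono q {xs} {ys} sub = ∑-mono q (λ a _ → 𝟙-mono (hit? q xs a) (hit? q ys a) (Any-⊆ sub))

∑-𝟙≟ : ∀ b n → ∑ n (λ a → 𝟙 (b ℕ.≟ a)) ≡ 𝟙 (b ℕ.<? n)
∑-𝟙≟ b zero = sym (𝟙-no (b ℕ.<? 0) λ ())
∑-𝟙≟ b (suc n) with ℕ.<-cmp b n
... | tri< b<n b≢n _ = trans (cong₂ _+_ (trans (∑-𝟙≟ b n) (𝟙-yes (b ℕ.<? n) b<n)) (𝟙-no (b ℕ.≟ n) b≢n)) (sym (𝟙-yes (b ℕ.<? suc n) (ℕ.m<n⇒m<1+n b<n)))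
... | tri≈ b≮n b≡n _ = trans (cong₂ _+_ (trans (∑-𝟙≟ b n) (𝟙-no (b ℕ.<? n) b≮n)) (𝟙-yes (b ℕ.≟ n) b≡n)) (sym (𝟙-yes (b ℕ.<? suc n) (s≤s (ℕ.≤-reflexive b≡n))))
... | tri> b≮n b≢n n<b = trans (cong₂ _+_ (trans (∑-𝟙≟ b n) (𝟙-no (b ℕ.<? n) b≮n)) (𝟙-no (b ℕ.≟ n) b≢n)) (sym (𝟙-no (b ℕ.<? suc n) (λ b<1+n → ℕ.<⇒≱ n<b (ℕ.≤-pred b<1+n))))

∑-residue : ∀ q .{{_ : NonZero q}} n → ∑ q (λ a → 𝟙 (n % q ℕ.≟ a)) ≡ 1ℚ
∑-residue q n = trans (∑-𝟙≟ (n % q) q) (𝟙-yes (n % q ℕ.<? q) (DM.m%n<n n q))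

∑-prime : ∀ n → ∑ n (λ i → 𝟙 (prime? i)) ≡ ι (π n)
∑-prime zero = sym ι-0
∑-prime (suc n) with 0 ℕ.≤? n ×-dec prime? n
... | yes (_ , pr) = trans (cong₂ _+_ (∑-prime n) (𝟙-yes (prime? n) pr)) (trans (ℚ.+-comm (ι (π n)) 1ℚ) (sym (ι-suc (π n))))
... | no ¬pr       = trans (cong₂ _+_ (∑-prime n) (𝟙-no (prime? n) (λ pr → ¬pr (z≤n , pr)))) (ℚ.+-identityʳ (ι (π n)))

primePair : ℕ → ℕ → ℚ
primePair h m = 𝟙 (prime? m) * 𝟙 (prime? (h ℕ.+ m))

0≤primePair : ∀ h m → 0ℚ ≤ primePair h m
0≤primePair h m = 0≤* (0≤𝟙 (prime? m)) (0≤𝟙 (prime? (h ℕ.+ m)))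

∑-shift : ∀ h n {f : ℕ → ℚ} → (∀ i → 0ℚ ≤ f i) → ∑ n (λ i → 𝟙 (h ℕ.≤? i) * f (i ∸ h)) ≤ ∑ n f
∑-shift h n {f} 0≤f = ℚ.≤-trans (ℚ.≤-reflexive (go n)) (∑-mono-length 0≤f (ℕ.m∸n≤m n h))
  where
  go : ∀ n → ∑ n (λ i → 𝟙 (h ℕ.≤? i) * f (i ∸ h)) ≡ ∑ (n ∸ h) f
  go zero = cong (λ k → ∑ k f) (sym (ℕ.0∸n≡0 h))
  go (suc n) with h ℕ.≤? n
  ... | yes h≤n = trans (cong₂ _+_ (go n) (ℚ.*-identityˡ (f (n ∸ h)))) (cong (λ k → ∑ k f) (sym (ℕ.+-∸-assoc 1 h≤n)))
  ... | no  h≰n = trans (cong₂ _+_ (go n) (ℚ.*-zeroˡ (f (n ∸ h)))) (trans (ℚ.+-identityʳ (∑ (n ∸ h) f))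
    (cong (λ k → ∑ k f) (trans (ℕ.m≤n⇒m∸n≡0 (ℕ.<⇒≤ (ℕ.≰⇒> h≰n))) (sym (ℕ.m≤n⇒m∸n≡0 (ℕ.≰⇒> h≰n))))))

pairs : ℕ → ℕ → ℚ
pairs N h = ∑ N (primePair h)

z[_] : ℕ → ℕ
z[ r ] = 2 ^ (H · 2 ^ r)

-- For m ≥ z a sieving prime dividing the prime m or h + m would have to equal it, but both are at
-- least z. Pairs with m < z are counted trivially.
primePair≤ : ∀ r h m → primePair h m ≤ 𝟙 (m ℕ.<? z[ r ]) + unsifted h (sievingPrimes r) m
primePair≤ r h m with m ℕ.<? z[ r ] | prime? m | prime? (h ℕ.+ m)
... | yes _ | x | y = ℚ.≤-trans (*-mono-≤ (0≤𝟙 x) (𝟙≤1 x) (0≤𝟙 y) (𝟙≤1 y)) (a≤a+s (proj₁ (unsifted-unit h (sievingPrimes r) m)))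
... | no _  | no _ | y = ℚ.≤-trans (ℚ.≤-reflexive (ℚ.*-zeroˡ (𝟙 y))) (0≤+ ℚ.≤-refl (proj₁ (unsifted-unit h (sievingPrimes r) m)))
... | no _  | yes _ | no _ = 0≤+ ℚ.≤-refl (proj₁ (unsifted-unit h (sievingPrimes r) m))
... | no m≮z | yes prm | yes prhm = ℚ.≤-reflexive (sym (trans (ℚ.+-identityˡ (unsifted h (sievingPrimes r) m)) (go small)))
  where
  Survives : ℕ → Set
  Survives p = ¬ p ∣ m × ¬ p ∣ h ℕ.+ m
  small : All Survives (sievingPrimes r)
  small = primesIn-All (2 ^ H) z[ r ] (λ p _ p<z pr →
    (λ p∣m → m≮z (subst (ℕ._< z[ r ]) (prime-∣-prime pr prm p∣m) p<z)) ,
    (λ p∣hm → m≮z (ℕ.≤-<-trans (ℕ.m≤n+m m h) (subst (ℕ._< z[ r ]) (prime-∣-prime pr prhm p∣hm) p<z))))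
  go : ∀ {ps} → All Survives ps → unsifted h ps m ≡ 1ℚ
  go [] = refl
  go {p ∷ ps} ((p∤m , p∤hm) ∷ ss) = trans
    (cong₂ (λ x y → (1ℚ - (x + 𝟙 (¬? (p ∣? h)) * y)) * unsifted h ps m) (𝟙-no (p ∣? m) p∤m) (𝟙-no (p ∣? (h ℕ.+ m)) p∤hm))
    (trans (lem (𝟙 (¬? (p ∣? h))) (unsifted h ps m)) (go ss))
    where
    lem : ∀ d u → (1ℚ - (0ℚ + d * 0ℚ)) * u ≡ u
    lem = solve-∀ ℚ-ring

∑-𝟙<≤ : ∀ z n → ∑ n (λ m → 𝟙 (m ℕ.<? z)) ≤ ι z
∑-𝟙<≤ z n with ℕ.≤-total n z
... | inj₁ n≤z = ℚ.≤-trans (∑-mono n (λ m _ → 𝟙≤1 (m ℕ.<? z))) (ℚ.≤-trans (ℚ.≤-reflexive (trans (∑-const n 1ℚ) (ℚ.*-identityʳ (ι n)))) (ι-mono-≤ n≤z))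
... | inj₂ z≤n′ with ℕ.m≤n⇒∃[o]m+o≡n z≤n′
...   | o , refl = ℚ.≤-trans (ℚ.≤-reflexive (∑-split z o (λ m → 𝟙 (m ℕ.<? z))))
  (ℚ.≤-trans (ℚ.+-mono-≤ (∑-mono z (λ m _ → 𝟙≤1 (m ℕ.<? z))) (∑-mono o (λ i _ → ℚ.≤-reflexive (𝟙-no (z ℕ.+ i ℕ.<? z) (ℕ.m+n≮m z i)))))
  (ℚ.≤-reflexive (trans (cong₂ _+_ (trans (∑-const z 1ℚ) (ℚ.*-identityʳ (ι z))) (trans (∑-const o 0ℚ) (ℚ.*-zeroʳ (ι o)))) (ℚ.+-identityʳ (ι z)))))

error[_] : ℕ → ℕ
error[ r ] = z[ r ] ℕ.+ 2 ^ (3808 · 2 ^ r)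

pairs≤ : ∀ r N h → pairs N h ≤ 2ℚ * ∏[1- map (density h) (sievingPrimes r) ] * ι N + ι error[ r ]
pairs≤ r N h = begin
  pairs N h ≤⟨ ∑-mono N (λ m _ → primePair≤ r h m) ⟩
  ∑ N (λ m → 𝟙 (m ℕ.<? z[ r ]) + unsifted h (sievingPrimes r) m) ≡⟨ ∑-+ N (λ m → 𝟙 (m ℕ.<? z[ r ])) (unsifted h (sievingPrimes r)) ⟩
  ∑ N (λ m → 𝟙 (m ℕ.<? z[ r ])) + ∑ N (unsifted h (sievingPrimes r)) ≤⟨ ℚ.+-mono-≤ (∑-𝟙<≤ z[ r ] N) (brun-hooley h r N) ⟩
  ι z[ r ] + (V + ι E) ≡⟨ lem (ι z[ r ]) V (ι E) ⟩
  V + (ι z[ r ] + ι E) ≡⟨ cong (V +_) (ι-+ z[ r ] E) ⟨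
  V + ι error[ r ] ∎
  where
  open ℚ.≤-Reasoning
  E = 2 ^ (3808 · 2 ^ r)
  V = 2ℚ * ∏[1- map (density h) (sievingPrimes r) ] * ι N
  lem : ∀ z v e → z + (v + e) ≡ v + (z + e)
  lem = solve-∀ ℚ-ring

∑-positive : ∀ K → ∑ (suc K) positive ≡ ι K
∑-positive zero    = sym ι-0
∑-positive (suc K) = trans (cong (_+ 1ℚ) (∑-positive K)) (trans (ℚ.+-comm (ι K) 1ℚ) (sym (ι-suc K)))

module _ (q : ℕ) .{{_ : NonZero q}} where

  upTo-suc⁻ : ∀ {n a} → Any (λ p → Prime p × p % q ≡ a) (upTo (suc n)) →
    Any (λ p → Prime p × p % q ≡ a) (upTo n) ⊎ (Prime n × n % q ≡ a)
  upTo-suc⁻ {n} any with ∈.find any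
  ... | p , p∈ , pr , p%q≡a with p ℕ.≟ n
  ...   | yes refl = inj₂ (pr , p%q≡a)
  ...   | no p≢n   = inj₁ (∈.lose (∈.∈-upTo⁺ (ℕ.≤∧≢⇒< (ℕ.≤-pred (∈.∈-upTo⁻ p∈)) p≢n)) (pr , p%q≡a))

  upTo-suc⁺ : ∀ {n a} → Any (λ p → Prime p × p % q ≡ a) (upTo n) ⊎ (Prime n × n % q ≡ a) →
    Any (λ p → Prime p × p % q ≡ a) (upTo (suc n))
  upTo-suc⁺ (inj₁ any) = Any-⊆ (λ p∈ → ∈.∈-upTo⁺ (ℕ.m<n⇒m<1+n (∈.∈-upTo⁻ p∈))) any
  upTo-suc⁺ {n} (inj₂ pn) = ∈.lose (∈.∈-upTo⁺ (ℕ.n<1+n n)) pn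

  classes≤π : ∀ n → classes q (upTo n) ≤ ι (π n)
  classes≤π n = subst (classes q (upTo n) ≤_) (∑-prime n) (go n)
    where
    go : ∀ n → classes q (upTo n) ≤ ∑ n (λ i → 𝟙 (prime? i))
    go zero = ℚ.≤-reflexive (trans (∑-const q 0ℚ) (ℚ.*-zeroʳ (ι q)))
    go (suc n) = begin
      classes q (upTo (suc n)) ≤⟨ ∑-mono q (λ a _ → pointwise a) ⟩
      ∑ q (λ a → 𝟙 (hit? q (upTo n) a) + 𝟙 (prime? n) * 𝟙 (n % q ℕ.≟ a)) ≡⟨ ∑-+ q (λ a → 𝟙 (hit? q (upTo n) a)) (λ a → 𝟙 (prime? n) * 𝟙 (n % q ℕ.≟ a)) ⟩
      classes q (upTo n) + ∑ q (λ a → 𝟙 (prime? n) * 𝟙 (n % q ℕ.≟ a)) ≡⟨ cong (classes q (upTo n) +_) (trans (∑-*ˡ q (𝟙 (prime? n)) (λ a → 𝟙 (n % q ℕ.≟ a))) (trans (cong (𝟙 (prime? n) *_) (∑-residue q n)) (ℚ.*-identityʳ (𝟙 (prime? n))))) ⟩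
      classes q (upTo n) + 𝟙 (prime? n) ≤⟨ ℚ.+-monoˡ-≤ (𝟙 (prime? n)) (go n) ⟩
      ∑ n (λ i → 𝟙 (prime? i)) + 𝟙 (prime? n) ∎
      where
      open ℚ.≤-Reasoning
      pointwise : ∀ a → 𝟙 (hit? q (upTo (suc n)) a) ≤ 𝟙 (hit? q (upTo n) a) + 𝟙 (prime? n) * 𝟙 (n % q ℕ.≟ a)
      pointwise a = subst (λ x → 𝟙 (hit? q (upTo (suc n)) a) ≤ 𝟙 (hit? q (upTo n) a) + x) (𝟙-× (prime? n) (n % q ℕ.≟ a))
        (or (hit? q (upTo (suc n)) a) (hit? q (upTo n) a) (prime? n ×-dec (n % q ℕ.≟ a)) upTo-suc⁻)
        where
        or : ∀ {a b c} {A : Set a} {B : Set b} {C : Set c} (x : Dec A) (y : Dec B) (z : Dec C) → (A → B ⊎ C) → 𝟙 x ≤ 𝟙 y + 𝟙 z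
        or (no _)  y z f = 0≤+ (0≤𝟙 y) (0≤𝟙 z)
        or (yes a) y z f with f a
        ... | inj₁ b = ℚ.≤-trans (ℚ.≤-reflexive (sym (𝟙-yes y b))) (a≤a+s (0≤𝟙 z))
        ... | inj₂ c = ℚ.≤-trans (ℚ.≤-reflexive (sym (𝟙-yes z c))) (≤-by (ℚ.+-comm (𝟙 y) (𝟙 z)) (0≤𝟙 y))

  same-class : ∀ {m n} → m ℕ.< n → m % q ≡ n % q → ∃[ k ] (1 ℕ.≤ k × k ℕ.≤ n / q × n ≡ k · q ℕ.+ m)
  same-class {m} {n} m<n eq = k , ℕ.n≢0⇒n>0 k≢0 , ℕ.m∸n≤m (n / q) (m / q) , n≡
    where
    k = n / q ∸ m / q
    lem : ∀ r k m q → r ℕ.+ (k ℕ.+ m) · q ≡ k · q ℕ.+ (r ℕ.+ m · q)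
    lem = solve-ℕ
    n≡ : n ≡ k · q ℕ.+ m
    n≡ = begin
      n ≡⟨ DM.m≡m%n+[m/n]*n n q ⟩
      n % q ℕ.+ n / q · q ≡⟨ cong₂ (λ r d → r ℕ.+ d · q) (sym eq) (sym (ℕ.m∸n+n≡m (DM./-monoˡ-≤ q (ℕ.<⇒≤ m<n)))) ⟩
      m % q ℕ.+ (k ℕ.+ m / q) · q ≡⟨ lem (m % q) k (m / q) q ⟩
      k · q ℕ.+ (m % q ℕ.+ m / q · q) ≡⟨ cong (k · q ℕ.+_) (DM.m≡m%n+[m/n]*n m q) ⟨
      k · q ℕ.+ m ∎
      where open ≡-Reasoning
    k≢0 : ¬ k ≡ 0
    k≢0 k≡0 = ℕ.<-irrefl (sym (trans n≡ (cong (λ k → k · q ℕ.+ m) k≡0))) m<n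

  -- The pair is indexed by its larger member n; a shift by k · q later turns this into a count over
  -- the smaller one.
  lowerPair : ℕ → ℕ → ℚ
  lowerPair n k = positive k * (𝟙 (k · q ℕ.≤? n) * primePair (k · q) (n ∸ k · q))

  0≤lowerPair : ∀ n k → 0ℚ ≤ lowerPair n k
  0≤lowerPair n k = 0≤* (0≤positive k) (0≤* (0≤𝟙 (k · q ℕ.≤? n)) (0≤primePair (k · q) (n ∸ k · q)))

  new? : ∀ n → Dec (Prime n × ¬ Any (λ p → Prime p × p % q ≡ n % q) (upTo n))
  new? n = prime? n ×-dec ¬? (hit? q (upTo n) (n % q))

  -- A prime that is not the first of its class exceeds an earlier one by k · q with 1 ≤ k ≤ n/q,
  -- and that single term of the sum is already 1.
  prime≤new+pairs : ∀ n N → n ℕ.< N → 𝟙 (prime? n) ≤ 𝟙 (new? n) + ∑ (suc (N / q)) (lowerPair n)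
  prime≤new+pairs n N n<N with prime? n | hit? q (upTo n) (n % q)
  ... | no  _  | h        = ℚ.≤-trans (∑-nonneg (suc (N / q)) (0≤lowerPair n)) (≤-by (ℚ.+-comm 0ℚ (∑ (suc (N / q)) (lowerPair n))) ℚ.≤-refl)
  ... | yes pr | no _     = a≤a+s (∑-nonneg (suc (N / q)) (0≤lowerPair n))
  ... | yes pr | yes any with ∈.find any
  ...   | p , p∈ , pr′ , p%q≡ with same-class (∈.∈-upTo⁻ p∈) p%q≡
  ...     | k@(suc k′) , _ , k≤n/q , n≡kq+p = ℚ.≤-trans (ℚ.≤-trans (ℚ.≤-reflexive (sym pair≡1)) term≤∑) (ℚ.≤-reflexive (sym (ℚ.+-identityˡ (∑ (suc (N / q)) (lowerPair n)))))
    where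
    n∸kq≡p : n ∸ k · q ≡ p
    n∸kq≡p = trans (cong (_∸ k · q) n≡kq+p) (ℕ.m+n∸m≡n (k · q) p)
    pair≡1 : lowerPair n k ≡ 1ℚ
    pair≡1 = trans (ℚ.*-identityˡ (𝟙 (k · q ℕ.≤? n) * primePair (k · q) (n ∸ k · q)))
      (trans (cong₂ (λ x m → x * primePair (k · q) m) (𝟙-yes (k · q ℕ.≤? n) (subst (k · q ℕ.≤_) (sym n≡kq+p) (ℕ.m≤m+n (k · q) p))) n∸kq≡p)
      (cong₂ (λ x y → 1ℚ * (x * y)) (𝟙-yes (prime? p) pr′) (𝟙-yes (prime? (k · q ℕ.+ p)) (subst Prime n≡kq+p pr))))
    term≤∑ : lowerPair n k ≤ ∑ (suc (N / q)) (lowerPair n)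
    term≤∑ = ℚ.≤-trans (≤-by (ℚ.+-comm (∑ k (lowerPair n)) (lowerPair n k)) (∑-nonneg k (0≤lowerPair n)))
      (∑-mono-length (0≤lowerPair n) (s≤s (ℕ.≤-trans k≤n/q (DM./-monoˡ-≤ q (ℕ.<⇒≤ n<N)))))

  -- A new prime opens a class that no earlier prime has hit, so the two indicators on the left of
  -- `pointwise` are never both 1.
  ∑-new≤classes : ∀ n → ∑ n (λ i → 𝟙 (new? i)) ≤ classes q (upTo n)
  ∑-new≤classes zero = ∑-nonneg q (λ a → 0≤𝟙 (hit? q [] a))
  ∑-new≤classes (suc n) = begin
    ∑ n (λ i → 𝟙 (new? i)) + 𝟙 (new? n) ≤⟨ ℚ.+-monoˡ-≤ (𝟙 (new? n)) (∑-new≤classes n) ⟩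
    classes q (upTo n) + 𝟙 (new? n) ≡⟨ cong (classes q (upTo n) +_) (trans (∑-*ˡ q (𝟙 (new? n)) (λ a → 𝟙 (n % q ℕ.≟ a))) (trans (cong (𝟙 (new? n) *_) (∑-residue q n)) (ℚ.*-identityʳ (𝟙 (new? n))))) ⟨
    classes q (upTo n) + ∑ q (λ a → 𝟙 (new? n) * 𝟙 (n % q ℕ.≟ a)) ≡⟨ ∑-+ q (λ a → 𝟙 (hit? q (upTo n) a)) (λ a → 𝟙 (new? n) * 𝟙 (n % q ℕ.≟ a)) ⟨
    ∑ q (λ a → 𝟙 (hit? q (upTo n) a) + 𝟙 (new? n) * 𝟙 (n % q ℕ.≟ a)) ≤⟨ ∑-mono q (λ a _ → pointwise a) ⟩
    classes q (upTo (suc n)) ∎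
    where
    open ℚ.≤-Reasoning
    disjoint : ∀ {a b c} {A : Set a} {B : Set b} {C : Set c} (x : Dec A) (y : Dec B) (z : Dec C) → (A → C) → (B → C) → (A → B → ⊥) → 𝟙 x + 𝟙 y ≤ 𝟙 z
    disjoint (yes a) (yes b) z f g h = ⊥-elim (h a b)
    disjoint (yes a) (no _)  z f g h = ℚ.≤-reflexive (sym (𝟙-yes z (f a)))
    disjoint (no _)  (yes b) z f g h = ℚ.≤-reflexive (sym (𝟙-yes z (g b)))
    disjoint (no _)  (no _)  z f g h = 0≤𝟙 z
    pointwise : ∀ a → 𝟙 (hit? q (upTo n) a) + 𝟙 (new? n) * 𝟙 (n % q ℕ.≟ a) ≤ 𝟙 (hit? q (upTo (suc n)) a)
    pointwise a = subst (λ x → 𝟙 (hit? q (upTo n) a) + x ≤ 𝟙 (hit? q (upTo (suc n)) a)) (𝟙-× (new? n) (n % q ℕ.≟ a))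
      (disjoint (hit? q (upTo n) a) (new? n ×-dec (n % q ℕ.≟ a)) (hit? q (upTo (suc n)) a)
        (upTo-suc⁺ ∘ inj₁) (λ { ((pr , _) , eq) → upTo-suc⁺ (inj₂ (pr , eq)) }) (λ { any ((_ , ¬any) , refl) → ¬any any }))

  π≤classes+pairs : ∀ N → ι (π N) ≤ classes q (upTo N) + ∑ (suc (N / q)) (λ k → positive k * pairs N (k · q))
  π≤classes+pairs N = begin
    ι (π N) ≡⟨ ∑-prime N ⟨
    ∑ N (λ n → 𝟙 (prime? n)) ≤⟨ ∑-mono N (λ n n<N → prime≤new+pairs n N n<N) ⟩
    ∑ N (λ n → 𝟙 (new? n) + ∑ (suc K) (lowerPair n)) ≡⟨ ∑-+ N (λ n → 𝟙 (new? n)) (λ n → ∑ (suc K) (lowerPair n)) ⟩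
    ∑ N (λ n → 𝟙 (new? n)) + ∑ N (λ n → ∑ (suc K) (lowerPair n)) ≤⟨ ℚ.+-mono-≤ (∑-new≤classes N) (ℚ.≤-reflexive (∑-swap N (suc K) lowerPair)) ⟩
    classes q (upTo N) + ∑ (suc K) (λ k → ∑ N (λ n → lowerPair n k)) ≤⟨ ℚ.+-monoʳ-≤ (classes q (upTo N)) (∑-mono (suc K) (λ k _ → shifted k)) ⟩
    classes q (upTo N) + ∑ (suc K) (λ k → positive k * pairs N (k · q)) ∎
    where
    open ℚ.≤-Reasoning
    K = N / q
    shifted : ∀ k → ∑ N (λ n → lowerPair n k) ≤ positive k * pairs N (k · q)
    shifted k = ℚ.≤-trans (ℚ.≤-reflexive (∑-*ˡ N (positive k) (λ n → 𝟙 (k · q ℕ.≤? n) * primePair (k · q) (n ∸ k · q))))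
      (*-monoʳ (0≤positive k) (∑-shift (k · q) N (0≤primePair (k · q))))

  ∑-pairs≤ : ∀ r N K → ∑ (suc K) (λ k → positive k * pairs N (k · q))
    ≤ 2ℚ * ι N * ∑ (suc K) (λ k → positive k * ∏[1- map (density (k · q)) (sievingPrimes r) ]) + ι (K · error[ r ])
  ∑-pairs≤ r N K = begin
    ∑ (suc K) (λ k → positive k * pairs N (k · q))
      ≤⟨ ∑-mono (suc K) (λ k _ → ℚ.≤-trans (*-monoʳ (0≤positive k) (pairs≤ r N (k · q))) (ℚ.≤-reflexive (lem (positive k) (V k) (ι N) e))) ⟩
    ∑ (suc K) (λ k → 2ℚ * ι N * (positive k * V k) + e * positive k)
      ≡⟨ ∑-+ (suc K) (λ k → 2ℚ * ι N * (positive k * V k)) (λ k → e * positive k) ⟩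
    ∑ (suc K) (λ k → 2ℚ * ι N * (positive k * V k)) + ∑ (suc K) (λ k → e * positive k)
      ≡⟨ cong₂ _+_ (∑-*ˡ (suc K) (2ℚ * ι N) (λ k → positive k * V k)) (trans (∑-*ˡ (suc K) e positive) (trans (cong (e *_) (∑-positive K)) (trans (ℚ.*-comm e (ι K)) (sym (ι-* K error[ r ]))))) ⟩
    2ℚ * ι N * ∑ (suc K) (λ k → positive k * V k) + ι (K · error[ r ]) ∎
    where
    open ℚ.≤-Reasoning
    e = ι error[ r ]
    V : ℕ → ℚ
    V k = ∏[1- map (density (k · q)) (sievingPrimes r) ]
    lem : ∀ n v N e → n * (2ℚ * v * N + e) ≡ 2ℚ * N * (n * v) + e * n
    lem = solve-∀ ℚ-ring

-- The exponential series

expTerm-suc : ∀ j t → expTerm (suc j) t ≡ expTerm j t * t * recip (suc j)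
expTerm-suc j t = cong (expTerm j t * t *_) (sym (recip-suc j))

0≤expTerm : ∀ j {t} → 0ℚ ≤ t → 0ℚ ≤ expTerm j t
0≤expTerm zero    0≤t = 0≤1
0≤expTerm (suc j) {t} 0≤t = subst (0ℚ ≤_) (sym (expTerm-suc j t)) (0≤* (0≤* (0≤expTerm j 0≤t) 0≤t) (0≤recip (suc j)))

0≤expSum : ∀ k {t} → 0ℚ ≤ t → 0ℚ ≤ expSum k t
0≤expSum zero    0≤t = 0≤1
0≤expSum (suc k) 0≤t = 0≤+ (0≤expSum k 0≤t) (0≤expTerm (suc k) 0≤t)

expTerm-mono : ∀ j {s t} → 0ℚ ≤ s → s ≤ t → expTerm j s ≤ expTerm j t
expTerm-mono zero    0≤s s≤t = ℚ.≤-refl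
expTerm-mono (suc j) {s} {t} 0≤s s≤t = subst₂ _≤_ (sym (expTerm-suc j s)) (sym (expTerm-suc j t))
  (*-monoˡ (0≤recip (suc j)) (*-mono-≤ (0≤expTerm j 0≤s) (expTerm-mono j 0≤s s≤t) 0≤s s≤t))

expSum-mono : ∀ k {s t} → 0ℚ ≤ s → s ≤ t → expSum k s ≤ expSum k t
expSum-mono zero    0≤s s≤t = ℚ.≤-refl
expSum-mono (suc k) 0≤s s≤t = ℚ.+-mono-≤ (expSum-mono k 0≤s s≤t) (expTerm-mono (suc k) 0≤s s≤t)

suc*expTerm : ∀ j t → ι (suc j) * expTerm (suc j) t ≡ t * expTerm j t
suc*expTerm j t = begin
  ι (suc j) * expTerm (suc j) t ≡⟨ cong (ι (suc j) *_) (expTerm-suc j t) ⟩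
  ι (suc j) * (expTerm j t * t * recip (suc j)) ≡⟨ lem (ι (suc j)) (expTerm j t) t (recip (suc j)) ⟩
  (ι (suc j) * recip (suc j)) * (t * expTerm j t) ≡⟨ cong (_* (t * expTerm j t)) (ι-recip (suc j)) ⟩
  1ℚ * (t * expTerm j t) ≡⟨ ℚ.*-identityˡ (t * expTerm j t) ⟩
  t * expTerm j t ∎
  where
  open ≡-Reasoning
  lem : ∀ i e t r → i * (e * t * r) ≡ (i * r) * (t * e)
  lem = solve-∀ ℚ-ring

expTerm-1 : ∀ t → expTerm 1 t ≡ t
expTerm-1 t = trans (ℚ.*-identityʳ (1ℚ * t)) (ℚ.*-identityˡ t)

-- (t+h)^(j+1) − t^(j+1) ≤ (j+1) h (t+h)^j
expTerm-upper : ∀ j {t h} → 0ℚ ≤ t → 0ℚ ≤ h → expTerm (suc j) (t + h) ≤ expTerm (suc j) t + h * expTerm j (t + h)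
expTerm-upper zero {t} {h} 0≤t 0≤h = ℚ.≤-reflexive (trans (expTerm-1 (t + h)) (trans (lem t h) (cong (_+ h * 1ℚ) (sym (expTerm-1 t)))))
  where
  lem : ∀ t h → t + h ≡ t + h * 1ℚ
  lem = solve-∀ ℚ-ring
expTerm-upper (suc j) {t} {h} 0≤t 0≤h = *-cancel-≤ (0<ι (suc (suc j))) (begin
  ι (suc (suc j)) * expTerm (suc (suc j)) s ≡⟨ suc*expTerm (suc j) s ⟩
  (t + h) * expTerm (suc j) s ≡⟨ ℚ.*-distribʳ-+ (expTerm (suc j) s) t h ⟩
  t * expTerm (suc j) s + h * expTerm (suc j) s ≤⟨ ℚ.+-monoˡ-≤ (h * expTerm (suc j) s) (*-monoʳ 0≤t (expTerm-upper j 0≤t 0≤h)) ⟩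
  t * (expTerm (suc j) t + h * expTerm j s) + h * expTerm (suc j) s ≡⟨ lem₁ t h (expTerm (suc j) t) (expTerm j s) (expTerm (suc j) s) ⟩
  t * expTerm (suc j) t + h * (t * expTerm j s + expTerm (suc j) s) ≤⟨ ℚ.+-monoʳ-≤ (t * expTerm (suc j) t) (*-monoʳ 0≤h (ℚ.+-monoˡ-≤ (expTerm (suc j) s) (*-monoˡ (0≤expTerm j 0≤s) (a≤a+s {t} 0≤h)))) ⟩
  t * expTerm (suc j) t + h * (s * expTerm j s + expTerm (suc j) s) ≡⟨ cong₂ (λ x y → x + h * (y + expTerm (suc j) s)) (suc*expTerm (suc j) t) (suc*expTerm j s) ⟨
  n * expTerm (suc (suc j)) t + h * (ι (suc j) * expTerm (suc j) s + expTerm (suc j) s) ≡⟨ lem₂ n (expTerm (suc (suc j)) t) h (ι (suc j)) (expTerm (suc j) s) ⟩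
  n * expTerm (suc (suc j)) t + h * ((1ℚ + ι (suc j)) * expTerm (suc j) s) ≡⟨ cong (λ x → n * expTerm (suc (suc j)) t + h * (x * expTerm (suc j) s)) (ι-suc (suc j)) ⟨
  n * expTerm (suc (suc j)) t + h * (n * expTerm (suc j) s) ≡⟨ lem₃ n (expTerm (suc (suc j)) t) h (expTerm (suc j) s) ⟩
  n * (expTerm (suc (suc j)) t + h * expTerm (suc j) s) ∎)
  where
  open ℚ.≤-Reasoning
  s = t + h
  n = ι (suc (suc j))
  0≤s = 0≤+ 0≤t 0≤h
  lem₁ : ∀ t h a b c → t * (a + h * b) + h * c ≡ t * a + h * (t * b + c)
  lem₁ = solve-∀ ℚ-ring
  lem₂ : ∀ n a h i b → n * a + h * (i * b + b) ≡ n * a + h * ((1ℚ + i) * b)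
  lem₂ = solve-∀ ℚ-ring
  lem₃ : ∀ n a h b → n * a + h * (n * b) ≡ n * (a + h * b)
  lem₃ = solve-∀ ℚ-ring

-- A finite form of (1 - h) exp(t + h) ≤ exp t; with h = 1/2 it yields exp(t + 1/2) ≤ 2 exp t.
expSum-upper : ∀ k {t h} → 0ℚ ≤ t → 0ℚ ≤ h → expSum k (t + h) ≤ expSum k t + h * expSum k (t + h)
expSum-upper k {t} {h} 0≤t 0≤h = ℚ.≤-trans (go k) (ℚ.+-monoʳ-≤ (expSum k t) (*-monoʳ 0≤h (before≤ k)))
  where
  s = t + h
  0≤s = 0≤+ 0≤t 0≤h
  -- The partial sum with one term fewer, because the increment of each term is bounded by the
  -- preceding term.
  before : ℕ → ℚ
  before zero    = 0ℚ
  before (suc k) = expSum k s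
  before≤ : ∀ k → before k ≤ expSum k s
  before≤ zero    = 0≤1
  before≤ (suc k) = a≤a+s (0≤expTerm (suc k) 0≤s)
  go : ∀ k → expSum k s ≤ expSum k t + h * before k
  go zero = a≤a+s (0≤* 0≤h ℚ.≤-refl)
  go (suc k) = ℚ.≤-trans (ℚ.+-mono-≤ (go k) (expTerm-upper k 0≤t 0≤h))
    (ℚ.≤-trans (ℚ.≤-reflexive (lem (expSum k t) (before k) (expTerm (suc k) t) (expTerm k s) h)) (ℚ.+-monoʳ-≤ (expSum (suc k) t) (*-monoʳ 0≤h (split k))))
    where
    lem : ∀ a b c d h → a + h * b + (c + h * d) ≡ a + c + h * (b + d)
    lem = solve-∀ ℚ-ring
    split : ∀ k → before k + expTerm k s ≤ expSum k s
    split zero    = ℚ.≤-reflexive (ℚ.+-identityˡ 1ℚ)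
    split (suc k) = ℚ.≤-refl

expSum-0 : ∀ k → expSum k 0ℚ ≡ 1ℚ
expSum-0 zero    = refl
expSum-0 (suc k) = trans (cong₂ _+_ (expSum-0 k) (trans (cong (_* ((ℤ.+ 1) ℚ./ suc k)) (ℚ.*-zeroʳ (expTerm k 0ℚ))) (ℚ.*-zeroˡ ((ℤ.+ 1) ℚ./ suc k)))) (ℚ.+-identityʳ 1ℚ)

expSum≤2^ : ∀ k m → expSum k (ι m * recip 2) ≤ ι (2 ^ m)
expSum≤2^ k zero = ℚ.≤-reflexive (trans (cong (expSum k) (trans (cong (_* recip 2) ι-0) (ℚ.*-zeroˡ (recip 2)))) (trans (expSum-0 k) (sym ι-1)))
expSum≤2^ k (suc m) = begin
  expSum k (ι (suc m) * h) ≡⟨ cong (expSum k) (trans (cong (_* h) (ι-suc m)) (lem (ι m) h)) ⟩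
  E ≤⟨ ≤-by (lem′ (expSum k (ι m * h)) E h) (0≤+ (0≤+ (0≤b-a bound) (0≤b-a bound)) (0≤* 0≤E (0≤b-a (ℚ.≤-reflexive ½+½≡1)))) ⟩
  2ℚ * expSum k (ι m * h) ≤⟨ *-monoʳ 0≤2 (expSum≤2^ k m) ⟩
  2ℚ * ι (2 ^ m) ≡⟨ lem″ (ι (2 ^ m)) ⟩
  ι (2 ^ m) + ι (2 ^ m) ≡⟨ trans (cong ι (2^suc m)) (ι-+ (2 ^ m) (2 ^ m)) ⟨
  ι (2 ^ suc m) ∎
  where
  open ℚ.≤-Reasoning
  h = recip 2
  0≤mh = 0≤* (0≤ι m) (0≤recip 2)
  E = expSum k (ι m * h + h)
  0≤E = 0≤expSum k (0≤+ 0≤mh (0≤recip 2))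
  bound : E ≤ expSum k (ι m * h) + h * E
  bound = expSum-upper k 0≤mh (0≤recip 2)
  lem : ∀ m h → (1ℚ + m) * h ≡ m * h + h
  lem = solve-∀ ℚ-ring
  lem′ : ∀ a E h → 2ℚ * a ≡ E + (((a + h * E - E) + (a + h * E - E)) + E * (1ℚ - (h + h)))
  lem′ = solve-∀ ℚ-ring
  lem″ : ∀ x → 2ℚ * x ≡ x + x
  lem″ = solve-∀ ℚ-ring

-- (t+1)^(j+1) ≥ t^(j+1) + (j+1) t^j
expTerm-lower : ∀ j {t} → 0ℚ ≤ t → expTerm (suc j) t + expTerm j t ≤ expTerm (suc j) (t + 1ℚ)
expTerm-lower zero {t} 0≤t = ℚ.≤-reflexive (trans (cong (_+ 1ℚ) (expTerm-1 t)) (sym (expTerm-1 (t + 1ℚ))))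
expTerm-lower (suc j) {t} 0≤t = *-cancel-≤ (0<ι (suc (suc j))) (begin
  n * (expTerm (suc (suc j)) t + b) ≡⟨ ℚ.*-distribˡ-+ n (expTerm (suc (suc j)) t) b ⟩
  n * expTerm (suc (suc j)) t + n * b ≡⟨ cong₂ (λ x y → x + y * b) (suc*expTerm (suc j) t) (ι-suc (suc j)) ⟩
  t * b + (1ℚ + ι (suc j)) * b ≡⟨ lem₁ t b (ι (suc j)) ⟩
  t * b + b + ι (suc j) * b ≡⟨ cong (t * b + b +_) (suc*expTerm j t) ⟩
  t * b + b + t * c ≤⟨ ≤-by (lem₂ t b c) (0≤expTerm j 0≤t) ⟩
  (t + 1ℚ) * (b + c) ≤⟨ *-monoʳ (0≤+ 0≤t 0≤1) (expTerm-lower j 0≤t) ⟩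
  (t + 1ℚ) * expTerm (suc j) (t + 1ℚ) ≡⟨ suc*expTerm (suc j) (t + 1ℚ) ⟨
  n * expTerm (suc (suc j)) (t + 1ℚ) ∎)
  where
  open ℚ.≤-Reasoning
  n = ι (suc (suc j))
  b = expTerm (suc j) t
  c = expTerm j t
  lem₁ : ∀ t b i → t * b + (1ℚ + i) * b ≡ t * b + b + i * b
  lem₁ = solve-∀ ℚ-ring
  lem₂ : ∀ t b c → (t + 1ℚ) * (b + c) ≡ t * b + b + t * c + c
  lem₂ = solve-∀ ℚ-ring

-- A finite form of 2 exp t ≤ exp(t + 1), at the cost of one further term.
expSum-lower : ∀ k {t} → 0ℚ ≤ t → expSum k t + expSum k t ≤ expSum (suc k) (t + 1ℚ)
expSum-lower k {t} 0≤t = ℚ.≤-trans (ℚ.+-monoˡ-≤ (expSum k t) (a≤a+s {expSum k t} (0≤expTerm (suc k) 0≤t))) (go k)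
  where
  lem : ∀ a b c d → a + b + (c + d) ≡ a + c + (b + d)
  lem = solve-∀ ℚ-ring
  go : ∀ k → expSum (suc k) t + expSum k t ≤ expSum (suc k) (t + 1ℚ)
  go zero = ℚ.≤-trans (ℚ.≤-reflexive (ℚ.+-assoc 1ℚ (expTerm 1 t) 1ℚ)) (ℚ.+-monoʳ-≤ 1ℚ (expTerm-lower 0 0≤t))
  go (suc k) = ℚ.≤-trans (ℚ.≤-reflexive (lem (expSum (suc k) t) (expTerm (suc (suc k)) t) (expSum k t) (expTerm (suc k) t)))
    (ℚ.+-mono-≤ (go k) (expTerm-lower (suc k) 0≤t))

2^≤expSum : ∀ n {t} → ι n ≤ t → ι (2 ^ n) ≤ expSum n t
2^≤expSum n n≤t = ℚ.≤-trans (go n) (expSum-mono n (0≤ι n) n≤t)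
  where
  go : ∀ n → ι (2 ^ n) ≤ expSum n (ι n)
  go zero    = ℚ.≤-reflexive ι-1
  go (suc n) = begin
    ι (2 ^ suc n) ≡⟨ trans (cong ι (2^suc n)) (ι-+ (2 ^ n) (2 ^ n)) ⟩
    ι (2 ^ n) + ι (2 ^ n) ≤⟨ ℚ.+-mono-≤ (go n) (go n) ⟩
    expSum n (ι n) + expSum n (ι n) ≤⟨ expSum-lower n (0≤ι n) ⟩
    expSum (suc n) (ι n + 1ℚ) ≡⟨ cong (expSum (suc n)) (trans (ℚ.+-comm (ι n) 1ℚ) (sym (ι-suc n))) ⟩
    expSum (suc n) (ι (suc n)) ∎
    where open ℚ.≤-Reasoning

-- Logarithmic bounds in terms of powers of 2

logBound⁺ : ∀ {μ q X} → 0ℚ < μ → ∀ n → q ℕ.≤ 2 ^ n → ι n * μ ≤ X → LogBound μ q X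
logBound⁺ {μ} {q} {X} 0<μ n q≤2^n nμ≤X t tμ≡X r r<q = n ,
  ℚ.<-≤-trans (subst (r <_) (sym (ι≡ℕ→ℚ q)) r<q) (ℚ.≤-trans (ι-mono-≤ q≤2^n) (2^≤expSum n n≤t))
  where
  n≤t : ι n ≤ t
  n≤t = *-cancel-≤ 0<μ (subst₂ _≤_ (ℚ.*-comm (ι n) μ) (trans (sym tμ≡X) (ℚ.*-comm t μ)) nμ≤X)

-- If X were smaller, t = X/μ would be at most m/2 and every partial sum at t at most 2^m. But 2^m
-- is a rational strictly below q, so `LogBound` provides a partial sum exceeding it.
logBound⁻ : ∀ {μ q X} → 0ℚ < μ → 0ℚ < X → LogBound μ q X → ∀ m → 2 ^ m ℕ.< q → ι m * recip 2 * μ ≤ X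
logBound⁻ {μ} {q} {X} 0<μ 0<X bound m 2^m<q with ι m * recip 2 * μ ℚ.≤? X
... | yes h = h
... | no ¬h = ⊥-elim (ℚ.<-irrefl refl (ℚ.<-≤-trans (proj₂ exceeded)
  (ℚ.≤-trans (expSum-mono (proj₁ exceeded) 0≤t t≤m/2) (expSum≤2^ (proj₁ exceeded) m))))
  where
  instance
    μ≢0 : ℚ.NonZero μ
    μ≢0 = ℚ.pos⇒nonZero μ {{ℚ.positive 0<μ}}
  t = X * ℚ.1/ μ
  tμ≡X : t * μ ≡ X
  tμ≡X = trans (ℚ.*-assoc X (ℚ.1/ μ) μ) (trans (cong (X *_) (ℚ.*-inverseˡ μ)) (ℚ.*-identityʳ X))
  0≤t : 0ℚ ≤ t
  0≤t = *-cancel-≤ 0<μ (subst₂ _≤_ (sym (ℚ.*-zeroʳ μ)) (trans (sym tμ≡X) (ℚ.*-comm t μ)) (ℚ.<⇒≤ 0<X))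
  t≤m/2 : t ≤ ι m * recip 2
  t≤m/2 = *-cancel-≤ 0<μ (subst₂ _≤_ (trans (sym tμ≡X) (ℚ.*-comm t μ)) (ℚ.*-comm (ι m * recip 2) μ) (ℚ.<⇒≤ (ℚ.≰⇒> ¬h)))
  exceeded : ∃[ k ] (ι (2 ^ m) < expSum k t)
  exceeded = bound t tμ≡X (ι (2 ^ m)) (subst (ι (2 ^ m) <_) (ι≡ℕ→ℚ q) (ι-mono-< 2^m<q))

archimedean : ∀ {c} → 0ℚ < c → ∃[ d ] (NonZero d × 1ℚ ≤ ι d * c)
archimedean {mkℚ (ℤ.+ zero) d cop} 0<c = ⊥-elim (ℚ.<⇒≢ 0<c (sym (ℚ.↥p≡0⇒p≡0 (mkℚ (ℤ.+ zero) d cop) refl)))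
archimedean {mkℚ ℤ.-[1+ n ] d cop} (ℚ.*<* ())
archimedean {c@(mkℚ ℤ.+[1+ n ] d cop)} 0<c = suc d , _ ,
  subst (_≤ ι (suc d) * c) (ι-recip-suc d) (*-monoʳ (0≤ι (suc d)) (ℚ.toℚᵘ-cancel-≤ (begin
    ℚ.toℚᵘ (recip (suc d)) ≡⟨ cong ℚ.toℚᵘ (recip-suc d) ⟩
    ℚ.toℚᵘ ((ℤ.+ 1) ℚ./ suc d) ≃⟨ toℚᵘ-/ (ℤ.+ 1) d ⟩
    ℚᵘ.mkℚᵘ (ℤ.+ 1) d ≤⟨ ℚᵘ.*≤* (ℤ.*-monoʳ-≤-nonNeg (ℤ.+ suc d) (ℤ.+≤+ {1} {suc n} (s≤s z≤n))) ⟩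
    ℚᵘ.mkℚᵘ ℤ.+[1+ n ] d ∎)))
  where open ℚᵘ.≤-Reasoning

-- The first part: primes against congruent pairs

n<2^n : ∀ n → n ℕ.< 2 ^ n
n<2^n zero    = s≤s z≤n
n<2^n (suc n) = subst (suc (suc n) ℕ.≤_) (sym (2^suc n)) (ℕ.+-mono-≤ (ℕ.m^n>0 2 n) (n<2^n n))

square-cancel-≤ : ∀ {m n} → m · m ℕ.≤ n · n → m ℕ.≤ n
square-cancel-≤ h = ℕ.≮⇒≥ (λ n<m → ℕ.<⇒≱ (ℕ.*-mono-< n<m n<m) h)

≤φ : ∀ {x L q} .{{_ : NonZero q}} → 2 ^ L ℕ.≤ q → 2 · (x · x) ℕ.≤ 2 ^ L → x ℕ.≤ φ q
≤φ {x} {L} {q} 2^L≤q h = square-cancel-≤ (ℕ.*-cancelˡ-≤ 2 (ℕ.≤-trans h (ℕ.≤-trans 2^L≤q (q≤2φ² q))))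

φ≤q : ∀ q → φ q ℕ.≤ q
φ≤q q = subst (φ q ℕ.≤_) (List.length-upTo q) (List.length-filter (λ k → coprime? k q) (upTo q))

-- The comparison of primes with classes and pairs, multiplied by φ(q) w² with w = H · 2^r so that
-- it can be stated in ℕ. The squared Mertens constant (2 · 2^H)², a factor 2 each from the sieve
-- and the average over k, and K q ≤ N produce 16 · 2^(2H) N².
primes-in-classes : ∀ q .{{_ : NonZero q}} r N →
  ∀ c → classes q (upTo N) ≤ ι c →
  let a = φ q · (H · 2 ^ r · (H · 2 ^ r)) in
  a · π N ℕ.≤ a · (c ℕ.+ N / q · error[ r ]) ℕ.+ 16 · (2 ^ H · 2 ^ H) · (N · N)
primes-in-classes q r N c classes≤c = ι-cancel-≤ (begin
  ι (a · π N) ≡⟨ ι-* a (π N) ⟩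
  ι a * ι (π N) ≤⟨ *-monoʳ (0≤ι a) (ℚ.≤-trans (π≤classes+pairs q N) (ℚ.+-mono-≤ classes≤c (∑-pairs≤ q r N K))) ⟩
  ι a * (ι c + (2ℚ * ι N * S + ι Ke)) ≡⟨ lem₁ (ι a) (ι c) (ι N) S (ι Ke) ⟩
  ι a * (ι c + ι Ke) + 2ℚ * ι N * (ι a * S) ≡⟨ cong₂ (λ x y → ι a * x + 2ℚ * ι N * (y * S)) (sym (ι-+ c Ke)) ιa ⟩
  M + 2ℚ * ι N * (f * (ω * ω) * S) ≡⟨ cong (λ x → M + 2ℚ * ι N * x) (lem₂ f ω S) ⟩
  M + 2ℚ * ι N * (ω * ω * (f * S)) ≤⟨ ℚ.+-monoʳ-≤ (M) (*-monoʳ (0≤* 0≤2 (0≤ι N)) (*-monoʳ (0≤* 0≤ω 0≤ω) (singularSeries-average r q K))) ⟩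
  M + 2ℚ * ι N * (ω * ω * (e * e * (ι q * (ι K * 2ℚ))))
    ≡⟨ cong (M +_) (lem₃ (ι N) ω e (ι q) (ι K)) ⟩
  M + 2ℚ * 2ℚ * ι N * ((ι K * ι q) * ((e * ω) * (e * ω)))
    ≤⟨ ℚ.+-monoʳ-≤ (M) (*-monoʳ (0≤* (0≤* 0≤2 0≤2) (0≤ι N))
         (*-mono-≤ (0≤* (0≤ι K) (0≤ι q)) Kq≤N (0≤* 0≤eω 0≤eω) (*-mono-≤ 0≤eω (mertens-sieving r) 0≤eω (mertens-sieving r)))) ⟩
  M + 2ℚ * 2ℚ * ι N * (ι N * ((2ℚ * h) * (2ℚ * h)))
    ≡⟨ cong (M +_) (lem₄ (ι N) h) ⟩
  M + 2ℚ * 2ℚ * (2ℚ * 2ℚ) * (h * h) * (ι N * ι N)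
    ≡⟨ cong₂ (λ x y → M + x * y * (ι N * ι N)) (sym ι-16) (sym (ι-* (2 ^ H) (2 ^ H))) ⟩
  M + ι 16 * ι hh * (ι N * ι N)
    ≡⟨ cong₂ _+_ (sym (ι-* a (c ℕ.+ Ke))) (trans (cong₂ _*_ (sym (ι-* 16 hh)) (sym (ι-* N N))) (sym (ι-* (16 · hh) (N · N)))) ⟩
  ι (a · (c ℕ.+ Ke)) + ι (X)
    ≡⟨ ι-+ (a · (c ℕ.+ Ke)) (X) ⟨
  ι (a · (c ℕ.+ Ke) ℕ.+ X) ∎)
  where
  open ℚ.≤-Reasoning
  w = H · 2 ^ r
  a = φ q · (w · w)
  K = N / q
  hh = 2 ^ H · 2 ^ H
  X = 16 · hh · (N · N)
  Ke = K · error[ r ]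
  M = ι a * ι (c ℕ.+ Ke)
  f = ι (φ q)
  ω = ι w
  0≤ω = 0≤ι w
  h = ι (2 ^ H)
  e = euler (sievingPrimes r)
  0≤eω : 0ℚ ≤ e * ω
  0≤eω = 0≤* (proj₁ (euler-unit (primesIn-prime (2 ^ H) (2 ^ w)))) 0≤ω
  S = ∑ (suc K) (λ k → positive k * ∏[1- map (density (k · q)) (sievingPrimes r) ])
  ιa : ι a ≡ f * (ω * ω)
  ιa = trans (ι-* (φ q) (w · w)) (cong (f *_) (ι-* w w))
  Kq≤N : ι K * ι q ≤ ι N
  Kq≤N = subst (_≤ ι N) (ι-* K q) (ι-mono-≤ (DM.m/n*n≤m N q))
  lem₁ : ∀ a c N S k → a * (c + (2ℚ * N * S + k)) ≡ a * (c + k) + 2ℚ * N * (a * S)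
  lem₁ = solve-∀ ℚ-ring
  lem₂ : ∀ f w S → f * (w * w) * S ≡ w * w * (f * S)
  lem₂ = solve-∀ ℚ-ring
  lem₃ : ∀ N w e q K → 2ℚ * N * (w * w * (e * e * (q * (K * 2ℚ)))) ≡ 2ℚ * 2ℚ * N * ((K * q) * ((e * w) * (e * w)))
  lem₃ = solve-∀ ℚ-ring
  lem₄ : ∀ N h → 2ℚ * 2ℚ * N * (N * ((2ℚ * h) * (2ℚ * h))) ≡ 2ℚ * 2ℚ * (2ℚ * 2ℚ) * (h * h) * (N * N)
  lem₄ = solve-∀ ℚ-ring

-- Opaque, since large literals in products would be unfolded into unary sums.
opaque
  scale : ℕ
  scale = 8 · 3808

  scale≡ : scale ≡ 8 · 3808
  scale≡ = refl

dyadic-scale : ∀ d .{{_ : NonZero d}} L → d ℕ.≤ L → ∃[ r ] (d · 2 ^ r ℕ.≤ L × L ℕ.< d · 2 ^ suc r)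
dyadic-scale d L d≤L with log-floor 2 ℕ.≤-refl (L / d) {{ℕ.>-nonZero (DM.m≥n⇒m/n>0 {L} {d} d≤L)}}
... | r , l , u = r ,
  ℕ.≤-trans (ℕ.*-monoʳ-≤ d l) (subst (ℕ._≤ L) (ℕ.*-comm (L / d) d) (DM.m/n*n≤m L d)) ,
  ℕ.<-≤-trans (subst₂ ℕ._<_ (sym (DM.m≡m%n+[m/n]*n L d)) (ℕ.*-comm (suc (L / d)) d) (ℕ.+-monoˡ-< (L / d · d) (DM.m%n<n L d)))
    (ℕ.*-monoʳ-≤ d u)

scale≢0 : NonZero scale
scale≢0 = subst NonZero (sym scale≡) _

-- Here f is φ(q), p is π(N), R the number of classes and E the total sieve error. Chebyshev gives p
-- ≥ f/(6J). After multiplication by 24J the error and the pairs each take at most a quarter of the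
-- 4af guaranteed by p, which leaves half for R.
combine : ∀ {f w p R E A B J N L} → 1 ℕ.≤ f → 1 ℕ.≤ w → 1 ℕ.≤ L → 1 ℕ.≤ J →
  f · (w · w) · p ℕ.≤ f · (w · w) · (R ℕ.+ E) ℕ.+ A · (N · N) →
  J · N ℕ.≤ f · L → f · L ℕ.≤ J · suc N → N ℕ.≤ 3 · L · p ℕ.+ 3 →
  8 · J ℕ.≤ f · L → L · L ℕ.≤ B · (w · w) → 24 · A · B ℕ.≤ J → 24 · J · E ℕ.≤ f →
  f ℕ.≤ 12 · J · R
combine {f} {w} {p} {R} {E} {A} {B} {J} {N} {L} 1≤f 1≤w 1≤L 1≤J main JN≤ fL≤ N≤ 8J≤ L²≤ 24AB≤J error≤ =
  ℕ.*-cancelˡ-≤ (2 · a) {{2a≢0}} (ℕ.+-cancelʳ-≤ (2 · a · f) (2 · a · f) (2 · a · (12 · J · R)) (begin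
    2 · a · f ℕ.+ 2 · a · f ≡⟨ lem₁ a f ⟩
    4 · (a · f) ≤⟨ ℕ.*-monoʳ-≤ 4 (ℕ.*-monoʳ-≤ a f≤6Jp) ⟩
    4 · (a · (6 · J · p)) ≡⟨ lem₂ a J p ⟩
    24 · J · (a · p) ≤⟨ ℕ.*-monoʳ-≤ (24 · J) main ⟩
    24 · J · (a · (R ℕ.+ E) ℕ.+ A · (N · N)) ≡⟨ lem₃ a J R E (A · (N · N)) ⟩
    2 · a · (12 · J · R) ℕ.+ (a · (24 · J · E) ℕ.+ 24 · J · (A · (N · N)))
      ≤⟨ ℕ.+-monoʳ-≤ (2 · a · (12 · J · R)) (ℕ.+-mono-≤ (ℕ.*-monoʳ-≤ a error≤) square) ⟩
    2 · a · (12 · J · R) ℕ.+ (a · f ℕ.+ f · f · (w · w)) ≡⟨ cong (2 · a · (12 · J · R) ℕ.+_) (lem₄ f w) ⟩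
    2 · a · (12 · J · R) ℕ.+ 2 · a · f ∎))
  where
  open ℕ.≤-Reasoning
  a = f · (w · w)
  2a≢0 : NonZero (2 · a)
  2a≢0 = ℕ.m*n≢0 2 a {{_}} {{ℕ.m*n≢0 f (w · w) {{ℕ.>-nonZero 1≤f}} {{ℕ.m*n≢0 w w {{ℕ.>-nonZero 1≤w}} {{ℕ.>-nonZero 1≤w}}}}}}
  lem₁ : ∀ a f → 2 · a · f ℕ.+ 2 · a · f ≡ 4 · (a · f)
  lem₁ = solve-ℕ
  lem₂ : ∀ a J p → 4 · (a · (6 · J · p)) ≡ 24 · J · (a · p)
  lem₂ = solve-ℕ
  lem₃ : ∀ a J R E X → 24 · J · (a · (R ℕ.+ E) ℕ.+ X) ≡ 2 · a · (12 · J · R) ℕ.+ (a · (24 · J · E) ℕ.+ 24 · J · X)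
  lem₃ = solve-ℕ
  lem₄ : ∀ f w → f · (w · w) · f ℕ.+ f · f · (w · w) ≡ 2 · (f · (w · w)) · f
  lem₄ = solve-ℕ
  f≤6Jp : f ℕ.≤ 6 · J · p
  f≤6Jp = ℕ.*-cancelʳ-≤ f (6 · J · p) L {{ℕ.>-nonZero 1≤L}} (ℕ.+-cancelʳ-≤ (f · L) (f · L) (6 · J · p · L) (begin
    f · L ℕ.+ f · L ≤⟨ ℕ.+-mono-≤ fL≤ fL≤ ⟩
    J · suc N ℕ.+ J · suc N ≤⟨ ℕ.+-mono-≤ (ℕ.*-monoʳ-≤ J (s≤s N≤)) (ℕ.*-monoʳ-≤ J (s≤s N≤)) ⟩
    J · suc (3 · L · p ℕ.+ 3) ℕ.+ J · suc (3 · L · p ℕ.+ 3) ≡⟨ lem J L p ⟩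
    6 · J · p · L ℕ.+ 8 · J ≤⟨ ℕ.+-monoʳ-≤ (6 · J · p · L) 8J≤ ⟩
    6 · J · p · L ℕ.+ f · L ∎))
    where
    lem : ∀ J L p → J · suc (3 · L · p ℕ.+ 3) ℕ.+ J · suc (3 · L · p ℕ.+ 3) ≡ 6 · J · p · L ℕ.+ 8 · J
    lem = solve-ℕ
  square : 24 · J · (A · (N · N)) ℕ.≤ f · f · (w · w)
  square = ℕ.*-cancelˡ-≤ J {{ℕ.>-nonZero 1≤J}} (begin
    J · (24 · J · (A · (N · N))) ≡⟨ lem J A N ⟩
    24 · A · (J · N · (J · N)) ≤⟨ ℕ.*-monoʳ-≤ (24 · A) (ℕ.*-mono-≤ JN≤ JN≤) ⟩
    24 · A · (f · L · (f · L)) ≡⟨ lem′ A f L ⟩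
    24 · A · (f · f) · (L · L) ≤⟨ ℕ.*-monoʳ-≤ (24 · A · (f · f)) L²≤ ⟩
    24 · A · (f · f) · (B · (w · w)) ≡⟨ lem″ A B f w ⟩
    24 · A · B · (f · f · (w · w)) ≤⟨ ℕ.*-monoˡ-≤ (f · f · (w · w)) 24AB≤J ⟩
    J · (f · f · (w · w)) ∎)
    where
    lem : ∀ J A N → J · (24 · J · (A · (N · N))) ≡ 24 · A · (J · N · (J · N))
    lem = solve-ℕ
    lem′ : ∀ A f L → 24 · A · (f · L · (f · L)) ≡ 24 · A · (f · f) · (L · L)
    lem′ = solve-ℕ
    lem″ : ∀ A B f w → 24 · A · (f · f) · (B · (w · w)) ≡ 24 · A · B · (f · f · (w · w))
    lem″ = solve-ℕ

opaque
  -- The first summand makes room for the sieve; the second forces 768 J < 3808 · 2^r, so that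
  -- 2^(3808 · 2^r) outgrows J.
  threshold : ℕ → ℕ
  threshold J = scale ℕ.+ 16 · (768 · J)

  scale≤threshold : ∀ J → scale ℕ.≤ threshold J
  scale≤threshold J = ℕ.m≤m+n scale (16 · (768 · J))

  16·768≤threshold : ∀ J → 16 · (768 · J) ℕ.≤ threshold J
  16·768≤threshold J = ℕ.m≤n+m (16 · (768 · J)) scale

-- For J above this constant and N = φ(q) log₂ q / J, the primes below N outnumber the pairs of congruent ones.
opaque
  sieveConstant : ℕ
  sieveConstant = 24 · (16 · (2 ^ H · 2 ^ H)) · (3808 · 3808)

  sieveConstant≡ : sieveConstant ≡ 24 · (16 · (2 ^ H · 2 ^ H)) · (3808 · 3808)
  sieveConstant≡ = refl

  sieveConstant≢0 : NonZero sieveConstant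
  sieveConstant≢0 = ℕ.m*n≢0 (24 · (16 · (2 ^ H · 2 ^ H))) (3808 · 3808)
    {{ℕ.m*n≢0 24 (16 · (2 ^ H · 2 ^ H)) {{_}} {{ℕ.m*n≢0 16 (2 ^ H · 2 ^ H) {{_}} {{ℕ.m*n≢0 (2 ^ H) (2 ^ H) {{2^≢0 H}} {{2^≢0 H}}}}}}}}

many-classes : ∀ J q .{{_ : NonZero J}} .{{_ : NonZero q}} L → sieveConstant ℕ.≤ J →
  threshold J ℕ.≤ L → 2 ^ L ℕ.≤ q → q ℕ.< 2 ^ suc L →
  ∀ R → classes q (upTo (φ q · L / J)) ≤ ι R → φ q ℕ.≤ 12 · J · R
many-classes J q L C≤J t≤L 2^L≤q q<2^1+L R classes≤R with dyadic-scale scale {{scale≢0}} L (ℕ.≤-trans (scale≤threshold J) t≤L)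
... | r , l , u = combine {φ q} {w} {π N} {R} {K · error[ r ]} {16 · (2 ^ H · 2 ^ H)} {3808 · 3808} {J} {N} {L}
    1≤f 1≤w 1≤L (ℕ.>-nonZero⁻¹ J) (primes-in-classes q r N R classes≤R)
    (subst (ℕ._≤ f · L) (ℕ.*-comm N J) (DM.m/n*n≤m (f · L) J))
    (ℕ.<⇒≤ (subst₂ ℕ._<_ (sym (DM.m≡m%n+[m/n]*n (f · L) J)) (ℕ.*-comm (suc N) J) (ℕ.+-monoˡ-< (N · J) (DM.m%n<n (f · L) J))))
    (π-lower (3 · L) N N≤2^3L)
    (ℕ.≤-trans 8J≤x (ℕ.≤-trans x≤f (ℕ.m≤m*n f L {{ℕ.>-nonZero 1≤L}})))
    (subst (L · L ℕ.≤_) (lem-w 3808 w) (ℕ.*-mono-≤ L≤3808w L≤3808w))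
    (subst (ℕ._≤ J) sieveConstant≡ C≤J) error-small
  where
  open ℕ.≤-Reasoning
  f = φ q
  N = f · L / J
  K = N / q
  w = H · 2 ^ r
  e = 3808 · 2 ^ r
  y = 2 ^ e
  -- At least 24 J times the total sieve error, which is at most L · 2y. As x ≤ y³, one has 2x² ≤
  -- y^7 ≤ y^8 ≤ 2^L ≤ q, hence x ≤ φ(q) by q ≤ 2φ(q)².
  x = 48 · J · L · y
  w≡ : w ≡ 16 · 2 ^ r
  w≡ = cong (_· 2 ^ r) H≡16
  1≤w : 1 ℕ.≤ w
  1≤w = subst (1 ℕ.≤_) (sym w≡) (ℕ.*-mono-≤ {1} {16} {1} (s≤s z≤n) (ℕ.m^n>0 2 r))
  1≤L : 1 ℕ.≤ L
  1≤L = ℕ.≤-trans (ℕ.>-nonZero⁻¹ scale {{scale≢0}}) (ℕ.≤-trans (scale≤threshold J) t≤L)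
  -- This is what the factor 8 in `scale` is for: it makes y = 2^e at most the eighth root of q.
  8e≤L : 8 · e ℕ.≤ L
  8e≤L = subst (ℕ._≤ L) (trans (cong (_· 2 ^ r) scale≡) (ℕ.*-assoc 8 3808 (2 ^ r))) l
  L<16e : L ℕ.< 16 · e
  L<16e = subst (L ℕ.<_) (trans (cong (_· 2 ^ suc r) scale≡) (lem 3808 (2 ^ r))) u
    where
    lem : ∀ c z → 8 · c · (2 · z) ≡ 16 · (c · z)
    lem = solve-ℕ
  768J≤y : 768 · J ℕ.≤ y
  768J≤y = ℕ.≤-trans (ℕ.<⇒≤ (ℕ.*-cancelˡ-< 16 (768 · J) e (ℕ.≤-<-trans (ℕ.≤-trans (16·768≤threshold J) t≤L) L<16e))) (ℕ.<⇒≤ (n<2^n e))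
  L≤3808w : L ℕ.≤ 3808 · w
  L≤3808w = ℕ.≤-trans (ℕ.<⇒≤ L<16e) (ℕ.≤-reflexive (trans (lem 3808 (2 ^ r)) (cong (3808 ·_) (sym w≡))))
    where
    lem : ∀ c z → 16 · (c · z) ≡ c · (16 · z)
    lem = solve-ℕ
  lem-w : ∀ c w → c · w · (c · w) ≡ c · c · (w · w)
  lem-w = solve-ℕ
  2≤y : 2 ℕ.≤ y
  2≤y = ℕ.≤-trans (ℕ.*-mono-≤ {2} {768} {1} {J} (s≤s (s≤s z≤n)) (ℕ.>-nonZero⁻¹ J)) 768J≤y
  x≤y³ : x ℕ.≤ y · (y · y)
  x≤y³ = begin
    48 · J · L · y ≤⟨ ℕ.*-monoˡ-≤ y (ℕ.*-monoʳ-≤ (48 · J) (ℕ.≤-trans (ℕ.<⇒≤ L<16e) (ℕ.*-monoʳ-≤ 16 (ℕ.<⇒≤ (n<2^n e))))) ⟩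
    48 · J · (16 · y) · y ≡⟨ lem J y ⟩
    768 · J · (y · y) ≤⟨ ℕ.*-monoˡ-≤ (y · y) 768J≤y ⟩
    y · (y · y) ∎
    where
    lem : ∀ J y → 48 · J · (16 · y) · y ≡ 768 · J · (y · y)
    lem = solve-ℕ
  x≤f : x ℕ.≤ f
  x≤f = ≤φ {x} {L} {q} 2^L≤q (begin
    2 · (x · x) ≤⟨ ℕ.*-mono-≤ 2≤y (ℕ.*-mono-≤ x≤y³ x≤y³) ⟩
    y · (y · (y · y) · (y · (y · y))) ≡⟨ ℕ.*-identityˡ _ ⟨
    1 · (y · (y · (y · y) · (y · (y · y)))) ≤⟨ ℕ.*-monoˡ-≤ (y · (y · (y · y) · (y · (y · y)))) (ℕ.<⇒≤ 2≤y) ⟩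
    y · (y · (y · (y · y) · (y · (y · y)))) ≡⟨ lem y ⟩
    y ^ 8 ≡⟨ ℕ.^-*-assoc 2 e 8 ⟩
    2 ^ (e · 8) ≤⟨ 2^mono (subst (ℕ._≤ L) (ℕ.*-comm 8 e) 8e≤L) ⟩
    2 ^ L ∎)
    where
    lem : ∀ y → y · (y · (y · (y · y) · (y · (y · y)))) ≡ y · (y · (y · (y · (y · (y · (y · (y · 1)))))))
    lem = solve-ℕ
  8J≤x : 8 · J ℕ.≤ x
  8J≤x = ℕ.≤-trans (ℕ.*-monoˡ-≤ J {8} {48} (ℕ.m≤m+n 8 40)) (ℕ.≤-trans (ℕ.m≤m*n (48 · J) L {{ℕ.>-nonZero 1≤L}}) (ℕ.m≤m*n (48 · J · L) y {{2^≢0 e}}))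
  1≤f : 1 ℕ.≤ f
  1≤f = ℕ.≤-trans (ℕ.*-mono-≤ {1} {8} {1} {J} (s≤s z≤n) (ℕ.>-nonZero⁻¹ J)) (ℕ.≤-trans 8J≤x x≤f)
  N≤fL : N ℕ.≤ f · L
  N≤fL = DM.m/n≤m (f · L) J
  N≤Lq : N ℕ.≤ L · q
  N≤Lq = ℕ.≤-trans N≤fL (subst (ℕ._≤ L · q) (ℕ.*-comm L f) (ℕ.*-monoʳ-≤ L (φ≤q q)))
  N≤2^3L : N ℕ.≤ 2 ^ (3 · L)
  N≤2^3L = begin
    N ≤⟨ N≤Lq ⟩
    L · q ≤⟨ ℕ.*-mono-≤ (ℕ.<⇒≤ (n<2^n L)) (ℕ.<⇒≤ q<2^1+L) ⟩
    2 ^ L · 2 ^ suc L ≡⟨ ℕ.^-distribˡ-+-* 2 L (suc L) ⟨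
    2 ^ (L ℕ.+ suc L) ≤⟨ 2^mono (ℕ.+-monoʳ-≤ L (ℕ.≤-trans (ℕ.+-monoˡ-≤ L 1≤L) (ℕ.≤-reflexive (cong (L ℕ.+_) (sym (ℕ.+-identityʳ L)))))) ⟩
    2 ^ (3 · L) ∎
  K≤L : K ℕ.≤ L
  K≤L = subst (K ℕ.≤_) (DM.m*n/n≡m L q) (DM./-monoˡ-≤ q N≤Lq)
  error≤2y : error[ r ] ℕ.≤ 2 · y
  error≤2y = subst (error[ r ] ℕ.≤_) (cong (y ℕ.+_) (sym (ℕ.+-identityʳ y))) (ℕ.+-monoˡ-≤ y (2^mono (subst (ℕ._≤ e) (sym w≡) (ℕ.*-monoˡ-≤ (2 ^ r) {16} {3808} (ℕ.m≤m+n 16 3792)))))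
  error-small : 24 · J · (K · error[ r ]) ℕ.≤ f
  error-small = begin
    24 · J · (K · error[ r ]) ≤⟨ ℕ.*-monoʳ-≤ (24 · J) (ℕ.*-mono-≤ K≤L error≤2y) ⟩
    24 · J · (L · (2 · y)) ≡⟨ lem J L y ⟩
    x ≤⟨ x≤f ⟩
    f ∎
    where
    lem : ∀ J L y → 24 · J · (L · (2 · y)) ≡ 48 · J · L · y
    lem = solve-ℕ

-- Passage from integer ranges to rational bounds

<X⇒≤num : ∀ {X n} → ℕ→ℚ n < X → n ℕ.≤ ℤ.∣ ℚ.↥ X ∣
<X⇒≤num {X@(mkℚ (ℤ.+ m) d _)} {n} n<X with ℚᵘ.<-respˡ-≃ (toℚᵘ-/ (ℤ.+ n) 0) (ℚ.toℚᵘ-mono-< n<X)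
... | ℚᵘ.*<* h = ℕ.≤-trans (ℕ.m≤m*n n (suc d)) (ℕ.<⇒≤ (ℤ.drop‿+<+ (subst₂ ℤ._<_ (sym (ℤ.pos-* n (suc d))) (ℤ.*-identityʳ (ℤ.+ m)) h)))
<X⇒≤num {X@(mkℚ ℤ.-[1+ m ] d _)} {n} n<X with ℚᵘ.<-respˡ-≃ (toℚᵘ-/ (ℤ.+ n) 0) (ℚ.toℚᵘ-mono-< n<X)
... | ℚᵘ.*<* h with subst (ℤ._< ℤ.-[1+ m ] ℤ.* ℤ.+ 1) (sym (ℤ.pos-* n (suc d))) h
...   | ()

upTo⊆below : ∀ {N X} → ι N ≤ X → ∀ {x} → x ∈ upTo N → x ∈ below X
upTo⊆below {N} {X} N≤X {x} x∈ = ∈.∈-filter⁺ (λ p → ℕ→ℚ p ℚ.<? X) (∈.∈-upTo⁺ (s≤s (<X⇒≤num x<X))) x<X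
  where
  x<X : ℕ→ℚ x < X
  x<X = subst (_< X) (ι≡ℕ→ℚ x) (ℚ.<-≤-trans (ι-mono-< (∈.∈-upTo⁻ x∈)) N≤X)

below-< : ∀ {X x} → x ∈ below X → ι x < X
below-< {X} {x} x∈ = subst (_< X) (sym (ι≡ℕ→ℚ x)) (proj₂ (∈.∈-filter⁻ (λ p → ℕ→ℚ p ℚ.<? X) {xs = upTo (suc ℤ.∣ ℚ.↥ X ∣)} x∈))

recip*≤ : ∀ {m a b} .{{_ : NonZero m}} → a ℕ.≤ m · b → recip m * ℕ→ℚ a ≤ ℕ→ℚ b
recip*≤ {m} {a} {b} a≤mb = subst₂ (λ x y → recip m * x ≤ y) (ι≡ℕ→ℚ a) (ι≡ℕ→ℚ b) (*-cancel-≤ (0<ι m) (begin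
  ι m * (recip m * ι a) ≡⟨ ℚ.*-assoc (ι m) (recip m) (ι a) ⟨
  ι m * recip m * ι a ≡⟨ trans (cong (_* ι a) (ι-recip m)) (ℚ.*-identityˡ (ι a)) ⟩
  ι a ≤⟨ ι-mono-≤ a≤mb ⟩
  ι (m · b) ≡⟨ ι-* m b ⟩
  ι m * ι b ∎))
  where open ℚ.≤-Reasoning

0<φ : ∀ q .{{_ : NonZero q}} → 0 ℕ.< φ q
0<φ q = ℕ.n≢0⇒n>0 (λ φ≡0 → ℕ.≢-nonZero⁻¹ q (ℕ.n≤0⇒n≡0 (subst (λ x → q ℕ.≤ 2 · (x · x)) φ≡0 (q≤2φ² q))))

log-large : ∀ {L₀ q} → 2 ^ L₀ ℕ.≤ q → ∃[ L ] (L₀ ℕ.≤ L × 2 ^ L ℕ.≤ q × q ℕ.< 2 ^ suc L)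
log-large {L₀} {q} q≥ with log-floor 2 ℕ.≤-refl q {{ℕ.>-nonZero (ℕ.<-≤-trans (ℕ.m^n>0 2 L₀) q≥)}}
... | L , l , u = L , ℕ.≮⇒≥ (λ L<L₀ → ℕ.<⇒≱ u (ℕ.≤-trans (2^mono L<L₀) q≥)) , l , u

-- Matching on the auxiliary data happens in arguments and never by with, whose abstraction would normalise R X q.
lower-bound : ∀ {lam d} → 0ℚ < lam → 1ℚ ≤ ι d * lam → NonZero d →
  ∀ J .{{_ : NonZero J}} → J ≡ sieveConstant · (4 · d) →
  ∀ q .{{_ : NonZero q}} X → 0ℚ < X → lam ·φlog q ≤ X →
  ∃[ L ] (threshold J ℕ.≤ L × 2 ^ L ℕ.≤ q × q ℕ.< 2 ^ suc L) → φ q ℕ.≤ 12 · J · R X q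
lower-bound _ _ _ J _ q X _ _ (zero , t≤0 , _ , _) = contradiction (ℕ.≤-trans (scale≤threshold J) t≤0) (ℕ.<⇒≱ (ℕ.>-nonZero⁻¹ scale {{scale≢0}}))
lower-bound {lam} {d} 0<lam 1≤dlam d≢0 J J≡ q X 0<X log≤X (L@(suc m) , t≤L , l , u) =
  many-classes J q L (subst (sieveConstant ℕ.≤_) (sym J≡) (ℕ.m≤m*n sieveConstant (4 · d) {{4d≢0}})) t≤L l u (R X q)
    (subst (classes q (upTo N) ≤_) (sym (R≡classes X q)) (classes-mono q (upTo⊆below {N} {X} N≤X)))
  where
  4d≢0 : NonZero (4 · d)
  4d≢0 = ℕ.m*n≢0 4 d {{_}} {{d≢0}}
  open ℚ.≤-Reasoning
  D≤L : scale ℕ.≤ L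
  D≤L = ℕ.≤-trans (scale≤threshold J) t≤L
  1≤m : 1 ℕ.≤ m
  1≤m = ℕ.≤-pred (ℕ.≤-trans (subst (2 ℕ.≤_) (sym scale≡) (s≤s (s≤s z≤n))) D≤L)
  N = φ q · L / J
  f = ι (φ q)
  0<f : 0ℚ < f
  0<f = 0<ι (φ q) {{ℕ.>-nonZero (0<φ q)}}
  -- L is written as m + 1 because 2^m must lie strictly below q.
  X≥ : ι m * recip 2 * (lam * f) ≤ X
  X≥ = logBound⁻ {lam * f} {q} (0<* 0<lam 0<f) 0<X (subst (λ x → LogBound (lam * x) q X) (sym (ι≡ℕ→ℚ (φ q))) log≤X) m
    (ℕ.<-≤-trans (ℕ.^-monoʳ-< 2 ℕ.≤-refl (ℕ.n<1+n m)) l)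
  -- Origin of 4d in J: d from lam ≥ 1/d, one 2 from the loss m/2 in the exponential bound, and one
  -- 2 from L = m + 1 ≤ 2m.
  2dN≤ : 2 · d · N ℕ.≤ φ q · m
  2dN≤ = ℕ.*-cancelˡ-≤ 2 (≤ₙ.begin
    2 · (2 · d · N) ≤ₙ.≡⟨ lem d N ⟩
    4 · d · N ≤ₙ.≤⟨ ℕ.*-monoˡ-≤ N (subst (4 · d ℕ.≤_) (sym J≡) (ℕ.m≤n*m (4 · d) sieveConstant {{sieveConstant≢0}})) ⟩
    J · N ≤ₙ.≡⟨ ℕ.*-comm J N ⟩
    N · J ≤ₙ.≤⟨ DM.m/n*n≤m (φ q · L) J ⟩
    φ q · suc m ≤ₙ.≤⟨ ℕ.*-monoʳ-≤ (φ q) (ℕ.+-monoˡ-≤ m 1≤m) ⟩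
    φ q · (m ℕ.+ m) ≤ₙ.≡⟨ lem′ (φ q) m ⟩
    2 · (φ q · m) ≤ₙ.∎)
    where
    module ≤ₙ = ℕ.≤-Reasoning
    lem : ∀ d N → 2 · (2 · d · N) ≡ 4 · d · N
    lem = solve-ℕ
    lem′ : ∀ f m → f · (m ℕ.+ m) ≡ 2 · (f · m)
    lem′ = solve-ℕ
  N≤X : ι N ≤ X
  N≤X = ℚ.≤-trans (*-cancel-≤ (0<ι (2 · d) {{ℕ.m*n≢0 2 d {{_}} {{d≢0}}}}) (begin
    ι (2 · d) * ι N ≡⟨ ι-* (2 · d) N ⟨
    ι (2 · d · N) ≤⟨ ι-mono-≤ 2dN≤ ⟩
    ι (φ q · m) ≡⟨ trans (ι-* (φ q) m) (sym (ℚ.*-identityʳ (f * ι m))) ⟩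
    f * ι m * 1ℚ ≤⟨ *-monoʳ (0≤* (0≤ι (φ q)) (0≤ι m)) 1≤dlam ⟩
    f * ι m * (ι d * lam) ≡⟨ ℚ.*-identityˡ (f * ι m * (ι d * lam)) ⟨
    1ℚ * (f * ι m * (ι d * lam)) ≡⟨ cong (_* (f * ι m * (ι d * lam))) (ι-recip 2) ⟨
    ι 2 * recip 2 * (f * ι m * (ι d * lam)) ≡⟨ lem (ι 2) (recip 2) f (ι m) (ι d) lam ⟩
    ι 2 * ι d * (ι m * recip 2 * (lam * f)) ≡⟨ cong (_* (ι m * recip 2 * (lam * f))) (ι-* 2 d) ⟨
    ι (2 · d) * (ι m * recip 2 * (lam * f)) ∎)) X≥
    where
    lem : ∀ t h f m d l → t * h * (f * m * (d * l)) ≡ t * d * (m * h * (l * f))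
    lem = solve-∀ ℚ-ring

ManyClasses : ℚ → Set
ManyClasses lam = ∃[ c ] ∃[ q₀ ] (0ℚ < c ×
    (∀ (q : ℕ) → .{{_ : NonZero q}} → q ≥ q₀ →
      ∀ (X : ℚ) → 0ℚ < X → lam ·φlog q ≤ X →
        c * ℕ→ℚ (φ q) ≤ ℕ→ℚ (R X q)))

part-i : ∀ (lam : ℚ) → 0ℚ < lam → ManyClasses lam
part-i lam 0<lam = go (archimedean 0<lam)
  where
  go : ∃[ d ] (NonZero d × 1ℚ ≤ ι d * lam) → ManyClasses lam
  go (d , d≢0 , 1≤dlam) = recip (12 · J) , 2 ^ threshold J , 0<recip (12 · J) {{12J≢0}} ,
    λ q q≥q₀ X 0<X log≤X → recip*≤ {12 · J} {φ q} {R X q} {{12J≢0}}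
      (lower-bound 0<lam 1≤dlam d≢0 J {{J≢0}} refl q X 0<X log≤X (log-large q≥q₀))
    where
    J = sieveConstant · (4 · d)
    J≢0 : NonZero J
    J≢0 = ℕ.m*n≢0 sieveConstant (4 · d) {{sieveConstant≢0}} {{ℕ.m*n≢0 4 d {{_}} {{d≢0}}}}
    12J≢0 : NonZero (12 · J)
    12J≢0 = ℕ.m*n≢0 12 J {{_}} {{J≢0}}

-- The second part: a small X leaves too few primes

few-primes : ∀ {f p d s Y T} → 1 ℕ.≤ d → 2 ℕ.≤ s → f ℕ.≤ d · p → s · p ℕ.≤ s · 2 ^ s ℕ.+ 4 · Y →
  256 · d · Y ℕ.≤ T · f ℕ.+ 256 · d → T ℕ.≤ 16 · s → ¬ 4 · d · 2 ^ s ℕ.≤ f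
-- The primes below 2^s cost 64 s f, the main part of 4 · 256 d Y another 64 s f, and its rounding
-- 64 f ≤ 32 s f: 160 s f in all, against 256 s f.
few-primes {f} {p} {d} {s} {Y} {T} 1≤d 2≤s f≤dp sp≤ Y≤ T≤ big = ℕ.<⇒≱ 160<256 (begin
  256 · (s · f) ≤⟨ ℕ.*-monoʳ-≤ 256 (ℕ.*-monoʳ-≤ s f≤dp) ⟩
  256 · (s · (d · p)) ≡⟨ lem₁ 256 s d p ⟩
  256 · d · (s · p) ≤⟨ ℕ.*-monoʳ-≤ (256 · d) sp≤ ⟩
  256 · d · (s · y ℕ.+ 4 · Y) ≡⟨ lem₂ d s y Y ⟩
  64 · s · (4 · d · y) ℕ.+ 4 · (256 · d · Y) ≤⟨ ℕ.+-mono-≤ (ℕ.*-monoʳ-≤ (64 · s) big) (ℕ.*-monoʳ-≤ 4 (ℕ.≤-trans Y≤ (ℕ.+-mono-≤ (ℕ.*-monoˡ-≤ f T≤) 256d≤16f))) ⟩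
  64 · s · f ℕ.+ 4 · (16 · s · f ℕ.+ 16 · f) ≡⟨ lem₃ s f ⟩
  128 · (s · f) ℕ.+ 32 · (2 · f) ≤⟨ ℕ.+-monoʳ-≤ (128 · (s · f)) (ℕ.*-monoʳ-≤ 32 (ℕ.*-monoˡ-≤ f 2≤s)) ⟩
  128 · (s · f) ℕ.+ 32 · (s · f) ≡⟨ lem₄ (s · f) ⟩
  160 · (s · f) ∎)
  where
  open ℕ.≤-Reasoning
  y = 2 ^ s
  4≤y : 4 ℕ.≤ y
  4≤y = 2^mono {2} {s} 2≤s
  256d≤16f : 256 · d ℕ.≤ 16 · f
  256d≤16f = begin
    256 · d ≡⟨ lem d ⟩
    16 · (4 · d · 4) ≤⟨ ℕ.*-monoʳ-≤ 16 (ℕ.≤-trans (ℕ.*-monoʳ-≤ (4 · d) 4≤y) big) ⟩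
    16 · f ∎
    where
    lem : ∀ d → 256 · d ≡ 16 · (4 · d · 4)
    lem = solve-ℕ
  1≤f : 1 ℕ.≤ f
  1≤f = ℕ.≤-trans (ℕ.*-mono-≤ {1} {4 · d} {1} (ℕ.*-mono-≤ {1} {4} {1} (s≤s z≤n) 1≤d) (ℕ.m^n>0 2 s)) big
  160<256 : 160 · (s · f) ℕ.< 256 · (s · f)
  160<256 = ℕ.*-monoˡ-< (s · f) {{ℕ.m*n≢0 s f {{ℕ.>-nonZero (ℕ.<⇒≤ 2≤s)}} {{ℕ.>-nonZero 1≤f}}}} (ℕ.m<m+n 160 {96} (s≤s z≤n))
  lem₁ : ∀ c s d p → c · (s · (d · p)) ≡ c · d · (s · p)
  lem₁ = solve-ℕ
  lem₂ : ∀ d s y Y → 256 · d · (s · y ℕ.+ 4 · Y) ≡ 64 · s · (4 · d · y) ℕ.+ 4 · (256 · d · Y)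
  lem₂ = solve-ℕ
  lem₃ : ∀ s f → 64 · s · f ℕ.+ 4 · (16 · s · f ℕ.+ 16 · f) ≡ 128 · (s · f) ℕ.+ 32 · (2 · f)
  lem₃ = solve-ℕ
  lem₄ : ∀ x → 128 · x ℕ.+ 32 · x ≡ 160 · x
  lem₄ = solve-ℕ

-- 4d · 2^s is at most 2^(3s), and 2 · 2^(6s) ≤ 2^(8s) ≤ q, so q ≤ 2φ(q)² suffices.
φ-large : ∀ {d L q} .{{_ : NonZero q}} s → d ℕ.≤ s → 2 ℕ.≤ s → s · 8 ℕ.≤ L → 2 ^ L ℕ.≤ q → 4 · d · 2 ^ s ℕ.≤ φ q
φ-large {d} {L} {q} s d≤s 2≤s 8s≤L 2^L≤q = ≤φ {4 · d · y} {L} {q} 2^L≤q (begin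
  2 · (4 · d · y · (4 · d · y)) ≤⟨ ℕ.*-monoʳ-≤ 2 (ℕ.*-mono-≤ 4dy≤ 4dy≤) ⟩
  2 · (y · y · y · (y · y · y)) ≤⟨ ℕ.*-monoˡ-≤ (y · y · y · (y · y · y)) (ℕ.≤-trans (s≤s (s≤s z≤n)) (ℕ.*-mono-≤ 4≤y 4≤y)) ⟩
  y · y · (y · y · y · (y · y · y)) ≡⟨ lem y ⟩
  y ^ 8 ≡⟨ ℕ.^-*-assoc 2 s 8 ⟩
  2 ^ (s · 8) ≤⟨ 2^mono 8s≤L ⟩
  2 ^ L ∎)
  where
  open ℕ.≤-Reasoning
  y = 2 ^ s
  4≤y : 4 ℕ.≤ y
  4≤y = 2^mono {2} {s} 2≤s
  4dy≤ : 4 · d · y ℕ.≤ y · y · y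
  4dy≤ = ℕ.*-monoˡ-≤ y (ℕ.*-mono-≤ 4≤y (ℕ.≤-trans d≤s (ℕ.<⇒≤ (n<2^n s))))
  lem : ∀ y → y · y · (y · y · y · (y · y · y)) ≡ y · (y · (y · (y · (y · (y · (y · (y · 1)))))))
  lem = solve-ℕ

-- For smaller X at most π(Y) classes are hit, with Y just above (L + 1)φ(q)/(256 d). Chebyshev
-- makes this less than φ(q)/d, although c ≥ 1/d.
few-classes : ∀ {c d} → 1ℚ ≤ ι d * c → NonZero d →
  ∀ q .{{_ : NonZero q}} X → c * ℕ→ℚ (φ q) ≤ ℕ→ℚ (R X q) →
  ∀ L → 8 · (d ℕ.+ 2) ℕ.≤ L → 2 ^ L ℕ.≤ q → ¬ X < ι (suc L) * (recip (256 · d) * ι (φ q))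
few-classes {c} {d} 1≤dc d≢0 q X cφ≤R L L₀≤L l small =
  few-primes (ℕ.>-nonZero⁻¹ d {{d≢0}}) 2≤s φ≤dπ (π-upper s Y 2≤s) JY≤ T≤16s (φ-large {d} {L} {q} s d≤s 2≤s 8s≤L l)
  where
  J = 256 · d
  instance
    J≢0 : NonZero J
    J≢0 = ℕ.m*n≢0 256 d {{_}} {{d≢0}}
  open ℚ.≤-Reasoning
  T = suc L
  -- Small enough for 4d · 2^s ≤ φ(q), large enough for L + 1 ≤ 16 s.
  s = L / 8
  f = φ q
  Y = suc (T · f / J)
  8s≤L : s · 8 ℕ.≤ L
  8s≤L = DM.m/n*n≤m L 8
  d+2≤s : d ℕ.+ 2 ℕ.≤ s
  d+2≤s = subst (ℕ._≤ s) (trans (cong (_/ 8) (ℕ.*-comm 8 (d ℕ.+ 2))) (DM.m*n/n≡m (d ℕ.+ 2) 8)) (DM./-monoˡ-≤ 8 L₀≤L)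
  d≤s : d ℕ.≤ s
  d≤s = ℕ.≤-trans (ℕ.m≤m+n d 2) d+2≤s
  2≤s : 2 ℕ.≤ s
  2≤s = ℕ.≤-trans (ℕ.m≤n+m 2 d) d+2≤s
  T≤16s : T ℕ.≤ 16 · s
  T≤16s = ≤ₙ.begin
    suc L ≤ₙ.≡⟨ cong suc (DM.m≡m%n+[m/n]*n L 8) ⟩
    suc (L % 8) ℕ.+ s · 8 ≤ₙ.≤⟨ ℕ.+-monoˡ-≤ (s · 8) (DM.m%n<n L 8) ⟩
    8 ℕ.+ s · 8 ≤ₙ.≤⟨ ℕ.+-monoˡ-≤ (s · 8) (ℕ.*-monoˡ-≤ 8 (ℕ.<⇒≤ 2≤s)) ⟩
    s · 8 ℕ.+ s · 8 ≤ₙ.≡⟨ lem s ⟩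
    16 · s ≤ₙ.∎
    where
    module ≤ₙ = ℕ.≤-Reasoning
    lem : ∀ s → s · 8 ℕ.+ s · 8 ≡ 16 · s
    lem = solve-ℕ
  JY≤ : J · Y ℕ.≤ T · f ℕ.+ J
  JY≤ = ℕ.≤-trans (ℕ.≤-reflexive (trans (ℕ.*-suc J (T · f / J)) (trans (ℕ.+-comm J (J · (T · f / J))) (cong (ℕ._+ J) (ℕ.*-comm J (T · f / J))))))
    (ℕ.+-monoˡ-≤ J (DM.m/n*n≤m (T · f) J))
  below⊆upTo : ∀ {x} → x ∈ below X → x ∈ upTo Y
  below⊆upTo {x} x∈ = ∈.∈-upTo⁺ (s≤s (subst (ℕ._≤ T · f / J) (DM.m*n/n≡m x J) (DM./-monoˡ-≤ J xJ≤Tf)))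
    where
    xJ≤Tf : x · J ℕ.≤ T · f
    xJ≤Tf = ι-cancel-≤ (begin
      ι (x · J) ≡⟨ ι-* x J ⟩
      ι x * ι J ≤⟨ *-monoˡ (0≤ι J) (ℚ.<⇒≤ (ℚ.<-trans (below-< {X} x∈) small)) ⟩
      ι T * (recip J * ι f) * ι J ≡⟨ lem (ι T) (recip J) (ι f) (ι J) ⟩
      ι T * ι f * (ι J * recip J) ≡⟨ cong₂ _*_ (sym (ι-* T f)) (ι-recip J) ⟩
      ι (T · f) * 1ℚ ≡⟨ ℚ.*-identityʳ (ι (T · f)) ⟩
      ι (T · f) ∎)
      where
      lem : ∀ t r f j → t * (r * f) * j ≡ t * f * (j * r)
      lem = solve-∀ ℚ-ring
  R≤π : ι (R X q) ≤ ι (π Y)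
  R≤π = subst (_≤ ι (π Y)) (sym (R≡classes X q)) (ℚ.≤-trans (classes-mono q below⊆upTo) (classes≤π q Y))
  φ≤dπ : f ℕ.≤ d · π Y
  φ≤dπ = ι-cancel-≤ (begin
    ι f ≡⟨ ℚ.*-identityˡ (ι f) ⟨
    1ℚ * ι f ≤⟨ *-monoˡ (0≤ι f) 1≤dc ⟩
    ι d * c * ι f ≡⟨ ℚ.*-assoc (ι d) c (ι f) ⟩
    ι d * (c * ι f) ≤⟨ *-monoʳ (0≤ι d) (subst₂ (λ x y → c * x ≤ y) (sym (ι≡ℕ→ℚ f)) (sym (ι≡ℕ→ℚ (R X q))) cφ≤R) ⟩
    ι d * ι (R X q) ≤⟨ *-monoʳ (0≤ι d) R≤π ⟩
    ι d * ι (π Y) ≡⟨ ι-* d (π Y) ⟨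
    ι (d · π Y) ∎)

LogNecessary : ℚ → Set
LogNecessary c = ∃[ c′ ] ∃[ q₀ ] (0ℚ < c′ ×
    (∀ (q : ℕ) → .{{_ : NonZero q}} → q ≥ q₀ →
      ∀ (X : ℚ) → 0ℚ < X →
        c * ℕ→ℚ (φ q) ≤ ℕ→ℚ (R X q) → c′ ·φlog q ≤ X))

part-ii : ∀ (c : ℚ) → 0ℚ < c → LogNecessary c
part-ii c 0<c = go (archimedean 0<c)
  where
  go : ∃[ d ] (NonZero d × 1ℚ ≤ ι d * c) → LogNecessary c
  go (d , d≢0 , 1≤dc) = recip J , 2 ^ (8 · (d ℕ.+ 2)) , 0<recip J {{J≢0}} ,
    λ q q≥q₀ X 0<X cφ≤R → bound q X cφ≤R (log-large q≥q₀)
    where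
    J = 256 · d
    J≢0 : NonZero J
    J≢0 = ℕ.m*n≢0 256 d {{_}} {{d≢0}}
    bound : ∀ q .{{_ : NonZero q}} X → c * ℕ→ℚ (φ q) ≤ ℕ→ℚ (R X q) →
      ∃[ L ] (8 · (d ℕ.+ 2) ℕ.≤ L × 2 ^ L ℕ.≤ q × q ℕ.< 2 ^ suc L) → recip J ·φlog q ≤ X
    bound q X cφ≤R (L , L₀≤L , l , u) = subst (λ x → LogBound (recip J * x) q X) (ι≡ℕ→ℚ (φ q))
      (logBound⁺ (0<* (0<recip J {{J≢0}}) (0<ι (φ q) {{ℕ.>-nonZero (0<φ q)}})) (suc L) (ℕ.<⇒≤ u)
        (ℚ.≮⇒≥ (few-classes 1≤dc d≢0 q X cφ≤R L L₀≤L l)))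

theorem1p4 : (∀ (lam : ℚ) → 0ℚ < lam →
    ∃[ c ] ∃[ q₀ ] (0ℚ < c ×
    (∀ (q : ℕ) → .{{_ : NonZero q}} → q ≥ q₀ →
    ∀ (X : ℚ) → 0ℚ < X → lam ·φlog q ≤ X →
    c * ℕ→ℚ (φ q) ≤ ℕ→ℚ (R X q))))
    ×
    (∀ (c : ℚ) → 0ℚ < c →
    ∃[ c′ ] ∃[ q₀ ] (0ℚ < c′ ×
    (∀ (q : ℕ) → .{{_ : NonZero q}} → q ≥ q₀ →
    ∀ (X : ℚ) → 0ℚ < X →
    c * ℕ→ℚ (φ q) ≤ ℕ→ℚ (R X q) → c′ ·φlog q ≤ X)))
theorem1p4 = part-i , part-ii
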